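{- Let $\Gamma$ be any hereditary graph property and $\mathcal{G}$ any hereditary graph class satisfying both of the following. (1) (Large baseline) There is a constant $C_{\mathcal{G}}>0$ and a polynomial-time algorithm that, given any graph $G=(V,E)\in\mathcal{G}$, finds $S\subseteq V$ of size at least $|V|/C_{\mathcal{G}}$ such that $G[S]$ satisfies $\Gamma$. (2) (Constant approximation for deletion to $\Gamma$) There is a constant $\rho\ge1$ and a polynomial-time algorithm that, given any graph $G=(V,E)\in\mathcal{G}$, outputs $S'\subseteq V$ such that $G[V\setminus S']$ satisfies $\Gamma$ and $|S'|\le\rho\cdot\mathrm{dist}_\Gamma(G)$. Then for every $\varepsilon\ge1$, there is an $\varepsilon$-DP implicit representation scheme $(\mathcal{E},\mathcal{D})$, with a polynomial-time decoder $\mathcal{D}$, for Maximum Induced $\Gamma$-subgraph on graphs in $\mathcal{G}$ that is a $(1-O(1/\varepsilon))$-FPT-approximation algorithm, where the encoder $\mathcal{E}(G;k)$ runs in time $2^{O(k)}\cdot n^{O(1)}$.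
   Context: A graph property (or class) is hereditary if it is closed under vertex deletion. $G[S]$ is the induced subgraph on $S$. $\mathrm{dist}_\Gamma(G)$ is the smallest size of a set $S\subseteq V$ such that $G[V\setminus S]$ satisfies $\Gamma$. The algorithms in (1) and (2) need not be private. Maximum Induced $\Gamma$-subgraph: given $G=(V,E)$, find a maximum-size $S\subseteq V$ such that $G[S]$ satisfies $\Gamma$; $\mathrm{val}(G,S)=|S|$ and $\mathrm{opt}(G)$ is the optimum. Here $n=|V|$. Constants hidden in $O(\cdot)$ may depend on $\Gamma,\mathcal{G}$ (in particular on $\rho$ and $C_{\mathcal{G}}$). Neighbors: two graphs $G=(V,E)$, $G'=(V,E')$ on the same vertex set are neighbors if $|E\triangle E'|\le 1$. A randomized algorithm $\mathcal{M}$ is $\varepsilon$-DP if for all neighboring inputs $G\sim G'$ and all sets $\mathcal{S}$ of outcomes, $\Pr[\mathcal{M}(G)\in\mathcal{S}]\le e^{\varepsilon}\Pr[\mathcal{M}(G')\in\mathcal{S}]$. Implicit representation scheme: a pair consisting of an encoder $\mathcal{E}$, a randomized $\varepsilon$-DP algorithm (for each fixed value of the additional parameter $k$) that takes the input $G$ and $k$ and outputs an object $C$ in some representation space $\mathcal{C}$, and a decoder $\mathcal{D}$ that takes $G$ and $C\in\mathcal{C}$ and outputs a valid solution for $G$. The decoder runs in time polynomial in the size of the input $G$; its output need not be private. Approximation: for a maximization problem and $\alpha\le1$, $(\mathcal{E},\mathcal{D})$ is an $\alpha$-approximation algorithm if for every input $G$ and every $k\le\mathrm{opt}(G)$, $\mathbb{E}_{S\sim\mathcal{D}(G,\mathcal{E}(G;k))}[\mathrm{val}(G,S)]\ge\alpha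 k$. It is an $\alpha$-FPT-approximation algorithm if additionally $\mathcal{E}(G;k)$ runs in time $f(k)\cdot N^{O(1)}$ for some function $f$, where $N$ is the size of the input. -}

module Defs where

open import Level using (Level; _⊔_)
open import Data.Bool.Base using (Bool; true; false; if_then_else_)
import Data.Bool.Properties as Bool
open import Data.Fin.Base using (Fin; zero; suc)
import Data.Fin.Properties as Fin
open import Data.Fin.Subset using (Subset; ∣_∣; ∁; ⁅_⁆; inside; outside)
open import Data.Integer.Base using (+_)
open import Data.List.Base as List using (List; []; _∷_)
open import Data.List.Relation.Unary.All using (All)
open import Data.Maybe.Base as Maybe using (Maybe; just; nothing)
open import Data.Nat.Base using (ℕ; zero; suc; _+_; _*_; _∸_; _^_; _≤_; _≤ᵇ_)
open import Data.Nat.Logarithm using (⌈log₂_⌉)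
open import Data.Product.Base using (∃; ∃-syntax; _×_; _,_; proj₁; proj₂)
open import Data.Rational.Base as ℚ using (ℚ; 0ℚ; 1ℚ; _/_)
import Data.Rational.Properties as ℚₚ
open import Data.Sum.Base using (_⊎_; inj₁; inj₂)
open import Data.Unit.Base using (⊤; tt)
import Data.Vec.Base as Vec
open import Function.Base using (_∘_)
open import Function.Bundles using (_↔_; Inverse)
open import Relation.Binary.PropositionalEquality.Core using (_≡_)
open import Relation.Nullary.Decidable using (_×-dec_; ¬?; toWitness)

private variable
  m n : ℕ
  X Y : Set

------------------------------------------------------------------------
-- Real numbers

fromℕ : ℕ → ℚ
fromℕ n = + n / 1

-- Regular sequences in the sense of Bishop.

record ℝ : Set where
  field
    approx  : ℕ → ℚ
    regular : ∀ i j → ℚ.∣ approx i ℚ.- approx j ∣ ℚ.≤ + 1 / suc i ℚ.+ + 1 / suc j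

open ℝ public

-- A real-valued expression is represented by a convergent sequence of
-- rationals, without a prescribed rate of convergence.  Arithmetic is then
-- pointwise, and  x ≲ y  says  lim x ≤ lim y.

Seq : Set
Seq = ℕ → ℚ

const : ℚ → Seq
const q _ = q

infix 4 _≲_

_≲_ : Seq → Seq → Set
x ≲ y = ∀ δ → 0ℚ ℚ.< δ → ∃[ N ] ∀ i → N ≤ i → x i ℚ.≤ y i ℚ.+ δ

_≥1 : ℝ → Set
x ≥1 = const 1ℚ ≲ approx x

_>0 : ℝ → Set
x >0 = ∃[ δ ] 0ℚ ℚ.< δ × const δ ≲ approx x

expTerm : ℚ → ℕ → ℚ
expTerm x zero    = 1ℚ
expTerm x (suc i) = expTerm x i ℚ.* x ℚ.* (+ 1 / suc i)

expPartialSum : ℚ → ℕ → ℚ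
expPartialSum x zero    = expTerm x zero
expPartialSum x (suc i) = expPartialSum x i ℚ.+ expTerm x (suc i)

-- The approximations to x are bounded, so Σ_{j ≤ i} (approx x i)ʲ / j!
-- converges to eˣ as i → ∞.

exp : ℝ → Seq
exp x i = expPartialSum (approx x i) i

-- 1 - c / ε for ε ≥ 1.  Replacing the approximations of ε by their maximum
-- with 1 makes the division total and does not change the limit.

1-_/_ : ℕ → ℝ → Seq
(1- c / ε) i = 1ℚ ℚ.- fromℕ c ℚ.÷ ε′
  where
  ε′ : ℚ
  ε′ = 1ℚ ℚ.⊔ approx ε i
  instance
    ε′≢0 : ℚ.NonZero ε′
    ε′≢0 = ℚₚ.pos⇒nonZero ε′
      {{ℚ.positive (ℚₚ.<-≤-trans (toWitness {a? = 0ℚ ℚₚ.<? 1ℚ} tt) (ℚₚ.p≤p⊔q 1ℚ (approx ε i)))}}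

------------------------------------------------------------------------
-- Finitely supported distributions: lists of (probability , outcome)

Dist : Set → Set
Dist X = List (ℚ × X)

return : X → Dist X
return x = (1ℚ , x) ∷ []

infixl 1 _>>=_

_>>=_ : Dist X → (X → Dist Y) → Dist Y
d >>= f = List.concatMap (λ (p , x) → List.map (λ (q , y) → p ℚ.* q , y) (f x)) d

mapDist : (X → Y) → Dist X → Dist Y
mapDist f = List.map (λ (p , x) → p , f x)

-- Uniform on {0, …, m}.

uniform : ℕ → Dist ℕ
uniform m = List.map (λ i → + 1 / suc m , i) (List.upTo (suc m))

𝔼 : Dist X → (X → ℚ) → ℚ
𝔼 d f = List.foldr (λ (p , x) s → p ℚ.* f x ℚ.+ s) 0ℚ d

-- An arbitrary set of outcomes meets the finite support in a decidable set, so
-- Boolean-valued events suffice.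

Pr : Dist X → (X → Bool) → ℚ
Pr d S = 𝔼 d (λ x → if S x then 1ℚ else 0ℚ)

Always : ∀ {ℓ} → (X → Set ℓ) → Dist X → Set ℓ
Always P = All (P ∘ proj₂)

------------------------------------------------------------------------
-- Graphs

record Graph (n : ℕ) : Set where
  field
    adj     : Fin n → Fin n → Bool
    symm    : ∀ u v → adj u v ≡ adj v u
    irrefl  : ∀ v → adj v v ≡ false

open Graph public

infix 4 _≅_ _∼_

_≅_ : Graph m → Graph n → Set
_≅_ {m} {n} G H =
  ∃ λ (f : Fin m ↔ Fin n) → ∀ u v → adj G u v ≡ adj H (Inverse.to f u) (Inverse.to f v)

members : (S : Subset n) → Fin ∣ S ∣ → Fin n
members (inside  Vec.∷ S) zero    = zero
members (inside  Vec.∷ S) (suc i) = suc (members S i)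
members (outside Vec.∷ S) i       = suc (members S i)

-- The subgraph induced on S, with the vertices of S renumbered in order.

_[_] : Graph n → (S : Subset n) → Graph ∣ S ∣
G [ S ] = record
  { adj    = λ i j → adj G (members S i) (members S j)
  ; symm   = λ i j → symm G (members S i) (members S j)
  ; irrefl = λ i → irrefl G (members S i)
  }

-- E △ E′, each edge listed once as (u , v) with u < v.

edgeDifference : Graph n → Graph n → List (Fin n × Fin n)
edgeDifference {n} G G′ =
  List.filter (λ (u , v) → (u Fin.<? v) ×-dec ¬? (adj G u v Bool.≟ adj G′ u v))
              (List.cartesianProduct (List.allFin n) (List.allFin n))

_∼_ : Graph n → Graph n → Set
G ∼ G′ = List.length (edgeDifference G G′) ≤ 1

GraphPredicate : (ℓ : Level) → Set (Level.suc ℓ)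
GraphPredicate ℓ = ∀ {n} → Graph n → Set ℓ

-- Graph properties and graph classes are isomorphism-invariant.

record Hereditary {ℓ} (Γ : GraphPredicate ℓ) : Set ℓ where
  field
    invariant : ∀ {m n} (G : Graph m) (H : Graph n) → G ≅ H → Γ G → Γ H
    deletion  : ∀ {n} (G : Graph n) (v : Fin n) → Γ G → Γ (G [ ∁ ⁅ v ⁆ ])

IsDist : ∀ {ℓ} → GraphPredicate ℓ → Graph n → ℕ → Set ℓ
IsDist Γ G d = (∃[ S ] ∣ S ∣ ≡ d × Γ (G [ ∁ S ])) × (∀ S → Γ (G [ ∁ S ]) → d ≤ ∣ S ∣)

IsOpt : ∀ {ℓ} → GraphPredicate ℓ → Graph n → ℕ → Set ℓ
IsOpt Γ G o = (∃[ S ] ∣ S ∣ ≡ o × Γ (G [ S ])) × (∀ S → Γ (G [ S ]) → ∣ S ∣ ≤ o)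

------------------------------------------------------------------------
-- Algorithms
--
-- A programming language with unbounded loops over finite data, with the
-- logarithmic cost measure: an operation on numbers costs the number of
-- their binary digits, every other basic step costs 1.  Data structures are
-- never copied or traversed in a single step (think of pointers), so running
-- times agree with those of Turing machines up to a polynomial.  Randomness
-- comes from drawing uniformly from {0, …, m}.

infixr 6 _⊕_
infixr 7 _⊗_

data Ty : Set where
  𝟙 nat   : Ty
  _⊗_ _⊕_ : Ty → Ty → Ty
  list    : Ty → Ty

⟦_⟧ᵗ : Ty → Set
⟦ 𝟙 ⟧ᵗ      = ⊤
⟦ nat ⟧ᵗ    = ℕ
⟦ A ⊗ B ⟧ᵗ  = ⟦ A ⟧ᵗ × ⟦ B ⟧ᵗ
⟦ A ⊕ B ⟧ᵗ  = ⟦ A ⟧ᵗ ⊎ ⟦ B ⟧ᵗ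
⟦ list A ⟧ᵗ = List ⟦ A ⟧ᵗ

bool : Ty
bool = 𝟙 ⊕ 𝟙

bit : Bool → ⟦ bool ⟧ᵗ
bit true  = inj₁ tt
bit false = inj₂ tt

private variable
  A B C : Ty

infixr 5 _⨾_

data Prog : Ty → Ty → Set where
  skip           : Prog A A
  _⨾_            : Prog A B → Prog B C → Prog A C
  unit           : Prog A 𝟙
  pair           : Prog A B → Prog A C → Prog A (B ⊗ C)
  fst            : Prog (A ⊗ B) A
  snd            : Prog (A ⊗ B) B
  inl            : Prog A (A ⊕ B)
  inr            : Prog B (A ⊕ B)
  case           : ∀ {D} → Prog (A ⊗ C) D → Prog (B ⊗ C) D → Prog ((A ⊕ B) ⊗ C) D
  nil            : Prog A (list B)
  cons           : Prog (A ⊗ list A) (list A)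
  uncons         : Prog (list A) (𝟙 ⊕ (A ⊗ list A))
  literal        : ℕ → Prog A nat
  add monus mult : Prog (nat ⊗ nat) nat
  leq            : Prog (nat ⊗ nat) bool
  random         : Prog nat nat
  loop           : Prog A (A ⊕ B) → Prog A B

-- A computation receives a time budget and yields its result together with
-- the time left, or  nothing  if the budget does not suffice.

Comp : Set → Set
Comp X = ℕ → Dist (Maybe (X × ℕ))

andThen : Comp X → (X → Comp Y) → Comp Y
andThen {X = X} {Y = Y} c f t = c t >>= continue
  where
  continue : Maybe (X × ℕ) → Dist (Maybe (Y × ℕ))
  continue nothing         = return nothing
  continue (just (x , t′)) = f x t′

done : X → Comp X
done x t = return (just (x , t))

spend : ℕ → Comp X → Comp X
spend c k t = if c ≤ᵇ t then k (t ∸ c) else return nothing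

digits : ℕ → ℕ
digits n = ⌈log₂ suc n ⌉

-- The first argument bounds the number of iterations.  Each iteration takes
-- time at least 1, so a bound equal to the time budget is never restrictive.

iterate : ℕ → (X → Comp (X ⊎ Y)) → X → Comp Y
iterate zero _ _ _ = return nothing
iterate {X = X} {Y = Y} (suc i) f x = spend 1 (andThen (f x) next)
  where
  next : X ⊎ Y → Comp Y
  next (inj₁ x′) = iterate i f x′
  next (inj₂ y)  = done y

arithmetic : (ℕ → ℕ → X) → ℕ × ℕ → Comp X
arithmetic _∙_ (x , y) = spend (1 + digits x + digits y) (done (x ∙ y))

⟦_⟧ : Prog A B → ⟦ A ⟧ᵗ → Comp ⟦ B ⟧ᵗ
⟦ skip ⟧       x            = spend 1 (done x)
⟦ p ⨾ q ⟧      x            = spend 1 (andThen (⟦ p ⟧ x) ⟦ q ⟧)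
⟦ unit ⟧       x            = spend 1 (done tt)
⟦ pair p q ⟧   x            = spend 1 (andThen (⟦ p ⟧ x) λ y → andThen (⟦ q ⟧ x) λ z → done (y , z))
⟦ fst ⟧        (x , y)      = spend 1 (done x)
⟦ snd ⟧        (x , y)      = spend 1 (done y)
⟦ inl ⟧        x            = spend 1 (done (inj₁ x))
⟦ inr ⟧        x            = spend 1 (done (inj₂ x))
⟦ case p q ⟧   (inj₁ x , z) = spend 1 (⟦ p ⟧ (x , z))
⟦ case p q ⟧   (inj₂ y , z) = spend 1 (⟦ q ⟧ (y , z))
⟦ nil ⟧        x            = spend 1 (done [])
⟦ cons ⟧       (x , xs)     = spend 1 (done (x ∷ xs))
⟦ uncons ⟧     []           = spend 1 (done (inj₁ tt))
⟦ uncons ⟧     (x ∷ xs)     = spend 1 (done (inj₂ (x , xs)))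
⟦ literal n ⟧  x            = spend (1 + digits n) (done n)
⟦ add ⟧        x            = arithmetic _+_ x
⟦ monus ⟧      x            = arithmetic _∸_ x
⟦ mult ⟧       x            = arithmetic _*_ x
⟦ leq ⟧        x            = arithmetic (λ m n → bit (m ≤ᵇ n)) x
⟦ random ⟧     m            = spend (1 + digits m) λ t → mapDist (λ i → just (i , t)) (uniform m)
⟦ loop p ⟧     x            = λ t → iterate t ⟦ p ⟧ x t

-- On input x, whatever the random choices, p halts within time t, and its
-- output has distribution d.

infix 4 _⟨_⟩⇓[_]_

_⟨_⟩⇓[_]_ : Prog A B → ⟦ A ⟧ᵗ → ℕ → Dist ⟦ B ⟧ᵗ → Set
p ⟨ x ⟩⇓[ t ] d = mapDist (Maybe.map proj₁) (⟦ p ⟧ x t) ≡ mapDist just d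

-- Graphs are given by their adjacency matrix, vertex sets by their
-- characteristic vector.

graph vertices : Ty
graph    = list (list bool)
vertices = list bool

encodeGraph : Graph n → ⟦ graph ⟧ᵗ
encodeGraph G = List.tabulate λ u → List.tabulate λ v → bit (adj G u v)

encodeSubset : Subset n → ⟦ vertices ⟧ᵗ
encodeSubset S = List.map bit (Vec.toList S)

------------------------------------------------------------------------
-- The two hypotheses on Γ and 𝒢
--
-- The programs are deterministic, in that their output is a point mass.

module _ {ℓ₁ ℓ₂} (Γ : GraphPredicate ℓ₁) (𝒢 : GraphPredicate ℓ₂) where

  record LargeBaseline : Set (ℓ₁ ⊔ ℓ₂) where
    field
      constant  : ℝ
      positive  : constant >0
      algorithm : Prog graph vertices
      factor    : ℕ
      degree    : ℕ
      correct   : ∀ {n} (G : Graph n) → 𝒢 G → ∃[ S ]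
        algorithm ⟨ encodeGraph G ⟩⇓[ factor * suc n ^ degree ] return (encodeSubset S)
        × const (fromℕ n) ≲ (λ i → approx constant i ℚ.* fromℕ ∣ S ∣)
        × Γ (G [ S ])

  record DeletionApproximation : Set (ℓ₁ ⊔ ℓ₂) where
    field
      ρ         : ℝ
      ρ≥1       : ρ ≥1
      algorithm : Prog graph vertices
      factor    : ℕ
      degree    : ℕ
      correct   : ∀ {n} (G : Graph n) → 𝒢 G → ∃[ S ]
        algorithm ⟨ encodeGraph G ⟩⇓[ factor * suc n ^ degree ] return (encodeSubset S)
        × Γ (G [ ∁ S ])
        × (∀ d → IsDist Γ G d → const (fromℕ ∣ S ∣) ≲ (λ i → approx ρ i ℚ.* fromℕ d))

------------------------------------------------------------------------
-- Implicit representation schemes for Maximum Induced Γ-subgraph on 𝒢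

DifferentiallyPrivate : ∀ {ℓ} → GraphPredicate ℓ → ℝ → (∀ {n} → Graph n → Dist X) → Set ℓ
DifferentiallyPrivate 𝒢 ε M = ∀ {n} (G G′ : Graph n) → 𝒢 G → 𝒢 G′ → G ∼ G′ →
  ∀ S → const (Pr (M G) S) ≲ (λ i → exp ε i ℚ.* Pr (M G′) S)

module _ {ℓ₁ ℓ₂} (Γ : GraphPredicate ℓ₁) (𝒢 : GraphPredicate ℓ₂) where

  record ImplicitRepresentationScheme (ε : ℝ) : Set (Level.suc Level.zero ⊔ ℓ₁ ⊔ ℓ₂) where
    field
      Object         : Ty
      Space          : ⟦ Object ⟧ᵗ → Set

      encode         : ∀ {n} → Graph n → ℕ → Dist ⟦ Object ⟧ᵗ
      encoder        : Prog (graph ⊗ nat) Object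
      encodeTime     : ℕ → ℕ → ℕ
      encoder-runs   : ∀ {n} (G : Graph n) → 𝒢 G → ∀ k →
                       encoder ⟨ encodeGraph G , k ⟩⇓[ encodeTime n k ] encode G k
      encode-space   : ∀ {n} (G : Graph n) → 𝒢 G → ∀ k → Always Space (encode G k)
      encode-private : ∀ k → DifferentiallyPrivate 𝒢 ε (λ G → encode G k)

      decode         : ∀ {n} → Graph n → ⟦ Object ⟧ᵗ → Dist (Subset n)
      decoder        : Prog (graph ⊗ Object) vertices
      factor         : ℕ
      degree         : ℕ
      decoder-runs   : ∀ {n} (G : Graph n) → 𝒢 G → ∀ c → Space c →
                       decoder ⟨ encodeGraph G , c ⟩⇓[ factor * suc n ^ degree ]
                         mapDist encodeSubset (decode G c)
      decode-valid   : ∀ {n} (G : Graph n) → 𝒢 G → ∀ c → Space c →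
                       Always (λ S → Γ (G [ S ])) (decode G c)

  module _ {ε : ℝ} (Π : ImplicitRepresentationScheme ε) where
    open ImplicitRepresentationScheme Π

    IsApproximation : Seq → Set (ℓ₁ ⊔ ℓ₂)
    IsApproximation α = ∀ {n} (G : Graph n) → 𝒢 G → ∀ opt → IsOpt Γ G opt → ∀ k → k ≤ opt →
      (λ i → α i ℚ.* fromℕ k) ≲ const (𝔼 (encode G k >>= decode G) (λ S → fromℕ ∣ S ∣))

    IsFPTApproximation : Seq → Set (ℓ₁ ⊔ ℓ₂)
    IsFPTApproximation α = IsApproximation α ×
      (∃ λ (f : ℕ → ℕ) → ∃[ e ] ∀ n k → encodeTime n k ≤ f k * suc n ^ e)

{-# OPTIONS --safe #-}
-- The encoder samples a pair T ⊆ S of vertex sets with G [ T ] in Γ by an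
-- exponential mechanism and publishes S; the decoder runs the deletion
-- algorithm on G [ S ], which removes at most ρ |S ∖ T| vertices.  A vertex of T,
-- a vertex outside S and a vertex of S ∖ T have weights 2 ^ (m (1 + κ)),
-- 2 ^ (m κ) and 1, where κ ≥ ρ and m is proportional to ε.
--
-- Privacy: if only edges at u change, moving u from T to S ∖ T keeps S and, by
-- heredity, keeps G [ T ] in Γ.  At most two pairs collide and one weight drops
-- by a factor 2 ^ (m (1 + κ)), so no sum over pairs with given S changes by more
-- than a factor 1 + 2 ^ (m (1 + κ)), whose square is below e ^ ε.
--
-- Utility: of 3 ^ n pairs, those that lose much more than n / m against an
-- optimum have negligible weight.  If n > θ k for the baseline constant θ, the
-- decoder just uses the baseline; otherwise n = O(k), which makes the
-- enumeration affordable and the loss O(k / ε).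
--
-- Membership of G in Γ is decidable on 𝒢: it holds if and only if the deletion
-- algorithm removes nothing.

module Submission where

open import Defs
open import Data.Nat.Base using (ℕ; suc; _*_; _^_; _≤_)
open import Data.Product.Base using (∃; ∃-syntax; _×_)

open import Algebra.Properties.CommutativeSemigroup using (interchange)
open import Data.Bool.Base using (Bool; true; false; not; if_then_else_; T)
import Data.Bool.Properties as Bool
open import Data.Fin.Base as Fin using (Fin; zero; suc)
import Data.Fin.Properties as Fin
open import Data.Fin.Subset as Subset using (Subset; ∣_∣; ∁; ⁅_⁆; inside; outside)
import Data.Fin.Subset.Properties as Subset
open import Data.Integer.Base as ℤ using (+_)
import Data.Integer.Properties as ℤ
open import Data.List.Base as List using (List; []; _∷_; length; map; foldl; applyUpTo; upTo)
open import Data.List.Membership.Propositional using (_∈_)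
open import Data.List.Membership.Propositional.Properties using (∈-filter⁺; ∈-cartesianProduct⁺; ∈-allFin)
import Data.List.Properties as List
open import Data.List.Relation.Unary.Any using (here; there)
open import Data.List.Relation.Unary.All as All using (All; []; _∷_)
import Data.List.Relation.Unary.All.Properties as All
open import Data.Maybe.Base as Maybe using (Maybe; just; nothing)
import Data.Maybe.Relation.Unary.Any as MaybeAny
open import Data.Nat.Base using (zero; _+_; _∸_; _<_; _≤ᵇ_; z≤n; s≤s; >-nonZero; NonZero)
import Data.Nat.DivMod as ℕ
import Data.Nat.Induction as ℕ
open import Data.Nat.ListAction using (sum)
open import Data.Nat.Logarithm using (⌈log₂_⌉; ⌈log₂⌉-mono-≤; ⌈log₂2^n⌉≡n)
import Data.Nat.Properties as ℕ
open import Data.Nat.Tactic.RingSolver using (solve-∀)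
open import Data.Product.Base using (_,_; proj₁; proj₂; map₂)
open import Data.Rational.Base as ℚ using (ℚ; 0ℚ; 1ℚ)
open import Data.Rational.Unnormalised.Base as ℚᵘ using (mkℚᵘ; *≡*; *≤*)
import Data.Rational.Unnormalised.Properties as ℚᵘ
import Data.Rational.Properties as ℚ
open import Data.Sum.Base using (_⊎_; inj₁; inj₂; [_,_]′)
open import Data.Unit.Base using (⊤; tt)
import Data.Vec.Base as Vec
import Data.Vec.Properties as Vec
open import Function.Base using (_∘_; flip; id)
open import Function.Bundles using (mk↔ₛ′; module Equivalence)
open import Relation.Binary.PropositionalEquality
  using (_≡_; _≢_; refl; sym; trans; cong; cong₂; subst; subst₂; module ≡-Reasoning)
open import Relation.Binary.Definitions using (tri<; tri≈; tri>)
open import Relation.Nullary.Decidable using (yes; no; toWitness; decidable-stable)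
open import Relation.Nullary.Negation using (contradiction)

-- Running times

-- The base-2 logarithm of the weight of a pair, divided by m, is |T| - κ |S ∖ T| up to the shift κ
-- n. This is a lower bound on the size of the decoded set, so the weight of S alone is a soft
-- maximum of such bounds over T. Summing over T, instead of computing the best T, gives a weight
-- that is a product over the vertices, and a change of the graph is absorbed by a map between pairs
-- rather than by the sensitivity of an optimum.
--
-- Two demands of the statement shape the rest. The exponents of the time bound may not depend on ε,
-- while the literals of the encoder do; so running times are proved for families of programs
-- indexed by m, polynomial in a size that contains a factor for m. And `encode` and `decode` are
-- functions of every graph, without access to a proof of membership in 𝒢; so they are read off the
-- runs of the programs, and each program is shown to produce exactly the list of outcomes on which
-- probabilities are computed.

private variable
  X Y Z : Set
  A B C D E : Ty
  m n : ℕ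

mapDist-∘ : (g : Y → Z) (f : X → Y) (d : Dist X) → mapDist (g ∘ f) d ≡ mapDist g (mapDist f d)
mapDist-∘ g f = List.map-∘

≤ᵇ-true : ∀ {m n} → m ≤ n → (m ≤ᵇ n) ≡ true
≤ᵇ-true m≤n = Equivalence.to Bool.T-≡ (ℕ.≤⇒≤ᵇ m≤n)

Halted : Maybe X → Set
Halted = MaybeAny.Any (λ _ → ⊤)

AllHalted : Dist (Maybe X) → Set
AllHalted = All (Halted ∘ proj₂)

postpone : ℕ → Maybe (X × ℕ) → Maybe (X × ℕ)
postpone d = Maybe.map (map₂ (_+ d))

-- c′ agrees with c wherever c halts, and passes extra time on unchanged; the
-- second computation allows for the iteration bound of a loop to grow.
record Extends (c c′ : Comp X) : Set where
  constructor extends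
  field extension : ∀ t d → AllHalted (c t) → c′ (t + d) ≡ mapDist (postpone d) (c t)

open Extends

done-extends : (x : X) → Extends (done x) (done x)
done-extends x .extension t d _ = refl

spend-extends : ∀ n {c c′ : Comp X} → Extends c c′ → Extends (spend n c) (spend n c′)
spend-extends n {c} {c′} e .extension t d h with n ≤ᵇ t in eq
spend-extends n {c} {c′} e .extension t d (() ∷ _) | false
... | true = begin
  (if n ≤ᵇ t + d then c′ (t + d ∸ n) else return nothing)
    ≡⟨ cong (if_then c′ (t + d ∸ n) else return nothing) (≤ᵇ-true (ℕ.≤-trans n≤t (ℕ.m≤m+n t d))) ⟩
  c′ (t + d ∸ n)     ≡⟨ cong c′ (ℕ.+-∸-comm d n≤t) ⟩
  c′ (t ∸ n + d)     ≡⟨ e .extension (t ∸ n) d h ⟩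
  mapDist (postpone d) (c (t ∸ n)) ∎
  where
  open ≡-Reasoning
  n≤t = ℕ.≤ᵇ⇒≤ n t (subst T (sym eq) tt)

-- The function `continue` inside `andThen` is local and cannot be named here; `k` and `k′` stand
-- for two instances of it and are characterised by their equations.
bind-extends : ∀ d (f : X → Comp Y) (f′ : X → Comp Y) →
  (∀ x → Extends (f x) (f′ x)) →
  ∀ {k k′ : Maybe (X × ℕ) → Dist (Maybe (Y × ℕ))} →
  k nothing ≡ return nothing →
  (∀ x t → k (just (x , t)) ≡ f x t) → (∀ x t → k′ (just (x , t)) ≡ f′ x t) →
  (r : Dist (Maybe (X × ℕ))) → AllHalted (r >>= k) →
  AllHalted r × (mapDist (postpone d) r >>= k′) ≡ mapDist (postpone d) (r >>= k)
bind-extends d f f′ e k₀ k₁ k₁′ [] h = [] , refl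
bind-extends d f f′ e {k} k₀ k₁ k₁′ ((p , nothing) ∷ r) h with k nothing | k₀
bind-extends d f f′ e {k} k₀ k₁ k₁′ ((p , nothing) ∷ r) (() ∷ h) | _ | refl
bind-extends d f f′ e {k} {k′} k₀ k₁ k₁′ ((p , just (x , t)) ∷ r) h =
  let scale  = λ (q , y) → p ℚ.* q , y
      halted , eq = bind-extends d f f′ e {k} {k′} k₀ k₁ k₁′ r (All.++⁻ʳ (map scale (k (just (x , t)))) h)
      first  = All.map⁻ (All.++⁻ˡ (map scale (k (just (x , t)))) h)
      shift  = e x .extension t d (subst AllHalted (k₁ x t) first)
  in MaybeAny.just tt ∷ halted , (begin
    map scale (k′ (just (x , t + d))) List.++ _
      ≡⟨ cong₂ List._++_ (cong (map scale) (trans (k₁′ x (t + d)) (trans shift (cong (mapDist (postpone d)) (sym (k₁ x t))))))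
                         eq ⟩
    map scale (mapDist (postpone d) (k (just (x , t)))) List.++ mapDist (postpone d) (r >>= k)
      ≡⟨ cong (List._++ _) (trans (sym (List.map-∘ (k (just (x , t))))) (List.map-∘ (k (just (x , t))))) ⟩
    mapDist (postpone d) (map scale (k (just (x , t)))) List.++ mapDist (postpone d) (r >>= k)
      ≡⟨ List.map-++ _ (map scale (k (just (x , t)))) (r >>= k) ⟨
    mapDist (postpone d) (((p , just (x , t)) ∷ r) >>= k) ∎)
  where open ≡-Reasoning

bind-cong : {d d′ : Dist X} {k : X → Dist Y} → d ≡ d′ → (d >>= k) ≡ (d′ >>= k)
bind-cong refl = refl

andThen-extends : {c c′ : Comp X} {f f′ : X → Comp Y} →
  Extends c c′ → (∀ x → Extends (f x) (f′ x)) → Extends (andThen c f) (andThen c′ f′)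
andThen-extends {c = c} {c′} {f} {f′} e e′ .extension t d h =
  let halted , eq = bind-extends d f f′ e′ {k′ = _} refl (λ _ _ → refl) (λ _ _ → refl) (c t) h
  in trans (bind-cong (e .extension t d halted)) eq

iterate-extends : {f : X → Comp (X ⊎ Y)} → (∀ x → Extends (f x) (f x)) →
  ∀ i j x → Extends (iterate i f x) (iterate (i + j) f x)
iterate-extends e zero j x .extension t d (() ∷ _)
iterate-extends e (suc i) j x = spend-extends 1 (andThen-extends (e x) λ where
  (inj₁ x′) → iterate-extends e i j x′
  (inj₂ y)  → done-extends y)

draw : Dist X → Comp X
draw d t = mapDist (λ x → just (x , t)) d

draw-extends : (d : Dist X) → Extends (draw d) (draw d)
draw-extends dist .extension t d _ = mapDist-∘ (postpone d) (λ x → just (x , t)) dist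

run-extends : (p : Prog A B) → ∀ x → Extends (⟦ p ⟧ x) (⟦ p ⟧ x)
run-extends skip x = spend-extends 1 (done-extends x)
run-extends (p ⨾ q) x = spend-extends 1 (andThen-extends (run-extends p x) (run-extends q))
run-extends unit x = spend-extends 1 (done-extends _)
run-extends (pair p q) x = spend-extends 1 (andThen-extends (run-extends p x) λ y →
  andThen-extends (run-extends q x) λ z → done-extends (y , z))
run-extends fst x = spend-extends 1 (done-extends _)
run-extends snd x = spend-extends 1 (done-extends _)
run-extends inl x = spend-extends 1 (done-extends _)
run-extends inr x = spend-extends 1 (done-extends _)
run-extends (case p q) (inj₁ x , z) = spend-extends 1 (run-extends p (x , z))
run-extends (case p q) (inj₂ y , z) = spend-extends 1 (run-extends q (y , z))
run-extends nil x = spend-extends 1 (done-extends _)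
run-extends cons x = spend-extends 1 (done-extends _)
run-extends uncons [] = spend-extends 1 (done-extends _)
run-extends uncons (x ∷ xs) = spend-extends 1 (done-extends _)
run-extends (literal n) x = spend-extends (1 + digits n) (done-extends n)
run-extends add (x , y) = spend-extends (1 + digits x + digits y) (done-extends _)
run-extends monus (x , y) = spend-extends (1 + digits x + digits y) (done-extends _)
run-extends mult (x , y) = spend-extends (1 + digits x + digits y) (done-extends _)
run-extends leq (x , y) = spend-extends (1 + digits x + digits y) (done-extends _)
run-extends random m = spend-extends (1 + digits m) (draw-extends (uniform m))
run-extends (loop p) x .extension t d = iterate-extends (run-extends p) t d x .extension t d

-- T bounds the time that c uses up.
record HaltsWithin (c : Comp X) (x : X) (T : ℕ) : Set where
  constructor haltsWithin
  field outcome : ∀ t → ∃[ r ] t ≤ r × c (T + t) ≡ return (just (x , r))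

open HaltsWithin

-- A record rather than an abbreviation, because `⟦ p ⟧ x` reduces as soon as `p` is known; the
-- record keeps `p` and `x` visible to unification.
record Runs (p : Prog A B) (x : ⟦ A ⟧ᵗ) (y : ⟦ B ⟧ᵗ) (T : ℕ) : Set where
  constructor runs
  field halts : HaltsWithin (⟦ p ⟧ x) y T

open Runs

weaken : {c : Comp X} {x : X} {T T′ : ℕ} → T ≤ T′ → HaltsWithin c x T → HaltsWithin c x T′
weaken {c = c} {x} {T} {T′} T≤T′ h .outcome t with r , t≤r , eq ← h .outcome (T′ ∸ T + t) =
  r , ℕ.≤-trans (ℕ.m≤n+m t _) t≤r ,
  trans (cong c (trans (cong (_+ t) (sym (ℕ.m+[n∸m]≡n T≤T′))) (ℕ.+-assoc T _ t))) eq

within : {p : Prog A B} {x : ⟦ A ⟧ᵗ} {y : ⟦ B ⟧ᵗ} {T T′ : ℕ} → T ≤ T′ → Runs p x y T → Runs p x y T′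
within T≤T′ h .halts = weaken T≤T′ (h .halts)

done-halts : (x : X) → HaltsWithin (done x) x 0
done-halts x .outcome t = t , ℕ.≤-refl , refl

spend-true : ∀ n (c : Comp X) t → spend n c (n + t) ≡ c t
spend-true n c t
  rewrite ≤ᵇ-true (ℕ.m≤m+n n t) = cong c (ℕ.m+n∸m≡n n t)

spend-halts : ∀ n {c : Comp X} {x T} → HaltsWithin c x T → HaltsWithin (spend n c) x (n + T)
spend-halts n {c} {x} {T} h .outcome t with r , t≤r , eq ← h .outcome t =
  r , t≤r , trans (cong (spend n c) (ℕ.+-assoc n T t)) (trans (spend-true n c (T + t)) eq)

scale-1 : (d : Dist X) → map (λ (q , y) → 1ℚ ℚ.* q , y) d ≡ d
scale-1 d = trans (List.map-cong (λ (q , y) → cong (_, y) (ℚ.*-identityˡ q)) d) (List.map-id d)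

bind-return : {d : Dist X} {x : X} {k : X → Dist Y} → d ≡ return x → (d >>= k) ≡ k x
bind-return {x = x} {k} refl = trans (List.++-identityʳ _) (scale-1 (k x))

andThen-halts : {c : Comp X} {f : X → Comp Y} {x : X} {y : Y} {T T′ : ℕ} →
  HaltsWithin c x T → HaltsWithin (f x) y T′ → HaltsWithin (andThen c f) y (T + T′)
andThen-halts {c = c} {f} {x} {y} {T} {T′} h h′ .outcome t
  with r , t≤r , eq ← h .outcome (T′ + t)
  with r′ , t≤r′ , eq′ ← h′ .outcome (r ∸ T′) =
  r′ , ℕ.≤-trans (ℕ.m+n≤o⇒m≤o∸n t (subst (_≤ r) (ℕ.+-comm T′ t) t≤r)) t≤r′ , (begin
    andThen c f (T + T′ + t)        ≡⟨ bind-return (trans (cong c (ℕ.+-assoc T T′ t)) eq) ⟩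
    f x r                           ≡⟨ cong (f x) (ℕ.m+[n∸m]≡n (ℕ.m+n≤o⇒m≤o T′ t≤r)) ⟨
    f x (T′ + (r ∸ T′))             ≡⟨ eq′ ⟩
    return (just (y , r′))          ∎)
  where
  open ≡-Reasoning

seq : {p : Prog A B} {q : Prog B C} {x : ⟦ A ⟧ᵗ} {y : ⟦ B ⟧ᵗ} {z : ⟦ C ⟧ᵗ} {T T′ : ℕ} →
  Runs p x y T → Runs q y z T′ → Runs (p ⨾ q) x z (1 + (T + T′))
seq {q = q} h h′ .halts = spend-halts 1 (andThen-halts {f = ⟦ q ⟧} (h .halts) (h′ .halts))

both : {p : Prog A B} {q : Prog A C} {x : ⟦ A ⟧ᵗ} {y : ⟦ B ⟧ᵗ} {z : ⟦ C ⟧ᵗ} {T T′ : ℕ} →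
  Runs p x y T → Runs q x z T′ → Runs (pair p q) x (y , z) (1 + (T + (T′ + 0)))
both h h′ .halts = spend-halts 1 (andThen-halts (h .halts) (andThen-halts (h′ .halts) (done-halts _)))

onLeft : {p : Prog (A ⊗ C) D} {q : Prog (B ⊗ C) D} {x : ⟦ A ⟧ᵗ} {z : ⟦ C ⟧ᵗ} {y : ⟦ D ⟧ᵗ} {T : ℕ} →
  Runs p (x , z) y T → Runs (case p q) (inj₁ x , z) y (1 + T)
onLeft h .halts = spend-halts 1 (h .halts)

onRight : {p : Prog (A ⊗ C) D} {q : Prog (B ⊗ C) D} {x : ⟦ B ⟧ᵗ} {z : ⟦ C ⟧ᵗ} {y : ⟦ D ⟧ᵗ} {T : ℕ} →
  Runs q (x , z) y T → Runs (case p q) (inj₂ x , z) y (1 + T)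
onRight h .halts = spend-halts 1 (h .halts)

-- Result and running time of a program without arithmetic, random choices or
-- loops.  It reduces even on inputs that are only partly known.
exec : Prog A B → ⟦ A ⟧ᵗ → Maybe (⟦ B ⟧ᵗ × ℕ)
exec skip x = just (x , 1)
exec (p ⨾ q) x with exec p x
... | nothing = nothing
... | just (y , T) with exec q y
...   | nothing = nothing
...   | just (z , T′) = just (z , 1 + (T + T′))
exec unit x = just (tt , 1)
exec (pair p q) x with exec p x | exec q x
... | just (y , T) | just (z , T′) = just ((y , z) , 1 + (T + (T′ + 0)))
... | _            | _             = nothing
exec fst (x , y) = just (x , 1)
exec snd (x , y) = just (y , 1)
exec inl x = just (inj₁ x , 1)
exec inr x = just (inj₂ x , 1)
exec (case p q) (inj₁ x , z) = Maybe.map (map₂ suc) (exec p (x , z))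
exec (case p q) (inj₂ y , z) = Maybe.map (map₂ suc) (exec q (y , z))
exec nil x = just ([] , 1)
exec cons (x , xs) = just (x ∷ xs , 1)
exec uncons [] = just (inj₁ tt , 1)
exec uncons (x ∷ xs) = just (inj₂ (x , xs) , 1)
exec _ x = nothing

straight : (p : Prog A B) {x : ⟦ A ⟧ᵗ} {y : ⟦ B ⟧ᵗ} {T : ℕ} → exec p x ≡ just (y , T) → Runs p x y T
straight skip refl .halts = spend-halts 1 (done-halts _)
straight (p ⨾ q) {x} eq with exec p x in eq₁
... | just (y , T) with exec q y in eq₂
straight (p ⨾ q) {x} refl | just (y , T) | just (z , T′) = seq (straight p eq₁) (straight q eq₂)
straight unit refl .halts = spend-halts 1 (done-halts _)
straight (pair p q) {x} eq with exec p x in eq₁ | exec q x in eq₂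
straight (pair p q) {x} refl | just (y , T) | just (z , T′) = both (straight p eq₁) (straight q eq₂)
straight fst refl .halts = spend-halts 1 (done-halts _)
straight snd refl .halts = spend-halts 1 (done-halts _)
straight inl refl .halts = spend-halts 1 (done-halts _)
straight inr refl .halts = spend-halts 1 (done-halts _)
straight (case p q) {inj₁ x , z} eq with exec p (x , z) in eq₁
straight (case p q) {inj₁ x , z} refl | just (y , T) = onLeft {q = q} (straight p eq₁)
straight (case p q) {inj₂ x , z} eq with exec q (x , z) in eq₁
straight (case p q) {inj₂ x , z} refl | just (y , T) = onRight {p = p} (straight q eq₁)
straight nil refl .halts = spend-halts 1 (done-halts _)
straight cons refl .halts = spend-halts 1 (done-halts _)
straight uncons {[]} refl .halts = spend-halts 1 (done-halts _)
straight uncons {x ∷ xs} refl .halts = spend-halts 1 (done-halts _)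

mapDist-just⁻ : (d : Dist (Maybe (X × ℕ))) {x : X} →
  mapDist (Maybe.map proj₁) d ≡ return (just x) → ∃[ t ] d ≡ return (just (x , t))
mapDist-just⁻ ((p , just (x , t)) ∷ []) refl = t , refl

-- A specification speaks of the single budget `T`; `run-extends` carries the outcome to every
-- larger budget and hands the surplus on.
fromSpec : {p : Prog A B} {x : ⟦ A ⟧ᵗ} {y : ⟦ B ⟧ᵗ} {T : ℕ} → p ⟨ x ⟩⇓[ T ] return y → Runs p x y T
fromSpec {p = p} {x} {y} {T} h .halts .outcome t with r , eq ← mapDist-just⁻ (⟦ p ⟧ x T) h =
  r + t , ℕ.m≤n+m t r ,
  trans (run-extends p x .extension T t (subst AllHalted (sym eq) (MaybeAny.just tt ∷ [])))
        (cong (mapDist (postpone t)) eq)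

toSpec : {p : Prog A B} {x : ⟦ A ⟧ᵗ} {y : ⟦ B ⟧ᵗ} {T : ℕ} → Runs p x y T → p ⟨ x ⟩⇓[ T ] return y
toSpec {p = p} {x} {y} {T} h with r , _ , eq ← h .halts .outcome 0 =
  cong (mapDist (Maybe.map proj₁)) (trans (cong (⟦ p ⟧ x) (sym (ℕ.+-identityʳ T))) eq)

-- The time left may differ between random outcomes, so `e` records it for each of them, subject to
-- a common lower bound. Distributions are compared as lists, as the specification demands.
record HaltsRandomly (c : Comp X) (d : Dist X) (T : ℕ) : Set where
  field
    randomOutcome : ∀ t → ∃[ e ] All (λ (_ , _ , r) → t ≤ r) e × mapDist proj₁ e ≡ d × c (T + t) ≡ mapDist just e

open HaltsRandomly

record RunsRandomly (p : Prog A B) (x : ⟦ A ⟧ᵗ) (d : Dist ⟦ B ⟧ᵗ) (T : ℕ) : Set where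
  field haltsRandomly : HaltsRandomly (⟦ p ⟧ x) d T

open RunsRandomly

weakenRandomly : {c : Comp X} {d : Dist X} {T T′ : ℕ} → T ≤ T′ → HaltsRandomly c d T → HaltsRandomly c d T′
weakenRandomly {c = c} {d} {T} {T′} T≤T′ h .randomOutcome t
  with e , t≤ , eq , eq′ ← h .randomOutcome (T′ ∸ T + t) =
  e , All.map (ℕ.≤-trans (ℕ.m≤n+m t _)) t≤ , eq ,
  trans (cong c (trans (cong (_+ t) (sym (ℕ.m+[n∸m]≡n T≤T′))) (ℕ.+-assoc T _ t))) eq′

withinRandomly : {p : Prog A B} {x : ⟦ A ⟧ᵗ} {d : Dist ⟦ B ⟧ᵗ} {T T′ : ℕ} →
  T ≤ T′ → RunsRandomly p x d T → RunsRandomly p x d T′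
withinRandomly T≤T′ h .haltsRandomly = weakenRandomly T≤T′ (h .haltsRandomly)

pointMass : {p : Prog A B} {x : ⟦ A ⟧ᵗ} {y : ⟦ B ⟧ᵗ} {T : ℕ} → Runs p x y T → RunsRandomly p x (return y) T
pointMass h .haltsRandomly .randomOutcome t with r , t≤r , eq ← h .halts .outcome t =
  return (_ , r) , t≤r ∷ [] , refl , eq

spend-haltsRandomly : ∀ n {c : Comp X} {d T} → HaltsRandomly c d T → HaltsRandomly (spend n c) d (n + T)
spend-haltsRandomly n {c} {d} {T} h .randomOutcome t with e , t≤ , eq , eq′ ← h .randomOutcome t =
  e , t≤ , eq , trans (cong (spend n c) (ℕ.+-assoc n T t)) (trans (spend-true n c (T + t)) eq′)

andThen-haltsRandomly : {c : Comp X} {f : X → Comp Y} {x : X} {d : Dist Y} {T T′ : ℕ} →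
  HaltsWithin c x T → HaltsRandomly (f x) d T′ → HaltsRandomly (andThen c f) d (T + T′)
andThen-haltsRandomly {c = c} {f} {x} {d} {T} {T′} h h′ .randomOutcome t
  with r , t≤r , eq ← h .outcome (T′ + t)
  with e , t≤ , eq₁ , eq₂ ← h′ .randomOutcome (r ∸ T′) =
  e , All.map (ℕ.≤-trans (ℕ.m+n≤o⇒m≤o∸n t (subst (_≤ r) (ℕ.+-comm T′ t) t≤r))) t≤ , eq₁ ,
  trans (bind-return (trans (cong c (ℕ.+-assoc T T′ t)) eq))
        (trans (cong (f x) (sym (ℕ.m+[n∸m]≡n (ℕ.m+n≤o⇒m≤o T′ t≤r)))) eq₂)

-- A deterministic continuation suffices, because the encoder draws a random number only once. As
-- before, `k` stands for the local function of `andThen`.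
bind-map : {f : X → Comp Y} {g : X → Y} {k : Maybe (X × ℕ) → Dist (Maybe (Y × ℕ))} {T t : ℕ} →
  (∀ x r → k (just (x , r)) ≡ f x r) →
  (e : Dist (X × ℕ)) → All (λ (_ , x , _) → HaltsWithin (f x) (g x) T) e → All (λ (_ , _ , r) → T + t ≤ r) e →
  ∃[ e′ ] All (λ (_ , _ , r) → t ≤ r) e′ × mapDist proj₁ e′ ≡ mapDist g (mapDist proj₁ e) ×
    (mapDist just e >>= k) ≡ mapDist just e′
bind-map kf [] [] [] = [] , [] , refl , refl
bind-map {f = f} {g} {k} {T} {t} kf ((p , x , r) ∷ e) (h ∷ hs) (T≤ ∷ T≤s)
  with r′ , t≤r′ , eq ← h .outcome (r ∸ T)
  with e′ , t≤ , eq₁ , eq₂ ← bind-map {f = f} {g} {k} {T} kf e hs T≤s =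
  (p , g x , r′) ∷ e′ ,
  ℕ.≤-trans (ℕ.m+n≤o⇒m≤o∸n t (subst (_≤ r) (ℕ.+-comm T t) T≤)) t≤r′ ∷ t≤ ,
  cong (_ ∷_) eq₁ ,
  cong₂ List._++_
    (trans (cong (map _) (trans (kf x r) (trans (cong (f x) (sym (ℕ.m+[n∸m]≡n (ℕ.m+n≤o⇒m≤o T T≤)))) eq)))
           (cong (λ q → (q , just (g x , r′)) ∷ []) (ℚ.*-identityʳ p)))
    eq₂

random-andThen : {c : Comp X} {f : X → Comp Y} {d : Dist X} {g : X → Y} {T T′ : ℕ} →
  HaltsRandomly c d T → All (λ (_ , x) → HaltsWithin (f x) (g x) T′) d →
  HaltsRandomly (andThen c f) (mapDist g d) (T + T′)
random-andThen {c = c} {f} {d} {g} {T} {T′} h hs .randomOutcome t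
  with e , t≤ , refl , eq₂ ← h .randomOutcome (T′ + t)
  with e′ , t≤′ , eq₁ , eq₃ ← bind-map {f = f} {g} {T = T′} {t} (λ _ _ → refl) e (All.map⁻ hs) t≤ =
  e′ , t≤′ , eq₁ , trans (bind-cong (trans (cong c (ℕ.+-assoc T T′ t)) eq₂)) eq₃

seqRandomly : {p : Prog A B} {q : Prog B C} {x : ⟦ A ⟧ᵗ} {y : ⟦ B ⟧ᵗ} {d : Dist ⟦ C ⟧ᵗ} {T T′ : ℕ} →
  Runs p x y T → RunsRandomly q y d T′ → RunsRandomly (p ⨾ q) x d (1 + (T + T′))
seqRandomly {q = q} h h′ .haltsRandomly =
  spend-haltsRandomly 1 (andThen-haltsRandomly {f = ⟦ q ⟧} (h .halts) (h′ .haltsRandomly))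

randomly-seq : {p : Prog A B} {q : Prog B C} {x : ⟦ A ⟧ᵗ} {d : Dist ⟦ B ⟧ᵗ} (g : ⟦ B ⟧ᵗ → ⟦ C ⟧ᵗ) {T T′ : ℕ} →
  RunsRandomly p x d T → All (λ (_ , y) → Runs q y (g y) T′) d →
  RunsRandomly (p ⨾ q) x (mapDist g d) (1 + (T + T′))
randomly-seq g h hs .haltsRandomly =
  spend-haltsRandomly 1 (random-andThen (h .haltsRandomly) (All.map (λ h′ → h′ .halts) hs))

bothRandomly : {p : Prog A B} {q : Prog A C} {x : ⟦ A ⟧ᵗ} {d : Dist ⟦ B ⟧ᵗ} {z : ⟦ C ⟧ᵗ} {T T′ : ℕ} →
  RunsRandomly p x d T → Runs q x z T′ → RunsRandomly (pair p q) x (mapDist (_, z) d) (1 + (T + (T′ + 0)))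
bothRandomly {d = d} h h′ .haltsRandomly =
  spend-haltsRandomly 1 (random-andThen (h .haltsRandomly)
    (All.universal (λ _ → andThen-halts (h′ .halts) (done-halts _)) d))

onLeftRandomly : {p : Prog (A ⊗ C) D} {q : Prog (B ⊗ C) D} {x : ⟦ A ⟧ᵗ} {z : ⟦ C ⟧ᵗ} {d : Dist ⟦ D ⟧ᵗ} {T : ℕ} →
  RunsRandomly p (x , z) d T → RunsRandomly (case p q) (inj₁ x , z) d (1 + T)
onLeftRandomly h .haltsRandomly = spend-haltsRandomly 1 (h .haltsRandomly)

draw-halts : (d : Dist X) → HaltsRandomly (draw d) d 0
draw-halts d .randomOutcome t =
  mapDist (_, t) d , All.map⁺ (All.universal (λ _ → ℕ.≤-refl) d) ,
  trans (sym (mapDist-∘ proj₁ (_, t) d)) (List.map-id d) , mapDist-∘ just (_, t) d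

random-runs : ∀ m → RunsRandomly random m (uniform m) (1 + digits m + 0)
random-runs m .haltsRandomly = spend-haltsRandomly (1 + digits m) (draw-halts (uniform m))

toSpecRandomly : {p : Prog A B} {x : ⟦ A ⟧ᵗ} {d : Dist ⟦ B ⟧ᵗ} {T : ℕ} → RunsRandomly p x d T → p ⟨ x ⟩⇓[ T ] d
toSpecRandomly {p = p} {x} {d} {T} h with e , _ , refl , eq ← h .haltsRandomly .randomOutcome 0 = begin
  mapDist (Maybe.map proj₁) (⟦ p ⟧ x T)
    ≡⟨ cong (mapDist (Maybe.map proj₁)) (trans (cong (⟦ p ⟧ x) (sym (ℕ.+-identityʳ T))) eq) ⟩
  mapDist (Maybe.map proj₁) (mapDist just e) ≡⟨ mapDist-∘ (Maybe.map proj₁) just e ⟨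
  mapDist (just ∘ proj₁) e                   ≡⟨ mapDist-∘ just proj₁ e ⟩
  mapDist just (mapDist proj₁ e)             ∎
  where open ≡-Reasoning

literal-runs : ∀ n {x : ⟦ A ⟧ᵗ} → Runs (literal n) x n (1 + digits n + 0)
literal-runs n .halts = spend-halts (1 + digits n) (done-halts n)

add-runs : ∀ m n → Runs add (m , n) (m + n) (1 + digits m + digits n + 0)
add-runs m n .halts = spend-halts (1 + digits m + digits n) (done-halts _)

monus-runs : ∀ m n → Runs monus (m , n) (m ∸ n) (1 + digits m + digits n + 0)
monus-runs m n .halts = spend-halts (1 + digits m + digits n) (done-halts _)

mult-runs : ∀ m n → Runs mult (m , n) (m * n) (1 + digits m + digits n + 0)
mult-runs m n .halts = spend-halts (1 + digits m + digits n) (done-halts _)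

leq-runs : ∀ m n → Runs leq (m , n) (bit (m ≤ᵇ n)) (1 + digits m + digits n + 0)
leq-runs m n .halts = spend-halts (1 + digits m + digits n) (done-halts _)

-- Traversing lists

foldBody : Prog (A ⊗ B) B → Prog (list A ⊗ B) ((list A ⊗ B) ⊕ B)
foldBody p = pair (fst ⨾ uncons) snd ⨾ case (snd ⨾ inr) (pair (fst ⨾ snd) (pair (fst ⨾ fst) snd ⨾ p) ⨾ inl)

fold : Prog (A ⊗ B) B → Prog (list A ⊗ B) B
fold p = loop (foldBody p)

-- One round costs 20 steps besides `c`, which 30 covers; `suc l` includes the last round, which
-- finds the list empty.
foldCost : ℕ → ℕ → ℕ
foldCost c l = suc l * (30 + c)

overhead : ∀ c r → 19 + (c + 0 + 1 + r) ≤ 30 + c + r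
overhead c r rewrite ℕ.+-identityʳ c | ℕ.+-comm c 1 = ℕ.m≤n+m (20 + (c + r)) 10

module _ {p : Prog (A ⊗ B) B} {f : ⟦ B ⟧ᵗ → ⟦ A ⟧ᵗ → ⟦ B ⟧ᵗ} {c : ℕ} (P : List ⟦ A ⟧ᵗ → ⟦ B ⟧ᵗ → Set)
  (step : ∀ x xs b → P (x ∷ xs) b → Runs p (x , b) (f b x) c × P xs (f b x)) where

  -- The invariant `P` couples the accumulator with the items still unread. It is what bounds the
  -- numbers involved, on whose digits the cost `c` of a step depends.
  iterate-runs : ∀ xs b → P xs b → ∀ i → length xs < i →
    HaltsWithin (iterate i ⟦ foldBody p ⟧ (xs , b)) (foldl f b xs) (foldCost c (length xs))
  iterate-runs [] b Pb (suc i) _ =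
    weaken (ℕ.m≤m+n 11 _)
      (spend-halts 1 (andThen-halts (straight (foldBody p) refl .halts) (done-halts b)))
  iterate-runs (x ∷ xs) b Pb (suc i) (s≤s l<i) with run , Pb′ ← step x xs b Pb =
    weaken (overhead c (foldCost c (length xs)))
      (spend-halts 1 (andThen-halts (body .halts) (iterate-runs xs (f b x) Pb′ i l<i)))
    where
    body : Runs (foldBody p) (x ∷ xs , b) (inj₁ (xs , f b x)) _
    body = seq (straight (pair (fst ⨾ uncons) snd) refl)
      (onRight (seq (both (straight (fst ⨾ snd) refl) (seq (straight (pair (fst ⨾ fst) snd) refl) run)) (straight inl refl)))

  fold-runs : ∀ xs b → P xs b → Runs (fold p) (xs , b) (foldl f b xs) (foldCost c (length xs))
  fold-runs xs b Pb .halts .outcome t =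
    -- A loop takes its time budget as iteration bound, and the budget exceeds the length of the
    -- list.
    iterate-runs xs b Pb (foldCost c (length xs) + t) (ℕ.≤-trans bound (ℕ.m≤m+n _ t)) .outcome t
    where
    bound : length xs < foldCost c (length xs)
    bound = ℕ.m≤m*n (suc (length xs)) (30 + c)

-- Polynomial running times

-- One scale and one exponent serve all indices. The base `suc (s i)` is positive, so raising the
-- exponent never lowers the bound.
record PolyBounded {ℓᵢ} {I : Set ℓᵢ} (s : I → ℕ) (T : I → ℕ) : Set ℓᵢ where
  constructor polyBounded
  field
    scale    : ℕ
    exponent : ℕ
    bound    : ∀ i → T i ≤ scale * suc (s i) ^ exponent

open PolyBounded

poly-mono : ∀ {ℓᵢ} {I : Set ℓᵢ} {s T T′ : I → ℕ} → (∀ i → T i ≤ T′ i) → PolyBounded s T′ → PolyBounded s T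
poly-mono T≤T′ (polyBounded K e b) = polyBounded K e λ i → ℕ.≤-trans (T≤T′ i) (b i)

poly-reindex : ∀ {ℓᵢ ℓⱼ} {I : Set ℓᵢ} {J : Set ℓⱼ} {s T : I → ℕ} (π : J → I) →
  PolyBounded s T → PolyBounded (s ∘ π) (T ∘ π)
poly-reindex π (polyBounded K e b) = polyBounded K e (b ∘ π)

poly-const : ∀ {ℓᵢ} {I : Set ℓᵢ} {s : I → ℕ} (n : ℕ) → PolyBounded s (λ _ → n)
poly-const n = polyBounded n 0 λ i → ℕ.≤-reflexive (sym (ℕ.*-identityʳ n))

poly-size : ∀ {ℓᵢ} {I : Set ℓᵢ} {s : I → ℕ} → PolyBounded s s
poly-size {s = s} = polyBounded 1 1 λ i → ℕ.≤-trans (ℕ.n≤1+n (s i))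
  (ℕ.≤-reflexive (sym (trans (ℕ.*-identityˡ _) (ℕ.^-identityʳ _))))

poly-+ : ∀ {ℓᵢ} {I : Set ℓᵢ} {s T T′ : I → ℕ} → PolyBounded s T → PolyBounded s T′ → PolyBounded s (λ i → T i + T′ i)
poly-+ {s = s} {T} {T′} (polyBounded K e b) (polyBounded K′ e′ b′) = polyBounded (K + K′) (e + e′) λ i → begin
  T i + T′ i                                               ≤⟨ ℕ.+-mono-≤ (b i) (b′ i) ⟩
  K * suc (s i) ^ e + K′ * suc (s i) ^ e′
    ≤⟨ ℕ.+-mono-≤ (ℕ.*-monoʳ-≤ K (ℕ.^-monoʳ-≤ (suc (s i)) (ℕ.m≤m+n e e′)))
                  (ℕ.*-monoʳ-≤ K′ (ℕ.^-monoʳ-≤ (suc (s i)) (ℕ.m≤n+m e′ e))) ⟩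
  K * suc (s i) ^ (e + e′) + K′ * suc (s i) ^ (e + e′)     ≡⟨ ℕ.*-distribʳ-+ (suc (s i) ^ (e + e′)) K K′ ⟨
  (K + K′) * suc (s i) ^ (e + e′)                          ∎
  where open ℕ.≤-Reasoning

poly-* : ∀ {ℓᵢ} {I : Set ℓᵢ} {s T T′ : I → ℕ} → PolyBounded s T → PolyBounded s T′ → PolyBounded s (λ i → T i * T′ i)
poly-* {s = s} {T} {T′} (polyBounded K e b) (polyBounded K′ e′ b′) = polyBounded (K * K′) (e + e′) λ i → begin
  T i * T′ i                                   ≤⟨ ℕ.*-mono-≤ (b i) (b′ i) ⟩
  K * suc (s i) ^ e * (K′ * suc (s i) ^ e′)    ≡⟨ *-interchange K _ K′ _ ⟩
  K * K′ * (suc (s i) ^ e * suc (s i) ^ e′)    ≡⟨ cong (K * K′ *_) (ℕ.^-distribˡ-+-* (suc (s i)) e e′) ⟨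
  K * K′ * suc (s i) ^ (e + e′)                ∎
  where
  open ℕ.≤-Reasoning
  *-interchange = interchange ℕ.*-commutativeSemigroup

-- The programs are indexed because their literals vary with the privacy
-- parameter, on which the exponent of the time bound must not depend.
record Fast {ℓᵢ} {I : Set ℓᵢ} (s : I → ℕ) (p : I → Prog A B) (x : I → ⟦ A ⟧ᵗ) (y : I → ⟦ B ⟧ᵗ) : Set ℓᵢ where
  constructor fast
  field
    {time}   : I → ℕ
    run      : ∀ i → Runs (p i) (x i) (y i) (time i)
    timePoly : PolyBounded s time

open Fast

record FastRandom {ℓᵢ} {I : Set ℓᵢ} (s : I → ℕ) (p : I → Prog A B) (x : I → ⟦ A ⟧ᵗ) (d : I → Dist ⟦ B ⟧ᵗ) : Set ℓᵢ where
  constructor fastRandom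
  field
    {randomTime}   : I → ℕ
    randomRun      : ∀ i → RunsRandomly (p i) (x i) (d i) (randomTime i)
    randomTimePoly : PolyBounded s randomTime

open FastRandom

infixr 5 _⨾ᶠ_

_⨾ᶠ_ : ∀ {ℓᵢ} {I : Set ℓᵢ} {s : I → ℕ} {p : I → Prog A B} {q : I → Prog B C}
  {x : I → ⟦ A ⟧ᵗ} {y : I → ⟦ B ⟧ᵗ} {z : I → ⟦ C ⟧ᵗ} →
  Fast s p x y → Fast s q y z → Fast s (λ i → p i ⨾ q i) x z
fast r t ⨾ᶠ fast r′ t′ = fast (λ i → seq (r i) (r′ i)) (poly-+ (poly-const 1) (poly-+ t t′))

pairᶠ : ∀ {ℓᵢ} {I : Set ℓᵢ} {s : I → ℕ} {p : I → Prog A B} {q : I → Prog A C}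
  {x : I → ⟦ A ⟧ᵗ} {y : I → ⟦ B ⟧ᵗ} {z : I → ⟦ C ⟧ᵗ} →
  Fast s p x y → Fast s q x z → Fast s (λ i → pair (p i) (q i)) x (λ i → y i , z i)
pairᶠ (fast r t) (fast r′ t′) =
  fast (λ i → both (r i) (r′ i)) (poly-+ (poly-const 1) (poly-+ t (poly-+ t′ (poly-const 0))))

straightᶠ : ∀ {ℓᵢ} {I : Set ℓᵢ} {s : I → ℕ} (p : I → Prog A B) {x : I → ⟦ A ⟧ᵗ} {y : I → ⟦ B ⟧ᵗ} {T : ℕ} →
  (∀ i → exec (p i) (x i) ≡ just (y i , T)) → Fast s p x y
straightᶠ p eq = fast (λ i → straight (p i) (eq i)) (poly-const _)

fstᶠ : ∀ {ℓᵢ} {I : Set ℓᵢ} {s : I → ℕ} {x : I → ⟦ A ⊗ B ⟧ᵗ} → Fast s (λ _ → fst {A} {B}) x (proj₁ ∘ x)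
fstᶠ = straightᶠ (λ _ → fst) (λ _ → refl)

sndᶠ : ∀ {ℓᵢ} {I : Set ℓᵢ} {s : I → ℕ} {x : I → ⟦ A ⊗ B ⟧ᵗ} → Fast s (λ _ → snd {A} {B}) x (proj₂ ∘ x)
sndᶠ = straightᶠ (λ _ → snd) (λ _ → refl)

skipᶠ : ∀ {ℓᵢ} {I : Set ℓᵢ} {s : I → ℕ} {x : I → ⟦ A ⟧ᵗ} → Fast s (λ _ → skip) x x
skipᶠ = straightᶠ (λ _ → skip) (λ _ → refl)

consᶠ : ∀ {ℓᵢ} {I : Set ℓᵢ} {s : I → ℕ} {x : I → ⟦ A ⊗ list A ⟧ᵗ} → Fast s (λ _ → cons) x (λ i → proj₁ (x i) ∷ proj₂ (x i))
consᶠ = straightᶠ (λ _ → cons) (λ _ → refl)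

nilᶠ : ∀ {ℓᵢ} {I : Set ℓᵢ} {s : I → ℕ} {x : I → ⟦ A ⟧ᵗ} → Fast s (λ _ → nil {A} {B}) x (λ _ → [])
nilᶠ = straightᶠ (λ _ → nil) (λ _ → refl)

literalᶠ : ∀ {ℓᵢ} {I : Set ℓᵢ} {s : I → ℕ} {x : I → ⟦ A ⟧ᵗ} (n : I → ℕ) → PolyBounded s (digits ∘ n) →
  Fast s (λ i → literal (n i)) x n
literalᶠ n t = fast (λ i → literal-runs (n i)) (poly-+ (poly-+ (poly-const 1) t) (poly-const 0))

digitwise : ∀ {ℓᵢ} {I : Set ℓᵢ} {s T T′ : I → ℕ} → PolyBounded s T → PolyBounded s T′ →
  PolyBounded s (λ i → 1 + T i + T′ i + 0)
digitwise t t′ = poly-+ (poly-+ (poly-+ (poly-const 1) t) t′) (poly-const 0)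

module _ {ℓᵢ} {I : Set ℓᵢ} {s : I → ℕ} {x : I → ℕ × ℕ}
  (t : PolyBounded s (digits ∘ proj₁ ∘ x)) (t′ : PolyBounded s (digits ∘ proj₂ ∘ x)) where

  addᶠ : Fast s (λ _ → add) x (λ i → proj₁ (x i) + proj₂ (x i))
  addᶠ = fast (λ i → add-runs _ _) (digitwise t t′)

  monusᶠ : Fast s (λ _ → monus) x (λ i → proj₁ (x i) ∸ proj₂ (x i))
  monusᶠ = fast (λ i → monus-runs _ _) (digitwise t t′)

  multᶠ : Fast s (λ _ → mult) x (λ i → proj₁ (x i) * proj₂ (x i))
  multᶠ = fast (λ i → mult-runs _ _) (digitwise t t′)

  leqᶠ : Fast s (λ _ → leq) x (λ i → bit (proj₁ (x i) ≤ᵇ proj₂ (x i)))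
  leqᶠ = fast (λ i → leq-runs _ _) (digitwise t t′)

resultᶠ : ∀ {ℓᵢ} {I : Set ℓᵢ} {s : I → ℕ} {p : I → Prog A B} {x : I → ⟦ A ⟧ᵗ} {y y′ : I → ⟦ B ⟧ᵗ} →
  (∀ i → y i ≡ y′ i) → Fast s p x y → Fast s p x y′
resultᶠ {p = p} {x} eq (fast r t) = fast (λ i → subst (λ y → Runs (p i) (x i) y _) (eq i) (r i)) t

-- The step is timed over the index type of all states that satisfy the invariant, measured by the
-- size of the original input; this makes one polynomial valid for all rounds.
foldᶠ : ∀ {ℓᵢ} {I : Set ℓᵢ} {s : I → ℕ} {p : I → Prog (A ⊗ B) B} (P : I → List ⟦ A ⟧ᵗ → ⟦ B ⟧ᵗ → Set)
  (f : I → ⟦ B ⟧ᵗ → ⟦ A ⟧ᵗ → ⟦ B ⟧ᵗ) {xs : I → List ⟦ A ⟧ᵗ} {b : I → ⟦ B ⟧ᵗ} →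
  PolyBounded s (length ∘ xs) → (∀ i → P i (xs i) (b i)) →
  (∀ {i x xs b} → P i (x ∷ xs) b → P i xs (f i b x)) →
  Fast {I = ∃ λ i → ∃ λ x → ∃ λ xs → ∃ λ b → P i (x ∷ xs) b}
       (s ∘ proj₁) (p ∘ proj₁) (λ (i , x , xs , b , _) → x , b) (λ (i , x , xs , b , _) → f i b x) →
  Fast s (fold ∘ p) (λ i → xs i , b i) (λ i → foldl (f i) (b i) (xs i))
foldᶠ {s = s} P f {xs} {b} l P₀ P⁺ (fast {T} r (polyBounded K e t)) =
  fast (λ i → fold-runs (P i) (λ x xs b Pb → record { halts = weaken (t _) (r (i , x , xs , b , Pb) .halts) } , P⁺ Pb)
                        (xs i) (b i) (P₀ i))
       (poly-* (poly-+ (poly-const 1) l) (poly-+ (poly-const 30) (polyBounded K e λ i → ℕ.≤-refl)))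

swap : Prog (A ⊗ B) (B ⊗ A)
swap = pair snd fst

swapᶠ : ∀ {ℓᵢ} {I : Set ℓᵢ} {s : I → ℕ} {x : I → ⟦ A ⊗ B ⟧ᵗ} → Fast s (λ _ → swap) x (λ i → proj₂ (x i) , proj₁ (x i))
swapᶠ = straightᶠ (λ _ → swap) (λ _ → refl)

reverse : Prog (list A) (list A)
reverse = pair skip nil ⨾ fold cons

reverseᶠ : ∀ {ℓᵢ} {I : Set ℓᵢ} {s : I → ℕ} {xs : I → List ⟦ A ⟧ᵗ} →
  PolyBounded s (length ∘ xs) → Fast s (λ _ → reverse) xs (List.reverse ∘ xs)
reverseᶠ l = pairᶠ skipᶠ nilᶠ ⨾ᶠ foldᶠ (λ _ _ _ → ⊤) (λ _ → flip _∷_) l (λ _ → tt) (λ _ → tt) consᶠ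

-- A step of `fold` sees only its item and the accumulator, so the parameter of type `E` travels,
-- unchanged, in the accumulator.
mapWith : Prog (A ⊗ E) B → Prog (list A ⊗ E) (list B)
mapWith p =
  pair fst (pair nil snd) ⨾
  fold (pair (pair (pair fst (snd ⨾ snd) ⨾ p) (snd ⨾ fst) ⨾ cons) (snd ⨾ snd)) ⨾
  fst ⨾ reverse

foldl-snoc : {Z : Set} (f : X → Y) (e : Z) (xs : List X) (acc : List Y) →
  foldl (λ (ys , e) x → f x ∷ ys , e) (acc , e) xs ≡ (map f xs List.ʳ++ acc , e)
foldl-snoc f e []       acc = refl
foldl-snoc f e (x ∷ xs) acc = foldl-snoc f e xs (f x ∷ acc)

mapWithᶠ : ∀ {ℓᵢ} {I : Set ℓᵢ} {s : I → ℕ} {p : I → Prog (A ⊗ E) B} {e : I → ⟦ E ⟧ᵗ} {xs : I → List ⟦ A ⟧ᵗ}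
  (Q : I → ⟦ A ⟧ᵗ → Set) (f : I → ⟦ A ⟧ᵗ → ⟦ B ⟧ᵗ) →
  PolyBounded s (length ∘ xs) → (∀ i → All (Q i) (xs i)) →
  Fast {I = ∃ λ i → ∃ λ x → Q i x} (s ∘ proj₁) (p ∘ proj₁) (λ (i , x , _) → x , e i) (λ (i , x , _) → f i x) →
  Fast s (mapWith ∘ p) (λ i → xs i , e i) (λ i → map (f i) (xs i))
mapWithᶠ {s = s} {p} {e} {xs} Q f l Q-xs (fast {T} r t) =
  pairᶠ fstᶠ (pairᶠ nilᶠ sndᶠ) ⨾ᶠ
  resultᶠ (λ i → foldl-snoc (f i) (e i) (xs i) [])
    (foldᶠ (λ i xs (_ , e′) → All (Q i) xs × e′ ≡ e i) (λ i (ys , e) x → f i x ∷ ys , e) l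
      (λ i → Q-xs i , refl) (λ { (_ ∷ qs , eq) → qs , eq })
      (pairᶠ (pairᶠ (pairᶠ fstᶠ (sndᶠ ⨾ᶠ sndᶠ) ⨾ᶠ item) (sndᶠ ⨾ᶠ fstᶠ) ⨾ᶠ consᶠ) (sndᶠ ⨾ᶠ sndᶠ))) ⨾ᶠ
  fstᶠ ⨾ᶠ
  resultᶠ (λ i → List.reverse-involutive (map (f i) (xs i)))
    (reverseᶠ (poly-mono (λ i → ℕ.≤-reflexive (trans (List.length-reverse (map (f i) (xs i))) (List.length-map (f i) (xs i)))) l))
  where
  item : Fast {I = ∃ λ i → ∃ λ x → ∃ λ xs → ∃ λ (b : _ × _) → All (Q i) (x ∷ xs) × proj₂ b ≡ e i}
    (s ∘ proj₁) (p ∘ proj₁) (λ (i , x , xs , b , _) → x , proj₂ b) (λ (i , x , xs , b , _) → f i x)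
  item = fast {time = λ (i , x , _ , _ , qs , _) → T (i , x , All.head qs)}
    (λ { (i , x , _ , (_ , .(e i)) , (q ∷ _ , refl)) → r (i , x , q) })
    (polyBounded (t .scale) (t .exponent) λ (i , x , _ , _ , qs , _) → t .bound (i , x , All.head qs))

-- Masks of every length are accepted, because the decoder has to cope with every object of the
-- space and not only with characteristic vectors of the right length. A short mask counts as padded
-- with `inj₂ tt`, a long one as truncated; `toSubset` agrees with this.
select : List (⊤ ⊎ ⊤) → List X → List X
select _               []       = []
select []              (x ∷ xs) = []
select (inj₁ _ ∷ mask) (x ∷ xs) = x ∷ select mask xs
select (inj₂ _ ∷ mask) (x ∷ xs) = select mask xs

select-[] : (xs : List X) → select [] xs ≡ []
select-[] []      = refl
select-[] (_ ∷ _) = refl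

selectNext : List (⊤ ⊎ ⊤) × List X → X → List (⊤ ⊎ ⊤) × List X
selectNext ([]            , ys) x = [] , ys
selectNext (inj₁ _ ∷ mask , ys) x = mask , x ∷ ys
selectNext (inj₂ _ ∷ mask , ys) x = mask , ys

foldl-selectNext : (mask : List (⊤ ⊎ ⊤)) (xs ys : List X) →
  proj₂ (foldl selectNext (mask , ys) xs) ≡ select mask xs List.ʳ++ ys
foldl-selectNext mask            []       ys = refl
foldl-selectNext []              (x ∷ xs) ys = trans (foldl-selectNext [] xs ys) (cong (List._ʳ++ ys) (select-[] xs))
foldl-selectNext (inj₁ _ ∷ mask) (x ∷ xs) ys = foldl-selectNext mask xs (x ∷ ys)
foldl-selectNext (inj₂ _ ∷ mask) (x ∷ xs) ys = foldl-selectNext mask xs ys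

length-select : (mask : List (⊤ ⊎ ⊤)) (xs : List X) → length (select mask xs) ≤ length xs
length-select mask            []       = z≤n
length-select []              (x ∷ xs) = z≤n
length-select (inj₁ _ ∷ mask) (x ∷ xs) = s≤s (length-select mask xs)
length-select (inj₂ _ ∷ mask) (x ∷ xs) = ℕ.m≤n⇒m≤1+n (length-select mask xs)

selectStep : Prog (A ⊗ vertices ⊗ list A) (vertices ⊗ list A)
selectStep =
  pair (snd ⨾ fst ⨾ uncons) skip ⨾
  case (pair nil (snd ⨾ snd ⨾ snd))
       (pair (fst ⨾ fst) (pair (fst ⨾ snd) snd) ⨾
        case (pair (snd ⨾ fst) (pair (snd ⨾ snd ⨾ fst) (snd ⨾ snd ⨾ snd ⨾ snd) ⨾ cons))
             (pair (snd ⨾ fst) (snd ⨾ snd ⨾ snd ⨾ snd)))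

selectStep-runs : (x : ⟦ A ⟧ᵗ) (b : ⟦ vertices ⊗ list A ⟧ᵗ) → Runs selectStep (x , b) (selectNext b x) 60
selectStep-runs x ([] , ys)              = within (ℕ.m≤m+n _ _) (straight selectStep refl)
selectStep-runs x ((inj₁ _ ∷ mask) , ys) = within (ℕ.m≤m+n _ _) (straight selectStep refl)
selectStep-runs x ((inj₂ _ ∷ mask) , ys) = within (ℕ.m≤m+n _ _) (straight selectStep refl)

selectBy : Prog (list A ⊗ vertices) (list A)
selectBy = pair fst (pair snd nil) ⨾ fold selectStep ⨾ snd ⨾ reverse

selectByᶠ : ∀ {ℓᵢ} {I : Set ℓᵢ} {s : I → ℕ} {xs : I → List ⟦ A ⟧ᵗ} {mask : I → List (⊤ ⊎ ⊤)} → PolyBounded s (length ∘ xs) →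
  Fast s (λ _ → selectBy) (λ i → xs i , mask i) (λ i → select (mask i) (xs i))
selectByᶠ {xs = xs} {mask} l =
  pairᶠ fstᶠ (pairᶠ sndᶠ nilᶠ) ⨾ᶠ
  foldᶠ (λ _ _ _ → ⊤) (λ _ → selectNext) l (λ _ → tt) (λ _ → tt)
    (fast (λ (_ , x , _ , b , _) → selectStep-runs x b) (poly-const 60)) ⨾ᶠ
  resultᶠ (λ i → foldl-selectNext (mask i) (xs i) []) sndᶠ ⨾ᶠ
  resultᶠ (λ i → List.reverse-involutive (select (mask i) (xs i)))
    (reverseᶠ (poly-mono (λ i → ℕ.≤-trans (ℕ.≤-reflexive (List.length-reverse (select (mask i) (xs i))))
                                          (length-select (mask i) (xs i))) l))

induced : Prog (graph ⊗ vertices) graph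
induced = pair selectBy snd ⨾ mapWith selectBy

inducedᶠ : ∀ {ℓᵢ} {I : Set ℓᵢ} {s : I → ℕ} {g : I → ⟦ graph ⟧ᵗ} {mask : I → List (⊤ ⊎ ⊤)} →
  PolyBounded s (length ∘ g) → (∀ i → All (λ row → length row ≤ s i) (g i)) →
  Fast s (λ _ → induced) (λ i → g i , mask i) (λ i → map (select (mask i)) (select (mask i) (g i)))
inducedᶠ {s = s} {g} {mask} l rows =
  pairᶠ (selectByᶠ l) sndᶠ ⨾ᶠ
  mapWithᶠ (λ i row → length row ≤ s i) (λ i → select (mask i))
    (poly-mono (λ i → length-select (mask i) (g i)) l)
    (λ i → all-select (mask i) (rows i))
    (selectByᶠ (poly-mono (λ (_ , _ , row≤) → row≤) poly-size))
  where
  all-select : {P : X → Set} (mask : List (⊤ ⊎ ⊤)) {xs : List X} → All P xs → All P (select mask xs)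
  all-select mask            []       = []
  all-select []              (p ∷ ps) = []
  all-select (inj₁ _ ∷ mask) (p ∷ ps) = p ∷ all-select mask ps
  all-select (inj₂ _ ∷ mask) (p ∷ ps) = all-select mask ps

-- deleted is a mask for the members of S only; the rows just fix the length of
-- the result.
survivors : List X → (S deleted : List (⊤ ⊎ ⊤)) → List (⊤ ⊎ ⊤)
survivors []         S            deleted                = []
survivors (_ ∷ rows) []           deleted                = inj₂ tt ∷ survivors rows [] deleted
survivors (_ ∷ rows) (inj₂ _ ∷ S) deleted                = inj₂ tt ∷ survivors rows S deleted
survivors (_ ∷ rows) (inj₁ _ ∷ S) []                     = inj₂ tt ∷ survivors rows S []
survivors (_ ∷ rows) (inj₁ _ ∷ S) (inj₁ _ ∷ deleted)     = inj₂ tt ∷ survivors rows S deleted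
survivors (_ ∷ rows) (inj₁ _ ∷ S) (inj₂ _ ∷ deleted)     = inj₁ tt ∷ survivors rows S deleted

survivorsState : Set
survivorsState = List (⊤ ⊎ ⊤) × List (⊤ ⊎ ⊤) × List (⊤ ⊎ ⊤)

survivorsNext : survivorsState → survivorsState
survivorsNext ([]         , deleted            , ys) = [] , deleted , inj₂ tt ∷ ys
survivorsNext (inj₂ _ ∷ S , deleted            , ys) = S  , deleted , inj₂ tt ∷ ys
survivorsNext (inj₁ _ ∷ S , []                 , ys) = S  , []      , inj₂ tt ∷ ys
survivorsNext (inj₁ _ ∷ S , (inj₁ _ ∷ deleted) , ys) = S  , deleted , inj₂ tt ∷ ys
survivorsNext (inj₁ _ ∷ S , (inj₂ _ ∷ deleted) , ys) = S  , deleted , inj₁ tt ∷ ys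

foldl-survivorsNext : (rows : List X) (S deleted ys : List (⊤ ⊎ ⊤)) →
  proj₂ (proj₂ (foldl (λ b _ → survivorsNext b) (S , deleted , ys) rows)) ≡ survivors rows S deleted List.ʳ++ ys
foldl-survivorsNext []         S            deleted            ys = refl
foldl-survivorsNext (_ ∷ rows) []           deleted            ys = foldl-survivorsNext rows [] deleted _
foldl-survivorsNext (_ ∷ rows) (inj₂ _ ∷ S) deleted            ys = foldl-survivorsNext rows S deleted _
foldl-survivorsNext (_ ∷ rows) (inj₁ _ ∷ S) []                 ys = foldl-survivorsNext rows S [] _
foldl-survivorsNext (_ ∷ rows) (inj₁ _ ∷ S) (inj₁ _ ∷ deleted) ys = foldl-survivorsNext rows S deleted _
foldl-survivorsNext (_ ∷ rows) (inj₁ _ ∷ S) (inj₂ _ ∷ deleted) ys = foldl-survivorsNext rows S deleted _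

length-survivors : (rows : List X) (S deleted : List (⊤ ⊎ ⊤)) → length (survivors rows S deleted) ≡ length rows
length-survivors []         S            deleted            = refl
length-survivors (_ ∷ rows) []           deleted            = cong suc (length-survivors rows [] deleted)
length-survivors (_ ∷ rows) (inj₂ _ ∷ S) deleted            = cong suc (length-survivors rows S deleted)
length-survivors (_ ∷ rows) (inj₁ _ ∷ S) []                 = cong suc (length-survivors rows S [])
length-survivors (_ ∷ rows) (inj₁ _ ∷ S) (inj₁ _ ∷ deleted) = cong suc (length-survivors rows S deleted)
length-survivors (_ ∷ rows) (inj₁ _ ∷ S) (inj₂ _ ∷ deleted) = cong suc (length-survivors rows S deleted)

survivorsStep : Prog (A ⊗ vertices ⊗ vertices ⊗ vertices) (vertices ⊗ vertices ⊗ vertices)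
survivorsStep =
  pair (snd ⨾ fst ⨾ uncons) (snd ⨾ snd) ⨾
  case (pair nil (snd ⨾ reject))
       (pair (fst ⨾ fst) (pair (fst ⨾ snd) snd) ⨾
        case (pair (snd ⨾ snd ⨾ fst ⨾ uncons) snd ⨾
              case (snd ⨾ pair fst (snd ⨾ reject))
                   (pair (fst ⨾ fst) (pair (snd ⨾ fst) (pair (fst ⨾ snd) (snd ⨾ snd ⨾ snd))) ⨾
                    case (snd ⨾ pair fst (snd ⨾ reject)) (snd ⨾ pair fst (snd ⨾ accept))))
             (snd ⨾ pair fst (snd ⨾ reject)))
  where
  reject accept : Prog (vertices ⊗ vertices) (vertices ⊗ vertices)
  reject = pair fst (pair (unit ⨾ inr) snd ⨾ cons)
  accept = pair fst (pair (unit ⨾ inl) snd ⨾ cons)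

survivorsStep-runs : (x : ⟦ A ⟧ᵗ) (b : survivorsState) → Runs survivorsStep (x , b) (survivorsNext b) 150
survivorsStep-runs x ([] , deleted , ys)                       = within (ℕ.m≤m+n _ _) (straight survivorsStep refl)
survivorsStep-runs x ((inj₂ _ ∷ S) , deleted , ys)             = within (ℕ.m≤m+n _ _) (straight survivorsStep refl)
survivorsStep-runs x ((inj₁ _ ∷ S) , [] , ys)                  = within (ℕ.m≤m+n _ _) (straight survivorsStep refl)
survivorsStep-runs x ((inj₁ _ ∷ S) , (inj₁ _ ∷ deleted) , ys)  = within (ℕ.m≤m+n _ _) (straight survivorsStep refl)
survivorsStep-runs x ((inj₁ _ ∷ S) , (inj₂ _ ∷ deleted) , ys)  = within (ℕ.m≤m+n _ _) (straight survivorsStep refl)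

removeDeleted : Prog (graph ⊗ vertices ⊗ vertices) vertices
removeDeleted = pair fst (pair (snd ⨾ fst) (pair (snd ⨾ snd) nil)) ⨾ fold survivorsStep ⨾ snd ⨾ snd ⨾ reverse

removeDeletedᶠ : ∀ {ℓᵢ} {I : Set ℓᵢ} {s : I → ℕ} {g : I → ⟦ graph ⟧ᵗ} {S deleted : I → List (⊤ ⊎ ⊤)} →
  PolyBounded s (length ∘ g) →
  Fast s (λ _ → removeDeleted) (λ i → g i , S i , deleted i) (λ i → survivors (g i) (S i) (deleted i))
removeDeletedᶠ {g = g} {S} {deleted} l =
  pairᶠ fstᶠ (pairᶠ (sndᶠ ⨾ᶠ fstᶠ) (pairᶠ (sndᶠ ⨾ᶠ sndᶠ) nilᶠ)) ⨾ᶠ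
  foldᶠ (λ _ _ _ → ⊤) (λ _ b _ → survivorsNext b) l (λ _ → tt) (λ _ → tt)
    (fast (λ (_ , x , _ , b , _) → survivorsStep-runs x b) (poly-const 150)) ⨾ᶠ
  sndᶠ ⨾ᶠ
  resultᶠ (λ i → foldl-survivorsNext (g i) (S i) (deleted i) []) sndᶠ ⨾ᶠ
  resultᶠ (λ i → List.reverse-involutive (survivors (g i) (S i) (deleted i)))
    (reverseᶠ (poly-mono (λ i → ℕ.≤-reflexive (trans (List.length-reverse (survivors (g i) (S i) (deleted i)))
                                                     (length-survivors (g i) (S i) (deleted i)))) l))

-- Induced subgraphs

index : {S : Subset n} {v : Fin n} → v Subset.∈ S → ∃[ i ] members S i ≡ v
index Vec.here = zero , refl
index {S = inside  Vec.∷ S} (Vec.there v∈S) with i , eq ← index v∈S = suc i , cong suc eq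
index {S = outside Vec.∷ S} (Vec.there v∈S) with i , eq ← index v∈S = i , cong suc eq

members-injective : (S : Subset n) {i j : Fin ∣ S ∣} → members S i ≡ members S j → i ≡ j
members-injective (inside  Vec.∷ S) {zero}  {zero}  _  = refl
members-injective (inside  Vec.∷ S) {suc i} {suc j} eq = cong suc (members-injective S (Fin.suc-injective eq))
members-injective (outside Vec.∷ S) {i}     {j}     eq = members-injective S (Fin.suc-injective eq)

module _ {ℓ} {Γ : GraphPredicate ℓ} (her : Hereditary Γ) where
  open Hereditary her

  -- Vertices outside the range of f are deleted one at a time.
  embedded : (G : Graph n) (H : Graph m) (f : Fin m → Fin n) →
    (∀ {i j} → f i ≡ f j → i ≡ j) → (∀ i j → adj H i j ≡ adj G (f i) (f j)) → Γ G → Γ H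
  embedded {n} {m} G H f inj eq γ = go n ℕ.≤-refl G f inj eq γ
    where
    go : ∀ N {n} → n ≤ N → (G : Graph n) (f : Fin m → Fin n) →
      (∀ {i j} → f i ≡ f j → i ≡ j) → (∀ i j → adj H i j ≡ adj G (f i) (f j)) → Γ G → Γ H
    go N {n} n≤N G f inj eq γ with Fin.all? (λ v → Fin.any? (λ i → f i Fin.≟ v))
    ... | yes onto = invariant G H (mk↔ₛ′ (proj₁ ∘ onto) f (λ i → inj (proj₂ (onto (f i)))) (proj₂ ∘ onto) ,
          λ u v → trans (cong₂ (adj G) (sym (proj₂ (onto u))) (sym (proj₂ (onto v)))) (sym (eq _ _))) γ
    ... | no ¬onto with v , v∉ ← Fin.¬∀⟶∃¬ n _ (λ v → Fin.any? (λ i → f i Fin.≟ v)) ¬onto = smaller N n≤N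
      where
      rest = ∁ ⁅ v ⁆
      f′ : ∀ i → ∃[ j ] members rest j ≡ f i
      f′ i = index (Subset.x∉p⇒x∈∁p λ fi∈ → v∉ (i , Subset.x∈⁅y⁆⇒x≡y v fi∈))
      size : suc ∣ rest ∣ ≤ n
      size = ℕ.≤-reflexive (trans (cong suc (trans (Subset.∣∁p∣≡n∸∣p∣ ⁅ v ⁆) (cong (n ∸_) (Subset.∣⁅x⁆∣≡1 v))))
                                  (ℕ.m+[n∸m]≡n (ℕ.≤-trans (s≤s z≤n) (Fin.toℕ<n v))))
      smaller : ∀ N → n ≤ N → Γ H
      smaller zero    n≤0   = contradiction (ℕ.≤-trans size n≤0) λ ()
      smaller (suc N) n≤1+N = go N (ℕ.≤-pred (ℕ.≤-trans size n≤1+N)) (G [ rest ]) (proj₁ ∘ f′)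
        (λ {i} {j} e → inj (trans (sym (proj₂ (f′ i))) (trans (cong (members rest) e) (proj₂ (f′ j)))))
        (λ i j → trans (eq i j) (cong₂ (adj G) (sym (proj₂ (f′ i))) (sym (proj₂ (f′ j)))))
        (deletion G v γ)

  induced-her : (G : Graph n) (S : Subset n) → Γ G → Γ (G [ S ])
  induced-her G S = embedded G (G [ S ]) (members S) (members-injective S) (λ _ _ → refl)

-- Masks as vertex sets

toBool : ⊤ ⊎ ⊤ → Bool
toBool (inj₁ _) = true
toBool (inj₂ _) = false

toSubset : ∀ n → List (⊤ ⊎ ⊤) → Subset n
toSubset zero    _          = Vec.[]
toSubset (suc n) []         = outside Vec.∷ toSubset n []
toSubset (suc n) (b ∷ mask) = toBool b Vec.∷ toSubset n mask

toSubset-encode : (S : Subset n) → toSubset n (encodeSubset S) ≡ S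
toSubset-encode Vec.[]              = refl
toSubset-encode (inside  Vec.∷ S) = cong (inside Vec.∷_) (toSubset-encode S)
toSubset-encode (outside Vec.∷ S) = cong (outside Vec.∷_) (toSubset-encode S)

select-tabulate : ∀ {n} (mask : List (⊤ ⊎ ⊤)) (f : Fin n → X) →
  select mask (List.tabulate f) ≡ List.tabulate (f ∘ members (toSubset n mask))
select-tabulate {n = zero}  mask            f = refl
select-tabulate {n = suc n} []              f = trans (sym (select-[] (List.tabulate (f ∘ suc)))) (select-tabulate [] (f ∘ suc))
select-tabulate {n = suc n} (inj₁ _ ∷ mask) f = cong (f zero ∷_) (select-tabulate mask (f ∘ suc))
select-tabulate {n = suc n} (inj₂ _ ∷ mask) f = select-tabulate mask (f ∘ suc)

select-encodeGraph : (G : Graph n) (mask : List (⊤ ⊎ ⊤)) →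
  map (select mask) (select mask (encodeGraph G)) ≡ encodeGraph (G [ toSubset n mask ])
select-encodeGraph {n} G mask = begin
  map (select mask) (select mask (encodeGraph G))
    ≡⟨ cong (map (select mask)) (select-tabulate mask row) ⟩
  map (select mask) (List.tabulate (λ i → List.tabulate (λ v → bit (adj G (members S i) v))))
    ≡⟨ List.map-tabulate _ (select mask) ⟩
  List.tabulate (λ i → select mask (List.tabulate (λ v → bit (adj G (members S i) v))))
    ≡⟨ List.tabulate-cong (λ i → select-tabulate mask (λ v → bit (adj G (members S i) v))) ⟩
  encodeGraph (G [ S ]) ∎
  where
  open ≡-Reasoning
  S = toSubset n mask
  row = λ u → List.tabulate (λ v → bit (adj G u v))

without : (S : Subset n) → Subset ∣ S ∣ → Subset n
without Vec.[]            _           = Vec.[]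
without (inside  Vec.∷ S) (d Vec.∷ D) = not d Vec.∷ without S D
without (outside Vec.∷ S) D           = outside Vec.∷ without S D

∣without∣ : (S : Subset n) (D : Subset ∣ S ∣) → ∣ without S D ∣ + ∣ D ∣ ≡ ∣ S ∣
∣without∣ Vec.[]            Vec.[]            = refl
∣without∣ (inside  Vec.∷ S) (inside  Vec.∷ D) = trans (ℕ.+-suc _ _) (cong suc (∣without∣ S D))
∣without∣ (inside  Vec.∷ S) (outside Vec.∷ D) = cong suc (∣without∣ S D)
∣without∣ (outside Vec.∷ S) D                 = ∣without∣ S D

members-without : (S : Subset n) (D : Subset ∣ S ∣) (i : Fin ∣ without S D ∣) →
  ∃[ j ] members S (members (∁ D) j) ≡ members (without S D) i
members-without (inside  Vec.∷ S) (inside  Vec.∷ D) i with j , eq ← members-without S D i = j , cong suc eq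
members-without (inside  Vec.∷ S) (outside Vec.∷ D) zero = zero , refl
members-without (inside  Vec.∷ S) (outside Vec.∷ D) (suc i) with j , eq ← members-without S D i = suc j , cong suc eq
members-without (outside Vec.∷ S) D i with j , eq ← members-without S D i = j , cong suc eq

survivors-encode : ∀ {n} (f : Fin n → X) (mask : List (⊤ ⊎ ⊤)) (D : Subset ∣ toSubset n mask ∣) →
  survivors (List.tabulate f) mask (encodeSubset D) ≡ encodeSubset (without (toSubset n mask) D)
survivors-encode {n = zero}  f mask            D                 = refl
survivors-encode {n = suc n} f []              D                 = cong (_ ∷_) (survivors-encode (f ∘ suc) [] D)
survivors-encode {n = suc n} f (inj₂ _ ∷ mask) D                 = cong (_ ∷_) (survivors-encode (f ∘ suc) mask D)
survivors-encode {n = suc n} f (inj₁ _ ∷ mask) (inside  Vec.∷ D) = cong (_ ∷_) (survivors-encode (f ∘ suc) mask D)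
survivors-encode {n = suc n} f (inj₁ _ ∷ mask) (outside Vec.∷ D) = cong (_ ∷_) (survivors-encode (f ∘ suc) mask D)

-- The two graphs agree up to a renumbering of their vertices. Heredity asks only for an embedding,
-- which spares an isomorphism between vertex types of different form.
without-her : ∀ {ℓ} {Γ : GraphPredicate ℓ} → Hereditary Γ → (G : Graph n) (S : Subset n) (D : Subset ∣ S ∣) →
  Γ ((G [ S ]) [ ∁ D ]) → Γ (G [ without S D ])
without-her her G S D = embedded her _ _ (λ i → proj₁ (members-without S D i))
  (λ {i} {j} eq → members-injective (without S D)
    (trans (sym (proj₂ (members-without S D i)))
           (trans (cong (members S ∘ members (∁ D)) eq) (proj₂ (members-without S D j)))))
  (λ i j → cong₂ (adj G) (sym (proj₂ (members-without S D i))) (sym (proj₂ (members-without S D j))))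

-- A candidate is a pair T ⊆ S of vertex sets: chosen for T, added for S ∖ T,
-- omitted for the complement of S.

data Status : Set where
  chosen omitted added : Status

Candidate : ℕ → Set
Candidate = Vec.Vec Status

core support : Candidate n → Subset n
core Vec.[]                 = Vec.[]
core (chosen  Vec.∷ σ)      = inside Vec.∷ core σ
core (omitted Vec.∷ σ)      = outside Vec.∷ core σ
core (added   Vec.∷ σ)      = outside Vec.∷ core σ
support Vec.[]              = Vec.[]
support (chosen  Vec.∷ σ)   = inside Vec.∷ support σ
support (omitted Vec.∷ σ)   = outside Vec.∷ support σ
support (added   Vec.∷ σ)   = inside Vec.∷ support σ

-- This is S ∖ T in the numbering of `G [ S ]`, the form in which the guarantee of the deletion
-- algorithm on that graph measures it.
noise : (σ : Candidate n) → Subset ∣ support σ ∣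
noise Vec.[]            = Vec.[]
noise (chosen  Vec.∷ σ) = outside Vec.∷ noise σ
noise (omitted Vec.∷ σ) = noise σ
noise (added   Vec.∷ σ) = inside Vec.∷ noise σ

members-noise : (σ : Candidate n) (i : Fin ∣ ∁ (noise σ) ∣) →
  ∃[ j ] members (core σ) j ≡ members (support σ) (members (∁ (noise σ)) i)
members-noise (chosen  Vec.∷ σ) zero = zero , refl
members-noise (chosen  Vec.∷ σ) (suc i) with j , eq ← members-noise σ i = suc j , cong suc eq
members-noise (omitted Vec.∷ σ) i with j , eq ← members-noise σ i = j , cong suc eq
members-noise (added   Vec.∷ σ) i with j , eq ← members-noise σ i = j , cong suc eq

noise-her : ∀ {ℓ} {Γ : GraphPredicate ℓ} → Hereditary Γ → (G : Graph n) (σ : Candidate n) →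
  Γ (G [ core σ ]) → Γ ((G [ support σ ]) [ ∁ (noise σ) ])
noise-her her G σ = embedded her _ _ (λ i → proj₁ (members-noise σ i))
  (λ {i} {j} eq → members-injective (∁ (noise σ)) (members-injective (support σ)
    (trans (sym (proj₂ (members-noise σ i))) (trans (cong (members (core σ)) eq) (proj₂ (members-noise σ j))))))
  (λ i j → cong₂ (adj G) (sym (proj₂ (members-noise σ i))) (sym (proj₂ (members-noise σ j))))

-- Rational and real numbers

toℚᵘ-/ : ∀ a d → ℚ.toℚᵘ (+ a ℚ./ suc d) ℚᵘ.≃ mkℚᵘ (+ a) d
toℚᵘ-/ a d = ℚ.toℚᵘ-fromℚᵘ (mkℚᵘ (+ a) d)

/-cong : ∀ {a b c d} → a * suc d ≡ b * suc c → + a ℚ./ suc c ≡ + b ℚ./ suc d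
/-cong {a} {b} {c} {d} eq = ℚ.fromℚᵘ-cong {mkℚᵘ (+ a) c} {mkℚᵘ (+ b) d}
  (*≡* (trans (sym (ℤ.pos-* a (suc d))) (trans (cong +_ eq) (ℤ.pos-* b (suc c)))))

/-mono : ∀ {a b c d} → a * suc d ≤ b * suc c → + a ℚ./ suc c ℚ.≤ + b ℚ./ suc d
/-mono {a} {b} {c} {d} le = ℚ.toℚᵘ-cancel-≤ (ℚᵘ.≤-respˡ-≃ (ℚᵘ.≃-sym (toℚᵘ-/ a c)) (ℚᵘ.≤-respʳ-≃ (ℚᵘ.≃-sym (toℚᵘ-/ b d))
  (*≤* (subst₂ ℤ._≤_ (ℤ.pos-* a (suc d)) (ℤ.pos-* b (suc c)) (ℤ.+≤+ le)))))

/-cancel : ∀ {a b c d} → + a ℚ./ suc c ℚ.≤ + b ℚ./ suc d → a * suc d ≤ b * suc c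
/-cancel {a} {b} {c} {d} le
  with ℚᵘ.≤-respˡ-≃ (toℚᵘ-/ a c) (ℚᵘ.≤-respʳ-≃ (toℚᵘ-/ b d) (ℚ.toℚᵘ-mono-≤ le))
... | *≤* le′ = ℤ.drop‿+≤+ (subst₂ ℤ._≤_ (sym (ℤ.pos-* a (suc d))) (sym (ℤ.pos-* b (suc c))) le′)

/-* : ∀ a b c d → (+ a ℚ./ suc c) ℚ.* (+ b ℚ./ suc d) ≡ + (a * b) ℚ./ (suc c * suc d)
/-* a b c d = ℚ.toℚᵘ-injective (ℚᵘ.≃-trans (ℚ.toℚᵘ-homo-* (+ a ℚ./ suc c) (+ b ℚ./ suc d)) (ℚᵘ.≃-trans (ℚᵘ.*-cong (toℚᵘ-/ a c) (toℚᵘ-/ b d))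
  (ℚᵘ.≃-trans (*≡* (cong (ℤ._* (+ (suc c * suc d))) (sym (ℤ.pos-* a b)))) (ℚᵘ.≃-sym (toℚᵘ-/ (a * b) _)))))

/-+ : ∀ a b c d → (+ a ℚ./ suc c) ℚ.+ (+ b ℚ./ suc d) ≡ + (a * suc d + b * suc c) ℚ./ (suc c * suc d)
/-+ a b c d = ℚ.toℚᵘ-injective (ℚᵘ.≃-trans (ℚ.toℚᵘ-homo-+ (+ a ℚ./ suc c) (+ b ℚ./ suc d)) (ℚᵘ.≃-trans (ℚᵘ.+-cong (toℚᵘ-/ a c) (toℚᵘ-/ b d))
  (ℚᵘ.≃-trans (*≡* (cong (ℤ._* (+ (suc c * suc d)))
                 (cong₂ ℤ._+_ (sym (ℤ.pos-* a (suc d))) (sym (ℤ.pos-* b (suc c))))))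
              (ℚᵘ.≃-sym (toℚᵘ-/ (a * suc d + b * suc c) _)))))

fromℕ-mono : ∀ {a b} → a ≤ b → fromℕ a ℚ.≤ fromℕ b
fromℕ-mono {a} {b} a≤b = /-mono {a} {b} {0} {0} (ℕ.*-monoˡ-≤ 1 a≤b)

fromℕ-nonNeg : ∀ a → 0ℚ ℚ.≤ fromℕ a
fromℕ-nonNeg a = fromℕ-mono {0} {a} z≤n

fromℕ-+ : ∀ a b → fromℕ a ℚ.+ fromℕ b ≡ fromℕ (a + b)
fromℕ-+ a b = trans (/-+ a b 0 0) (cong fromℕ (cong₂ _+_ (ℕ.*-identityʳ a) (ℕ.*-identityʳ b)))

fromℕ-* : ∀ a b → fromℕ a ℚ.* fromℕ b ≡ fromℕ (a * b)
fromℕ-* a b = /-* a b 0 0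

fromℕ-*-/ : ∀ a b d → fromℕ a ℚ.* (+ b ℚ./ suc d) ≡ + (a * b) ℚ./ suc d
fromℕ-*-/ a b d = trans (/-* a b 0 d) (/-cong {a * b} {a * b} {d + 0} {d} (cong (λ e → a * b * suc e) (sym (ℕ.+-identityʳ d))))

*-mono-≤ : ∀ {p q r s} → 0ℚ ℚ.≤ p → p ℚ.≤ q → 0ℚ ℚ.≤ r → r ℚ.≤ s → p ℚ.* r ℚ.≤ q ℚ.* s
*-mono-≤ {p} {q} {r} {s} 0≤p p≤q 0≤r r≤s = ℚ.≤-trans
  (ℚ.*-monoʳ-≤-nonNeg r {{ℚ.nonNegative 0≤r}} p≤q)
  (ℚ.*-monoˡ-≤-nonNeg q {{ℚ.nonNegative (ℚ.≤-trans 0≤p p≤q)}} r≤s)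

p≤p+δ : ∀ p {δ} → 0ℚ ℚ.< δ → p ℚ.≤ p ℚ.+ δ
p≤p+δ p {δ} 0<δ = subst (ℚ._≤ p ℚ.+ δ) (ℚ.+-identityʳ p) (ℚ.+-monoʳ-≤ p (ℚ.<⇒≤ 0<δ))

eventually : {x y : Seq} (N : ℕ) → (∀ i → N ≤ i → x i ℚ.≤ y i) → x ≲ y
eventually N le δ 0<δ = N , λ i N≤i → ℚ.≤-trans (le i N≤i) (p≤p+δ _ 0<δ)

archimedes : ∀ q → ∃[ N ] q ℚ.≤ fromℕ N
archimedes q@(ℚ.mkℚ z d _) = ℤ.∣ z ∣ , ℚ.toℚᵘ-cancel-≤ (ℚᵘ.≤-respʳ-≃ (ℚᵘ.≃-sym (toℚᵘ-/ ℤ.∣ z ∣ 0)) (*≤* (le z)))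
  where
  le : ∀ z → z ℤ.* + 1 ℤ.≤ + ℤ.∣ z ∣ ℤ.* + suc d
  le (+ a) = subst₂ ℤ._≤_ (ℤ.pos-* a 1) (ℤ.pos-* a (suc d)) (ℤ.+≤+ (ℕ.*-monoʳ-≤ a (s≤s z≤n)))
  le (ℤ.-[1+ a ]) = subst (ℤ.-[1+ a ] ℤ.* + 1 ℤ.≤_) (ℤ.pos-* (suc a) (suc d)) ℤ.-≤+

-- The first alternative takes care of negative `q`.
floor : ∀ q → ∃[ M ] (M ≡ 0 ⊎ fromℕ M ℚ.≤ q) × q ℚ.≤ fromℕ (suc M)
floor q with N , q≤N ← archimedes q = search N (ℚ.≤-trans q≤N (fromℕ-mono (ℕ.n≤1+n N)))
  where
  search : ∀ N → q ℚ.≤ fromℕ (suc N) → ∃[ M ] (M ≡ 0 ⊎ fromℕ M ℚ.≤ q) × q ℚ.≤ fromℕ (suc M)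
  search zero    q≤ = 0 , inj₁ refl , q≤
  search (suc N) q≤ with fromℕ (suc N) ℚ.≤? q
  ... | yes N≤q = suc N , inj₂ N≤q , q≤
  ... | no  N≰q = search N (ℚ.<⇒≤ (ℚ.≰⇒> N≰q))

p≤∣p∣ : ∀ p → p ℚ.≤ ℚ.∣ p ∣
p≤∣p∣ p with ℚ.≤-total 0ℚ p
... | inj₁ 0≤p = ℚ.≤-reflexive (sym (ℚ.0≤p⇒∣p∣≡p 0≤p))
... | inj₂ p≤0 = ℚ.≤-trans p≤0 (ℚ.0≤∣p∣ p)

-- Each of the two terms in the regularity bound is at most 1. Thus a single approximation controls
-- all the others, and no limits are needed later.
approx-difference : (x : ℝ) → ∀ i j → approx x i ℚ.≤ approx x j ℚ.+ fromℕ 2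
approx-difference x i j = begin
  approx x i                               ≡⟨ ℚ.+-identityʳ _ ⟨
  approx x i ℚ.+ 0ℚ                        ≡⟨ cong (approx x i ℚ.+_) (ℚ.+-inverseˡ (approx x j)) ⟨
  approx x i ℚ.+ (ℚ.- approx x j ℚ.+ approx x j) ≡⟨ ℚ.+-assoc (approx x i) _ _ ⟨
  (approx x i ℚ.- approx x j) ℚ.+ approx x j     ≤⟨ ℚ.+-monoˡ-≤ (approx x j) (ℚ.≤-trans (p≤∣p∣ _) (ℚ.≤-trans (regular x i j) small)) ⟩
  fromℕ 2 ℚ.+ approx x j                   ≡⟨ ℚ.+-comm (fromℕ 2) (approx x j) ⟩
  approx x j ℚ.+ fromℕ 2                   ∎
  where
  open ℚ.≤-Reasoning
  unit≤1 : ∀ i → + 1 ℚ./ suc i ℚ.≤ fromℕ 1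
  unit≤1 i = /-mono {1} {1} {i} {0} (s≤s z≤n)
  small : + 1 ℚ./ suc i ℚ.+ + 1 ℚ./ suc j ℚ.≤ fromℕ 2
  small = ℚ.≤-trans (ℚ.+-mono-≤ (unit≤1 i) (unit≤1 j)) (ℚ.≤-reflexive (fromℕ-+ 1 1))

upper : (x : ℝ) → ∃[ N ] ∀ i → approx x i ℚ.≤ fromℕ N
upper x with N , le ← archimedes (approx x 0 ℚ.+ fromℕ 2) = N , λ i → ℚ.≤-trans (approx-difference x i 0) le

-- Tolerance 1/2 in the comparison of limits is enough, since a natural number that exceeds another
-- by at most 1/2 does not exceed it at all.
natural-bound : (x : ℝ) (N a b : ℕ) → (∀ i → approx x i ℚ.≤ fromℕ N) →
  const (fromℕ a) ≲ (λ i → approx x i ℚ.* fromℕ b) → a ≤ N * b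
natural-bound x N a b x≤N le with I , le′ ← le (+ 1 ℚ./ 2) (toWitness {a? = 0ℚ ℚ.<? + 1 ℚ./ 2} tt) =
  ℕ.≤-pred (ℕ.*-cancelʳ-< 2 a (suc (N * b)) (begin-strict
    a * 2             ≤⟨ /-cancel {a} {N * b * 2 + 1} {0} {1} (ℚ.≤-trans (le′ I ℕ.≤-refl) sum≤) ⟩
    (N * b * 2 + 1) * 1 ≡⟨ ℕ.*-identityʳ _ ⟩
    N * b * 2 + 1     <⟨ ℕ.+-monoʳ-< (N * b * 2) (s≤s (s≤s z≤n)) ⟩
    N * b * 2 + 2     ≡⟨ ℕ.+-comm _ 2 ⟩
    suc (N * b) * 2   ∎))
  where
  open ℕ.≤-Reasoning
  sum≤ : approx x I ℚ.* fromℕ b ℚ.+ + 1 ℚ./ 2 ℚ.≤ + (N * b * 2 + 1) ℚ./ 2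
  sum≤ = ℚ.≤-trans
    (ℚ.+-monoˡ-≤ (+ 1 ℚ./ 2) (ℚ.≤-trans
      (ℚ.*-monoʳ-≤-nonNeg (fromℕ b) {{ℚ.nonNegative (fromℕ-nonNeg b)}} (x≤N I)) (ℚ.≤-reflexive (fromℕ-* N b))))
    (ℚ.≤-reflexive (/-+ (N * b) 1 0 1))

expTerm-nonNeg : ∀ {x} → 0ℚ ℚ.≤ x → ∀ i → 0ℚ ℚ.≤ expTerm x i
expTerm-nonNeg 0≤x zero    = fromℕ-nonNeg 1
expTerm-nonNeg 0≤x (suc i) =
  *-mono-≤ ℚ.≤-refl (*-mono-≤ ℚ.≤-refl (expTerm-nonNeg 0≤x i) ℚ.≤-refl 0≤x) ℚ.≤-refl (/-mono {0} {1} {0} {i} z≤n)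

-- As long as `suc i ≤ M`, the next factor `x / suc i` is at least 2.
expTerm-large : ∀ {x M} → fromℕ (2 * M) ℚ.≤ x → ∀ i → i ≤ M → fromℕ (2 ^ i) ℚ.≤ expTerm x i
expTerm-large le zero    _   = ℚ.≤-refl
expTerm-large {x} {M} le (suc i) i<M = begin
  fromℕ (2 ^ suc i)                                       ≡⟨ /-cong {2 ^ suc i} {2 ^ i * (2 * suc i) * 1} {0} {i} (solve i (2 ^ i)) ⟩
  + (2 ^ i * (2 * suc i) * 1) ℚ./ suc i                   ≡⟨ fromℕ-*-/ (2 ^ i * (2 * suc i)) 1 i ⟨
  fromℕ (2 ^ i * (2 * suc i)) ℚ.* (+ 1 ℚ./ suc i)         ≡⟨ cong (ℚ._* (+ 1 ℚ./ suc i)) (fromℕ-* (2 ^ i) (2 * suc i)) ⟨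
  fromℕ (2 ^ i) ℚ.* fromℕ (2 * suc i) ℚ.* (+ 1 ℚ./ suc i)
    ≤⟨ ℚ.*-monoʳ-≤-nonNeg (+ 1 ℚ./ suc i) {{ℚ.nonNegative (/-mono {0} {1} {0} {i} z≤n)}}
         (*-mono-≤ (fromℕ-nonNeg (2 ^ i)) (expTerm-large le i (ℕ.<⇒≤ i<M)) (fromℕ-nonNeg (2 * suc i))
                   (ℚ.≤-trans (fromℕ-mono (ℕ.*-monoʳ-≤ 2 i<M)) le)) ⟩
  expTerm x (suc i)                                       ∎
  where
  open ℚ.≤-Reasoning
  solve : ∀ i p → (p + (p + 0)) * suc i ≡ p * (2 * suc i) * 1 * 1
  solve = solve-∀

-- A single term of the exponential series: e ^ x ≥ (2 M) ^ M / M ! ≥ 2 ^ M for x ≥ 2 M.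
expPartialSum-large : ∀ {x M} → fromℕ (2 * M) ℚ.≤ x → ∀ i → M ≤ i → fromℕ (2 ^ M) ℚ.≤ expPartialSum x i
expPartialSum-large {x} {M} le i M≤i = subst (λ i → fromℕ (2 ^ M) ℚ.≤ expPartialSum x i) (ℕ.m+[n∸m]≡n M≤i) (go (i ∸ M))
  where
  0≤x = ℚ.≤-trans (fromℕ-nonNeg (2 * M)) le
  sum-nonNeg : ∀ i → 0ℚ ℚ.≤ expPartialSum x i
  sum-nonNeg zero    = fromℕ-nonNeg 1
  sum-nonNeg (suc i) = ℚ.+-mono-≤ (sum-nonNeg i) (expTerm-nonNeg 0≤x (suc i))
  term≤sum : ∀ i → expTerm x i ℚ.≤ expPartialSum x i
  term≤sum zero    = ℚ.≤-refl
  term≤sum (suc i) = subst (ℚ._≤ expPartialSum x (suc i)) (ℚ.+-identityˡ _) (ℚ.+-monoˡ-≤ (expTerm x (suc i)) (sum-nonNeg i))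
  go : ∀ d → fromℕ (2 ^ M) ℚ.≤ expPartialSum x (M + d)
  go zero    = subst (λ i → fromℕ (2 ^ M) ℚ.≤ expPartialSum x i) (sym (ℕ.+-identityʳ M))
                 (ℚ.≤-trans (expTerm-large le M ℕ.≤-refl) (term≤sum M))
  go (suc d) rewrite ℕ.+-suc M d = ℚ.≤-trans (go d)
    (subst (ℚ._≤ expPartialSum x (suc (M + d))) (ℚ.+-identityʳ _)
      (ℚ.+-monoʳ-≤ (expPartialSum x (M + d)) (expTerm-nonNeg 0≤x (suc (M + d)))))

-- Enumerating and sampling candidates

module _ {ℓᵢ} {I : Set ℓᵢ} {s : I → ℕ} where

  seqRandomlyᶠ : {p : I → Prog A B} {q : I → Prog B C} {x : I → ⟦ A ⟧ᵗ} {y : I → ⟦ B ⟧ᵗ} {d : I → Dist ⟦ C ⟧ᵗ} →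
    Fast s p x y → FastRandom s q y d → FastRandom s (λ i → p i ⨾ q i) x d
  seqRandomlyᶠ (fast r t) (fastRandom r′ t′) =
    fastRandom (λ i → seqRandomly (r i) (r′ i)) (poly-+ (poly-const 1) (poly-+ t t′))

  randomly-seqᶠ : {p : I → Prog A B} {q : I → Prog B C} {x : I → ⟦ A ⟧ᵗ} {d : I → Dist ⟦ B ⟧ᵗ}
    (Q : I → ⟦ B ⟧ᵗ → Set) (g : I → ⟦ B ⟧ᵗ → ⟦ C ⟧ᵗ) → (∀ i → All (λ (_ , y) → Q i y) (d i)) →
    FastRandom s p x d →
    Fast {I = ∃ λ i → ∃ λ y → Q i y} (s ∘ proj₁) (q ∘ proj₁) (λ (i , y , _) → y) (λ (i , y , _) → g i y) →
    FastRandom s (λ i → p i ⨾ q i) x (λ i → mapDist (g i) (d i))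
  randomly-seqᶠ Q g Q-d (fastRandom r t) (fast r′ (polyBounded K e t′)) =
    fastRandom (λ i → randomly-seq (g i) (r i) (All.map (λ q → within (t′ _) (r′ (i , _ , q))) (Q-d i)))
      (poly-+ (poly-const 1) (poly-+ t (polyBounded K e λ i → ℕ.≤-refl)))

  bothRandomlyᶠ : {p : I → Prog A B} {q : I → Prog A C} {x : I → ⟦ A ⟧ᵗ} {d : I → Dist ⟦ B ⟧ᵗ} {z : I → ⟦ C ⟧ᵗ} →
    FastRandom s p x d → Fast s q x z → FastRandom s (λ i → pair (p i) (q i)) x (λ i → mapDist (_, z i) (d i))
  bothRandomlyᶠ (fastRandom r t) (fast r′ t′) =
    fastRandom (λ i → bothRandomly (r i) (r′ i)) (poly-+ (poly-const 1) (poly-+ t (poly-+ t′ (poly-const 0))))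

  randomᶠ : {m : I → ℕ} → PolyBounded s (digits ∘ m) → FastRandom s (λ _ → random) m (uniform ∘ m)
  randomᶠ t = fastRandom (λ i → random-runs _) (poly-+ (poly-+ (poly-const 1) t) (poly-const 0))

  resultRandomlyᶠ : {p : I → Prog A B} {x : I → ⟦ A ⟧ᵗ} {d d′ : I → Dist ⟦ B ⟧ᵗ} →
    (∀ i → d i ≡ d′ i) → FastRandom s p x d → FastRandom s p x d′
  resultRandomlyᶠ {p = p} {x} eq (fastRandom r t) = fastRandom (λ i → subst (λ d → RunsRandomly (p i) (x i) d _) (eq i) (r i)) t

digits-mono : ∀ {m n} → m ≤ n → digits m ≤ digits n
digits-mono m≤n = ⌈log₂⌉-mono-≤ (s≤s m≤n)

digits-2^ : ∀ {m} d → m ≤ 2 ^ d → digits m ≤ suc d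
digits-2^ {m} d m≤2^d = begin
  ⌈log₂ suc m ⌉   ≤⟨ ⌈log₂⌉-mono-≤ (ℕ.+-mono-≤ (ℕ.m^n>0 2 d) (ℕ.≤-trans m≤2^d (ℕ.m≤m+n _ 0))) ⟩
  ⌈log₂ 2 ^ suc d ⌉ ≡⟨ ⌈log₂2^n⌉≡n (suc d) ⟩
  suc d           ∎
  where open ℕ.≤-Reasoning

-- The order is the one in which the program `enumerate` builds its list, so that both agree as
-- lists.
candidates : ∀ n → List (Candidate n)
candidates zero    = Vec.[] ∷ []
candidates (suc n) =
  foldl (λ σs σ → (chosen Vec.∷ σ) ∷ (omitted Vec.∷ σ) ∷ (added Vec.∷ σ) ∷ σs) [] (candidates n)

-- Relative to an added vertex.
weight : (a b : ℕ) → Candidate n → ℕ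
weight a b Vec.[]            = 1
weight a b (chosen  Vec.∷ σ) = weight a b σ * a
weight a b (omitted Vec.∷ σ) = weight a b σ * b
weight a b (added   Vec.∷ σ) = weight a b σ

candidate : Ty
candidate = vertices ⊗ vertices ⊗ nat

encodeCandidate : (a b : ℕ) → Candidate n → ⟦ candidate ⟧ᵗ
encodeCandidate a b σ = encodeSubset (core σ) , encodeSubset (support σ) , weight a b σ

extended : (a b : ℕ) → List ⟦ candidate ⟧ᵗ → ⟦ candidate ⟧ᵗ → List ⟦ candidate ⟧ᵗ
extended a b cs (T , S , w) =
  (inj₁ tt ∷ T , inj₁ tt ∷ S , w * a) ∷ (inj₂ tt ∷ T , inj₂ tt ∷ S , w * b) ∷ (inj₂ tt ∷ T , inj₁ tt ∷ S , w) ∷ cs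

entry : (t s : Prog (candidate ⊗ list candidate) bool) → Prog (candidate ⊗ list candidate) nat →
  Prog (candidate ⊗ list candidate) candidate
entry t s v = pair (pair t (fst ⨾ fst) ⨾ cons) (pair (pair s (fst ⨾ snd ⨾ fst) ⨾ cons) v)

tick blank : Prog A bool
tick  = unit ⨾ inl
blank = unit ⨾ inr

scaled : ℕ → Prog (candidate ⊗ list candidate) nat
scaled a = pair (fst ⨾ snd ⨾ snd) (literal a) ⨾ mult

extend : (a b : ℕ) → Prog (candidate ⊗ list candidate) (list candidate)
extend a b =
  pair (entry tick tick (scaled a))
       (pair (entry blank blank (scaled b)) (pair (entry blank tick (fst ⨾ snd ⨾ snd)) snd ⨾ cons) ⨾ cons) ⨾ cons

enumerate : (a b : ℕ) → Prog graph (list candidate)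
enumerate a b =
  pair skip (pair (pair nil (pair nil (literal 1))) nil ⨾ cons) ⨾ fold (pair snd nil ⨾ fold (extend a b))

foldl-extended : ∀ a b (σs : List (Candidate n)) (τs : List (Candidate (suc n))) →
  foldl (extended a b) (map (encodeCandidate a b) τs) (map (encodeCandidate a b) σs) ≡
  map (encodeCandidate a b)
    (foldl (λ σs σ → (chosen Vec.∷ σ) ∷ (omitted Vec.∷ σ) ∷ (added Vec.∷ σ) ∷ σs) τs σs)
foldl-extended a b []       τs = refl
foldl-extended a b (σ ∷ σs) τs = foldl-extended a b σs _

length-foldl-extended : (σs : List (Candidate n)) (τs : List (Candidate (suc n))) →
  length (foldl (λ σs σ → (chosen Vec.∷ σ) ∷ (omitted Vec.∷ σ) ∷ (added Vec.∷ σ) ∷ σs) τs σs) ≡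
  3 * length σs + length τs
length-foldl-extended []       τs = refl
length-foldl-extended (σ ∷ σs) τs = trans (length-foldl-extended σs _) (shift (length σs) (length τs))
  where
  shift : ∀ l m → 3 * l + (3 + m) ≡ 3 * suc l + m
  shift = solve-∀

length-candidates : ∀ n → length (candidates n) ≡ 3 ^ n
length-candidates zero    = refl
length-candidates (suc n) =
  trans (length-foldl-extended (candidates n) []) (trans (ℕ.+-identityʳ _) (cong (3 *_) (length-candidates n)))

weight-≤ : ∀ {a b} d → a ≤ 2 ^ d → b ≤ 2 ^ d → (σ : Candidate n) → weight a b σ ≤ 2 ^ (d * n)
weight-≤ {a = a} {b} d a≤ b≤ Vec.[] = ℕ.≤-reflexive (cong (2 ^_) (sym (ℕ.*-zeroʳ d)))
weight-≤ {suc n} {a} {b} d a≤ b≤ (st Vec.∷ σ) = begin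
  weight a b (st Vec.∷ σ)   ≤⟨ factor st ⟩
  weight a b σ * 2 ^ d      ≤⟨ ℕ.*-monoˡ-≤ (2 ^ d) (weight-≤ d a≤ b≤ σ) ⟩
  2 ^ (d * n) * 2 ^ d       ≡⟨ ℕ.^-distribˡ-+-* 2 (d * n) d ⟨
  2 ^ (d * n + d)           ≡⟨ cong (2 ^_) (trans (ℕ.+-comm (d * n) d) (sym (ℕ.*-suc d n))) ⟩
  2 ^ (d * suc n)           ∎
  where
  open ℕ.≤-Reasoning
  factor : ∀ st → weight a b (st Vec.∷ σ) ≤ weight a b σ * 2 ^ d
  factor chosen  = ℕ.*-monoʳ-≤ (weight a b σ) a≤
  factor omitted = ℕ.*-monoʳ-≤ (weight a b σ) b≤
  factor added   = ℕ.m≤m*n (weight a b σ) (2 ^ d) {{ℕ.m^n≢0 2 d}}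

module _ {ℓᵢ} {I : Set ℓᵢ} {s a b d n : I → ℕ} (3^n≤s : ∀ i → 3 ^ n i ≤ s i) (dn≤s : ∀ i → d i * suc (n i) ≤ s i)
  (a≤ : ∀ i → a i ≤ 2 ^ d i) (b≤ : ∀ i → b i ≤ 2 ^ d i) where

  private
    poly-bits : ∀ {ℓᵢ} {J : Set ℓᵢ} (π : J → I) {w : J → ℕ} → (∀ j → w j ≤ 2 ^ (d (π j) * suc (n (π j)))) →
      PolyBounded (s ∘ π) (digits ∘ w)
    poly-bits π w≤ = poly-mono (λ j → ℕ.≤-trans (digits-2^ _ (w≤ j)) (s≤s (dn≤s (π j)))) (poly-+ (poly-const 1) poly-size)

    2^d≤ : ∀ i → 2 ^ d i ≤ 2 ^ (d i * suc (n i))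
    2^d≤ i = ℕ.^-monoʳ-≤ 2 (ℕ.m≤m*n (d i) (suc (n i)))

  module _ {ℓⱼ} {J : Set ℓⱼ} (π : J → I) {c : J → ⟦ candidate ⟧ᵗ} {cs : J → List ⟦ candidate ⟧ᵗ}
    (w≤ : ∀ j → proj₂ (proj₂ (c j)) ≤ 2 ^ (d (π j) * n (π j))) where

    private
      x : J → ⟦ candidate ⊗ list candidate ⟧ᵗ
      x j = c j , cs j

    scaledᶠ : {a : I → ℕ} → (∀ i → a i ≤ 2 ^ d i) →
      Fast (s ∘ π) (scaled ∘ a ∘ π) x (λ j → proj₂ (proj₂ (c j)) * a (π j))
    scaledᶠ {a} a≤ =
      pairᶠ (fstᶠ ⨾ᶠ sndᶠ ⨾ᶠ sndᶠ) (literalᶠ (a ∘ π) (poly-bits π λ j → ℕ.≤-trans (a≤ (π j)) (2^d≤ (π j)))) ⨾ᶠ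
      multᶠ (poly-bits π (λ j → ℕ.≤-trans (w≤ j) (ℕ.^-monoʳ-≤ 2 (ℕ.*-monoʳ-≤ (d (π j)) (ℕ.n≤1+n _)))))
            (poly-bits π λ j → ℕ.≤-trans (a≤ (π j)) (2^d≤ (π j)))

    entryᶠ : {p q : J → Prog (candidate ⊗ list candidate) bool} {r : J → Prog (candidate ⊗ list candidate) nat}
      {t u : J → ⟦ bool ⟧ᵗ} {v : J → ℕ} → Fast (s ∘ π) p x t → Fast (s ∘ π) q x u → Fast (s ∘ π) r x v →
      Fast (s ∘ π) (λ j → entry (p j) (q j) (r j)) x
           (λ j → t j ∷ proj₁ (c j) , u j ∷ proj₁ (proj₂ (c j)) , v j)
    entryᶠ t u v = pairᶠ (pairᶠ t (fstᶠ ⨾ᶠ fstᶠ) ⨾ᶠ consᶠ) (pairᶠ (pairᶠ u (fstᶠ ⨾ᶠ sndᶠ ⨾ᶠ fstᶠ) ⨾ᶠ consᶠ) v)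

    tickᶠ : Fast (s ∘ π) (λ _ → tick) x (λ _ → inj₁ tt)
    tickᶠ = straightᶠ (λ _ → tick) (λ _ → refl)

    blankᶠ : Fast (s ∘ π) (λ _ → blank) x (λ _ → inj₂ tt)
    blankᶠ = straightᶠ (λ _ → blank) (λ _ → refl)

    extendᶠ : Fast (s ∘ π) (λ j → extend (a (π j)) (b (π j))) x (λ j → extended (a (π j)) (b (π j)) (cs j) (c j))
    extendᶠ =
      pairᶠ (entryᶠ tickᶠ tickᶠ (scaledᶠ a≤))
            (pairᶠ (entryᶠ blankᶠ blankᶠ (scaledᶠ b≤))
                   (pairᶠ (entryᶠ blankᶠ tickᶠ (fstᶠ ⨾ᶠ sndᶠ ⨾ᶠ sndᶠ)) sndᶠ ⨾ᶠ consᶠ) ⨾ᶠ consᶠ) ⨾ᶠ consᶠ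

  -- The size `s` is assumed to dominate `3 ^ n`, which turns the exponential enumeration into a
  -- polynomial one, and to dominate `d * suc n`, which bounds the digits of every weight.
  enumerateᶠ : {g : I → ⟦ graph ⟧ᵗ} → (∀ i → length (g i) ≡ n i) →
    Fast s (λ i → enumerate (a i) (b i)) g (λ i → map (encodeCandidate (a i) (b i)) (candidates (n i)))
  enumerateᶠ {g} len =
    pairᶠ skipᶠ (pairᶠ (pairᶠ nilᶠ (pairᶠ nilᶠ (literalᶠ (λ _ → 1) (poly-const 1)))) nilᶠ ⨾ᶠ consᶠ) ⨾ᶠ
    resultᶠ (λ i → finished (a i) (b i) (g i) 0 (len i))
      (foldᶠ (λ i rows → Stage i (length rows)) (λ i cs _ → foldl (extended (a i) (b i)) [] cs)
        (poly-mono (λ i → ℕ.≤-trans (ℕ.≤-reflexive (len i)) (ℕ.≤-trans (n≤3^n (n i)) (3^n≤s i))) poly-size)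
        (λ i → 0 , len i , refl)
        (λ { {i} (j , eq , refl) → suc j , trans (sym (ℕ.+-suc j _)) eq , foldl-extended (a i) (b i) (candidates j) [] })
        (pairᶠ sndᶠ nilᶠ ⨾ᶠ
         foldᶠ (λ (i , _) cs _ → All (λ c → proj₂ (proj₂ c) ≤ 2 ^ (d i * n i)) cs)
           (λ (i , _) → extended (a i) (b i))
           (poly-mono (λ (i , _ , _ , _ , stage) → few-candidates i stage) poly-size)
           (λ (i , _ , _ , _ , stage) → light i stage)
           (λ { (_ ∷ ps) → ps })
           (extendᶠ (proj₁ ∘ proj₁) (λ { (_ , _ , _ , _ , (p ∷ _)) → p }))))
    where
    -- After `j` rows of the adjacency matrix the accumulator holds the candidates on `j` vertices.
    -- The contents of the rows are ignored; the rows merely count the vertices.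
    Stage : I → ℕ → List ⟦ candidate ⟧ᵗ → Set
    Stage i l cs = ∃ λ j → j + l ≡ n i × cs ≡ map (encodeCandidate (a i) (b i)) (candidates j)

    finished : ∀ a b {n} (rows : List X) j → j + length rows ≡ n →
      foldl (λ cs _ → foldl (extended a b) [] cs) (map (encodeCandidate a b) (candidates j)) rows ≡
      map (encodeCandidate a b) (candidates n)
    finished a b []         j refl rewrite ℕ.+-identityʳ j = refl
    finished a b (_ ∷ rows) j refl =
      trans (cong (λ cs → foldl (λ cs _ → foldl (extended a b) [] cs) cs rows) (foldl-extended a b (candidates j) []))
            (finished a b rows (suc j) (sym (ℕ.+-suc j _)))

    n≤3^n : ∀ n → n ≤ 3 ^ n
    n≤3^n zero    = z≤n
    n≤3^n (suc n) = ℕ.≤-trans (ℕ.+-mono-≤ (ℕ.m^n>0 3 n) (n≤3^n n)) (ℕ.+-monoʳ-≤ (3 ^ n) (ℕ.m≤m+n (3 ^ n) _))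

    j≤n : ∀ {i l cs} (stage : Stage i (suc l) cs) → suc (proj₁ stage) ≤ n i
    j≤n (j , eq , _) = subst (suc j ≤_) (trans (sym (ℕ.+-suc j _)) eq) (ℕ.m≤m+n (suc j) _)

    few-candidates : ∀ i {l cs} → Stage i (suc l) cs → length cs ≤ s i
    few-candidates i stage@(j , _ , refl) = begin
      length (map (encodeCandidate (a i) (b i)) (candidates j)) ≡⟨ List.length-map _ (candidates j) ⟩
      length (candidates j) ≡⟨ length-candidates j ⟩
      3 ^ j                 ≤⟨ ℕ.^-monoʳ-≤ 3 (ℕ.≤-trans (ℕ.n≤1+n j) (j≤n stage)) ⟩
      3 ^ n i               ≤⟨ 3^n≤s i ⟩
      s i                   ∎
      where open ℕ.≤-Reasoning

    light : ∀ i {l cs} → Stage i (suc l) cs → All (λ c → proj₂ (proj₂ c) ≤ 2 ^ (d i * n i)) cs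
    light i stage@(j , _ , refl) = All.map⁺ (All.universal (λ σ → ℕ.≤-trans (weight-≤ (d i) (a≤ i) (b≤ i) σ)
      (ℕ.^-monoʳ-≤ 2 (ℕ.*-monoʳ-≤ (d i) (ℕ.≤-trans (ℕ.n≤1+n j) (j≤n stage))))) (candidates j))

-- A number instead of a Boolean: multiplied into the weight, it keeps infeasible candidates in the
-- list with weight 0.
isEmpty : Subset n → ℕ
isEmpty Vec.[]              = 1
isEmpty (inside  Vec.∷ D) = 0
isEmpty (outside Vec.∷ D) = isEmpty D

vetoNext : ℕ → ⊤ ⊎ ⊤ → ℕ
vetoNext w (inj₁ _) = 0
vetoNext w (inj₂ _) = w

foldl-veto : ∀ w (D : Subset n) → foldl vetoNext w (encodeSubset D) ≡ w * isEmpty D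
foldl-veto w Vec.[]            = sym (ℕ.*-identityʳ w)
foldl-veto w (inside  Vec.∷ D) = trans (foldl-veto 0 D) (sym (ℕ.*-zeroʳ w))
foldl-veto w (outside Vec.∷ D) = foldl-veto w D

veto : Prog (bool ⊗ nat) nat
veto = case (literal 0) snd

veto-runs : ∀ b w → Runs veto (b , w) (vetoNext w b) 10
veto-runs (inj₁ _) w = within (ℕ.m≤m+n _ _) (onLeft (literal-runs 0))
veto-runs (inj₂ _) w = within (ℕ.m≤m+n _ _) (straight veto refl)

weightedCandidates : (a b : ℕ) → ((S : Subset n) → Subset ∣ S ∣) → List (ℕ × List (⊤ ⊎ ⊤))
weightedCandidates {n} a b D =
  map (λ σ → weight a b σ * isEmpty (D (core σ)) , encodeSubset (support σ)) (candidates n)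

weighted : Ty
weighted = list (nat ⊗ vertices)

weigh : Prog graph vertices → Prog (candidate ⊗ graph) (nat ⊗ vertices)
weigh del =
  pair (pair (pair snd (fst ⨾ fst) ⨾ induced ⨾ del) (fst ⨾ snd ⨾ snd) ⨾ fold veto)
       (fst ⨾ snd ⨾ fst)

module _ {ℓᵢ} {I : Set ℓᵢ} {s n : I → ℕ} (n≤s : ∀ i → n i ≤ s i) (G : ∀ i → Graph (n i)) where

  rows≤ : ∀ i → All (λ row → length row ≤ s i) (encodeGraph (G i))
  rows≤ i = All.tabulate⁺ λ u → ℕ.≤-trans (ℕ.≤-reflexive (List.length-tabulate _)) (n≤s i)

  length-encodeGraph : PolyBounded s (λ i → length (encodeGraph (G i)))
  length-encodeGraph = poly-mono (λ i → ℕ.≤-trans (ℕ.≤-reflexive (List.length-tabulate _)) (n≤s i)) poly-size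

  module _ {del : Prog graph vertices} (D : ∀ i (S : Subset (n i)) → Subset ∣ S ∣) {K e : ℕ}
    (del-runs : ∀ i S → Runs del (encodeGraph (G i [ S ])) (encodeSubset (D i S)) (K * suc ∣ S ∣ ^ e)) where

    inducedDeletionᶠ : ∀ {ℓⱼ} {J : Set ℓⱼ} (π : J → I) (mask : J → List (⊤ ⊎ ⊤)) →
      Fast (s ∘ π) (λ _ → induced ⨾ del) (λ j → encodeGraph (G (π j)) , mask j)
           (λ j → encodeSubset (D (π j) (toSubset (n (π j)) (mask j))))
    inducedDeletionᶠ π mask =
      resultᶠ (λ j → select-encodeGraph (G (π j)) (mask j))
        (inducedᶠ (poly-reindex π length-encodeGraph) (rows≤ ∘ π)) ⨾ᶠ
      fast (λ j → within (time≤ (π j) (toSubset _ (mask j))) (del-runs (π j) (toSubset _ (mask j))))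
           (polyBounded K e λ j → ℕ.≤-refl)
      where
      time≤ : ∀ i (S : Subset (n i)) → K * suc ∣ S ∣ ^ e ≤ K * suc (s i) ^ e
      time≤ i S = ℕ.*-monoʳ-≤ K (ℕ.^-monoˡ-≤ e (s≤s (ℕ.≤-trans (Subset.∣p∣≤n S) (n≤s i))))

    weighᶠ : {a b : I → ℕ} → (∀ i → 3 ^ n i ≤ s i) →
      Fast s (λ _ → mapWith (weigh del))
           (λ i → map (encodeCandidate (a i) (b i)) (candidates (n i)) , encodeGraph (G i))
           (λ i → weightedCandidates (a i) (b i) (D i))
    weighᶠ {a} {b} 3^n≤s = resultᶠ pointwise
      (mapWithᶠ (λ _ _ → ⊤) weigh′
        (poly-mono (λ i → ℕ.≤-trans (ℕ.≤-reflexive (trans (List.length-map _ (candidates (n i))) (length-candidates (n i)))) (3^n≤s i))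
                   poly-size)
        (λ i → All.universal (λ _ → tt) _)
        (pairᶠ
          (pairᶠ (pairᶠ sndᶠ (fstᶠ ⨾ᶠ fstᶠ) ⨾ᶠ inducedDeletionᶠ proj₁ (λ (_ , (T , _) , _) → T)) (fstᶠ ⨾ᶠ sndᶠ ⨾ᶠ sndᶠ) ⨾ᶠ
           resultᶠ (λ (i , (T , S , w) , _) → foldl-veto w (D i (toSubset (n i) T)))
             (foldᶠ (λ _ _ _ → ⊤) (λ _ → vetoNext)
               (poly-mono (λ (i , (T , _) , _) → ℕ.≤-trans (length-encodeSubset (D i (toSubset (n i) T)))
                             (ℕ.≤-trans (Subset.∣p∣≤n (toSubset (n i) T)) (n≤s i))) poly-size)
               (λ _ → tt) (λ _ → tt) (fast (λ (_ , b , _ , w , _) → veto-runs b w) (poly-const 10))))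
          (fstᶠ ⨾ᶠ sndᶠ ⨾ᶠ fstᶠ)))
      where
      weigh′ : ∀ i → ⟦ candidate ⟧ᵗ → ℕ × List (⊤ ⊎ ⊤)
      weigh′ i (T , S , w) = w * isEmpty (D i (toSubset (n i) T)) , S

      pointwise : ∀ i → map (weigh′ i) (map (encodeCandidate (a i) (b i)) (candidates (n i))) ≡ weightedCandidates (a i) (b i) (D i)
      pointwise i = trans (sym (List.map-∘ (candidates (n i)))) (List.map-cong
        (λ σ → cong (λ T → weight (a i) (b i) σ * isEmpty (D i T) , encodeSubset (support σ)) (toSubset-encode (core σ)))
        (candidates (n i)))

      length-encodeSubset : ∀ {n} (S : Subset n) → length (encodeSubset S) ≤ n
      length-encodeSubset S = ℕ.≤-reflexive (trans (List.length-map _ (Vec.toList S)) (Vec.length-toList S))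

-- Drawing an item according to its weight

total : List (ℕ × X) → ℕ
total L = sum (map proj₁ L)

-- The counter c reaches 0 at the selected item; from there on, cur is kept.
pickNext : ℕ × X → ℕ × X → ℕ × X
pickNext (c , cur) (w , x) = c ∸ w , (if c ≤ᵇ 0 then cur else x)

pick : X → List (ℕ × X) → ℕ → X
pick cur L c = proj₂ (foldl pickNext (c , cur) L)

sumWeights : Prog weighted nat
sumWeights = pair skip (literal 0) ⨾ fold (pair (fst ⨾ fst) snd ⨾ add)

pickStep : Prog ((nat ⊗ A) ⊗ (nat ⊗ A)) (nat ⊗ A)
pickStep =
  pair (pair (snd ⨾ fst) (fst ⨾ fst) ⨾ monus)
       (pair (pair (snd ⨾ fst) (literal 0) ⨾ leq) (pair (snd ⨾ snd) (fst ⨾ snd)) ⨾ case (snd ⨾ fst) (snd ⨾ snd))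

sample : Prog weighted vertices
sample =
  pair (sumWeights ⨾ pair skip (literal 1) ⨾ monus ⨾ random) skip ⨾
  pair snd (pair (pair fst (literal 1) ⨾ add) nil) ⨾ fold pickStep ⨾ snd

-- The counter is uniform between 1 and the total weight, while `uniform` starts at 0; hence both
-- shifts by one. A positive counter always overwrites the initial value `[]` when the list is not
-- empty.
sampled : List (ℕ × List (⊤ ⊎ ⊤)) → Dist (List (⊤ ⊎ ⊤))
sampled L = mapDist (λ j → pick [] L (j + 1)) (uniform (total L ∸ 1))

foldl-sum : (L : List (ℕ × X)) (t : ℕ) → foldl (λ t (w , _) → w + t) t L ≡ total L + t
foldl-sum []            t = refl
foldl-sum ((w , x) ∷ L) t = trans (foldl-sum L (w + t)) (rearrange (total L) w t)
  where
  rearrange : ∀ l w t → l + (w + t) ≡ w + l + t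
  rearrange = solve-∀

module _ {ℓᵢ} {I : Set ℓᵢ} {s : I → ℕ} (L : I → List (ℕ × List (⊤ ⊎ ⊤)))
  (l : PolyBounded s (length ∘ L)) (bits : PolyBounded s (digits ∘ total ∘ L)) where

  private
    poly-bits : ∀ {ℓⱼ} {J : Set ℓⱼ} (π : J → I) {w : J → ℕ} → (∀ j → w j ≤ total (L (π j))) →
      PolyBounded (s ∘ π) (digits ∘ w)
    poly-bits π w≤ = poly-mono (λ j → digits-mono (w≤ j)) (poly-reindex π bits)

  sumWeightsᶠ : Fast s (λ _ → sumWeights) L (total ∘ L)
  sumWeightsᶠ =
    pairᶠ skipᶠ (literalᶠ (λ _ → 0) (poly-const 0)) ⨾ᶠ
    resultᶠ (λ i → trans (foldl-sum (L i) 0) (ℕ.+-identityʳ _))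
      (foldᶠ (λ i L′ t → total L′ + t ≤ total (L i)) (λ _ t (w , _) → w + t) l
        (λ i → ℕ.≤-reflexive (ℕ.+-identityʳ _))
        (λ {i} {(w , _)} {L′} {t} → subst (_≤ total (L i)) (sym (rearrange (total L′) w t)))
        (pairᶠ (fstᶠ ⨾ᶠ fstᶠ) sndᶠ ⨾ᶠ
         addᶠ (poly-bits proj₁ λ (_ , (w , _) , L′ , t , p) → ℕ.≤-trans (ℕ.≤-trans (ℕ.m≤m+n w (total L′)) (ℕ.m≤m+n _ t)) p)
              (poly-bits proj₁ λ (_ , (w , _) , L′ , t , p) → ℕ.≤-trans (ℕ.m≤n+m t (w + total L′)) p)))
    where
    rearrange : ∀ l w t → l + (w + t) ≡ w + l + t
    rearrange = solve-∀

  sampleᶠ : (∀ i → 1 ≤ total (L i)) → FastRandom s (λ _ → sample) L (λ i → sampled (L i))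
  sampleᶠ positive = resultRandomlyᶠ (λ i → sym (mapDist-∘ _ (_, L i) (uniform (total (L i) ∸ 1)))) raw
    where
    drawᶠ : FastRandom s (λ _ → sumWeights ⨾ pair skip (literal 1) ⨾ monus ⨾ random) L (λ i → uniform (total (L i) ∸ 1))
    drawᶠ = seqRandomlyᶠ sumWeightsᶠ (seqRandomlyᶠ (pairᶠ skipᶠ (literalᶠ (λ _ → 1) (poly-const 1)))
      (seqRandomlyᶠ (monusᶠ bits (poly-const 1)) (randomᶠ (poly-bits id λ i → ℕ.m∸n≤m _ 1))))

    Valid : ∀ i → ℕ × List (ℕ × List (⊤ ⊎ ⊤)) → Set
    Valid i (j , L′) = j + 1 ≤ total (L i) × L′ ≡ L i

    valid : ∀ i → All (λ (_ , y) → Valid i y) (mapDist (_, L i) (uniform (total (L i) ∸ 1)))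
    valid i = All.map⁺ (All.map⁺ (All.applyUpTo⁺₁ id _ λ {j} j< → j+1≤ j<  , refl))
      where
      j+1≤ : ∀ {j} → j < suc (total (L i) ∸ 1) → j + 1 ≤ total (L i)
      j+1≤ {j} j< = begin
        j + 1                 ≤⟨ ℕ.+-monoˡ-≤ 1 (ℕ.≤-pred j<) ⟩
        total (L i) ∸ 1 + 1   ≡⟨ ℕ.m∸n+n≡m (positive i) ⟩
        total (L i)           ∎
        where open ℕ.≤-Reasoning

    choose-runs : ∀ b (x y : List (⊤ ⊎ ⊤)) →
      Runs {A = bool ⊗ vertices ⊗ vertices} (case (snd ⨾ fst) (snd ⨾ snd)) (bit b , x , y) (if b then x else y) 4
    choose-runs true  x y = straight _ refl
    choose-runs false x y = straight _ refl

    raw : FastRandom s (λ _ → sample) L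
      (λ i → mapDist (λ (j , L′) → pick [] L′ (j + 1)) (mapDist (_, L i) (uniform (total (L i) ∸ 1))))
    raw = randomly-seqᶠ Valid (λ _ (j , L′) → pick [] L′ (j + 1)) valid (bothRandomlyᶠ drawᶠ skipᶠ)
      (pairᶠ sndᶠ (pairᶠ (pairᶠ fstᶠ (literalᶠ (λ _ → 1) (poly-const 1)) ⨾ᶠ
                          addᶠ (poly-bits proj₁ λ (_ , (j , _) , j≤ , _) → ℕ.≤-trans (ℕ.m≤m+n j 1) j≤) (poly-const 1)) nilᶠ) ⨾ᶠ
       foldᶠ (λ (i , _) L′ (c , _) → c ≤ total (L i) × total L′ ≤ total (L i)) (λ _ → pickNext)
         (poly-mono (λ { (i , _ , _ , refl) → ℕ.≤-refl }) (poly-reindex proj₁ l))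
         (λ { (i , _ , j≤ , refl) → j≤ , ℕ.≤-refl })
         (λ { {_} {w , _} {L′} {c , _} (c≤ , L≤) → ℕ.≤-trans (ℕ.m∸n≤m c w) c≤ , ℕ.≤-trans (ℕ.m≤n+m (total L′) w) L≤ })
         (pairᶠ
           (pairᶠ (sndᶠ ⨾ᶠ fstᶠ) (fstᶠ ⨾ᶠ fstᶠ) ⨾ᶠ
            monusᶠ (poly-bits (proj₁ ∘ proj₁) λ (_ , _ , _ , _ , c≤ , _) → c≤)
                   (poly-bits (proj₁ ∘ proj₁) λ (_ , (w , _) , L′ , _ , _ , L≤) → ℕ.≤-trans (ℕ.m≤m+n w (total L′)) L≤))
           (pairᶠ (pairᶠ (sndᶠ ⨾ᶠ fstᶠ) (literalᶠ (λ _ → 0) (poly-const 0)) ⨾ᶠ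
                   leqᶠ (poly-bits (proj₁ ∘ proj₁) λ (_ , _ , _ , _ , c≤ , _) → c≤) (poly-const 0))
                  (pairᶠ (sndᶠ ⨾ᶠ sndᶠ) (fstᶠ ⨾ᶠ sndᶠ)) ⨾ᶠ
            fast (λ (_ , (_ , x) , _ , (c , cur) , _) → choose-runs (c ≤ᵇ 0) cur x) (poly-const 4))) ⨾ᶠ
       sndᶠ)

-- Sums over candidates

-- Recursion on the vertices makes the split by the status of the foremost vertex definitional,
-- which suits weights that are products over the vertices.
∑ : ∀ n → (Candidate n → ℕ) → ℕ
∑ zero    f = f Vec.[]
∑ (suc n) f = ∑ n (f ∘ (chosen Vec.∷_)) + (∑ n (f ∘ (omitted Vec.∷_)) + ∑ n (f ∘ (added Vec.∷_)))

∑-candidates : ∀ n (f : Candidate n → ℕ) → sum (map f (candidates n)) ≡ ∑ n f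
∑-candidates zero    f = ℕ.+-identityʳ _
∑-candidates (suc n) f = begin
  sum (map f (candidates (suc n)))                ≡⟨ go (candidates n) [] ⟩
  part chosen + (part omitted + part added) + 0   ≡⟨ ℕ.+-identityʳ _ ⟩
  part chosen + (part omitted + part added)
    ≡⟨ cong₂ _+_ (∑-candidates n _) (cong₂ _+_ (∑-candidates n _) (∑-candidates n _)) ⟩
  ∑ (suc n) f                                     ∎
  where
  open ≡-Reasoning
  part = λ st → sum (map (λ σ → f (st Vec.∷ σ)) (candidates n))
  rearrange : ∀ c o a c′ o′ a′ t → c′ + (o′ + a′) + (c + (o + (a + t))) ≡ c + c′ + (o + o′ + (a + a′)) + t
  rearrange = solve-∀
  go : ∀ σs τs →
    sum (map f (foldl (λ σs σ → (chosen Vec.∷ σ) ∷ (omitted Vec.∷ σ) ∷ (added Vec.∷ σ) ∷ σs) τs σs)) ≡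
    sum (map (λ σ → f (chosen Vec.∷ σ)) σs) +
      (sum (map (λ σ → f (omitted Vec.∷ σ)) σs) + sum (map (λ σ → f (added Vec.∷ σ)) σs)) + sum (map f τs)
  go []       τs = refl
  go (σ ∷ σs) τs = trans (go σs _) (rearrange (f (chosen Vec.∷ σ)) (f (omitted Vec.∷ σ)) (f (added Vec.∷ σ)) _ _ _ _)

∑-cong : ∀ n {f g : Candidate n → ℕ} → (∀ σ → f σ ≡ g σ) → ∑ n f ≡ ∑ n g
∑-cong zero    eq = eq Vec.[]
∑-cong (suc n) eq = cong₂ _+_ (∑-cong n (eq ∘ _)) (cong₂ _+_ (∑-cong n (eq ∘ _)) (∑-cong n (eq ∘ _)))

∑-mono : ∀ n {f g : Candidate n → ℕ} → (∀ σ → f σ ≤ g σ) → ∑ n f ≤ ∑ n g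
∑-mono zero    le = le Vec.[]
∑-mono (suc n) le = ℕ.+-mono-≤ (∑-mono n (le ∘ _)) (ℕ.+-mono-≤ (∑-mono n (le ∘ _)) (∑-mono n (le ∘ _)))

∑-+ : ∀ n (f g : Candidate n → ℕ) → ∑ n (λ σ → f σ + g σ) ≡ ∑ n f + ∑ n g
∑-+ zero    f g = refl
∑-+ (suc n) f g = trans (cong₂ _+_ (∑-+ n _ _) (cong₂ _+_ (∑-+ n _ _) (∑-+ n _ _)))
  (rearrange (∑ n (f ∘ (chosen Vec.∷_))) (∑ n (f ∘ (omitted Vec.∷_))) (∑ n (f ∘ (added Vec.∷_))) _ _ _)
  where
  rearrange : ∀ a b c a′ b′ c′ → a + a′ + (b + b′ + (c + c′)) ≡ a + (b + c) + (a′ + (b′ + c′))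
  rearrange = solve-∀

∑-* : ∀ n c (f : Candidate n → ℕ) → ∑ n (λ σ → c * f σ) ≡ c * ∑ n f
∑-* zero    c f = refl
∑-* (suc n) c f = trans (cong₂ _+_ (∑-* n c _) (cong₂ _+_ (∑-* n c _) (∑-* n c _)))
  (rearrange c (∑ n (f ∘ (chosen Vec.∷_))) _ _)
  where
  rearrange : ∀ d a b c → d * a + (d * b + d * c) ≡ d * (a + (b + c))
  rearrange = solve-∀

∑-const : ∀ n c → ∑ n (λ _ → c) ≡ 3 ^ n * c
∑-const zero    c = sym (ℕ.+-identityʳ c)
∑-const (suc n) c rewrite ∑-const n c = rearrange (3 ^ n) c
  where
  rearrange : ∀ t c → t * c + (t * c + t * c) ≡ (t + (t + (t + 0))) * c
  rearrange = solve-∀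

term≤∑ : ∀ n (f : Candidate n → ℕ) σ → f σ ≤ ∑ n f
term≤∑ zero    f Vec.[]              = ℕ.≤-refl
term≤∑ (suc n) f (chosen  Vec.∷ σ) = ℕ.≤-trans (term≤∑ n _ σ) (ℕ.m≤m+n _ _)
term≤∑ (suc n) f (omitted Vec.∷ σ) =
  ℕ.≤-trans (term≤∑ n _ σ) (ℕ.≤-trans (ℕ.m≤m+n _ _) (ℕ.m≤n+m _ (∑ n (f ∘ (chosen Vec.∷_)))))
term≤∑ (suc n) f (added   Vec.∷ σ) =
  ℕ.≤-trans (term≤∑ n _ σ) (ℕ.≤-trans (ℕ.m≤n+m _ _) (ℕ.m≤n+m _ (∑ n (f ∘ (chosen Vec.∷_)))))

-- Moving a vertex out of the core

demote : Fin n → Candidate n → Candidate n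
demote zero    (chosen  Vec.∷ σ) = added Vec.∷ σ
demote zero    (omitted Vec.∷ σ) = omitted Vec.∷ σ
demote zero    (added   Vec.∷ σ) = added Vec.∷ σ
demote (suc u) (st      Vec.∷ σ) = st Vec.∷ demote u σ

support-demote : (u : Fin n) (σ : Candidate n) → support (demote u σ) ≡ support σ
support-demote zero    (chosen  Vec.∷ σ) = refl
support-demote zero    (omitted Vec.∷ σ) = refl
support-demote zero    (added   Vec.∷ σ) = refl
support-demote (suc u) (chosen  Vec.∷ σ) = cong (inside Vec.∷_) (support-demote u σ)
support-demote (suc u) (omitted Vec.∷ σ) = cong (outside Vec.∷_) (support-demote u σ)
support-demote (suc u) (added   Vec.∷ σ) = cong (inside Vec.∷_) (support-demote u σ)

members-demote : (u : Fin n) (σ : Candidate n) (i : Fin ∣ core (demote u σ) ∣) →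
  members (core (demote u σ)) i ≢ u × ∃[ j ] members (core σ) j ≡ members (core (demote u σ)) i
members-demote zero    (chosen  Vec.∷ σ) i = (λ ()) , suc i , refl
members-demote zero    (omitted Vec.∷ σ) i = (λ ()) , i , refl
members-demote zero    (added   Vec.∷ σ) i = (λ ()) , i , refl
members-demote (suc u) (chosen  Vec.∷ σ) zero = (λ ()) , zero , refl
members-demote (suc u) (chosen  Vec.∷ σ) (suc i) with ≢u , j , eq ← members-demote u σ i =
  ≢u ∘ Fin.suc-injective , suc j , cong suc eq
members-demote (suc u) (omitted Vec.∷ σ) i with ≢u , j , eq ← members-demote u σ i =
  ≢u ∘ Fin.suc-injective , j , cong suc eq
members-demote (suc u) (added   Vec.∷ σ) i with ≢u , j , eq ← members-demote u σ i =
  ≢u ∘ Fin.suc-injective , j , cong suc eq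

-- Heredity absorbs the change at u: only edges at u differ between G and G′.
demote-her : ∀ {ℓ} {Γ : GraphPredicate ℓ} → Hereditary Γ → (G G′ : Graph n) (u : Fin n) →
  (∀ v w → v ≢ u → w ≢ u → adj G v w ≡ adj G′ v w) → (σ : Candidate n) →
  Γ (G [ core σ ]) → Γ (G′ [ core (demote u σ) ])
demote-her her G G′ u same σ = embedded her _ _ (λ i → proj₁ (proj₂ (members-demote u σ i)))
  (λ {i} {j} eq → members-injective (core (demote u σ))
    (trans (sym (proj₂ (proj₂ (members-demote u σ i))))
           (trans (cong (members (core σ)) eq) (proj₂ (proj₂ (members-demote u σ j))))))
  (λ i j → trans (sym (same _ _ (proj₁ (members-demote u σ i)) (proj₁ (members-demote u σ j))))
    (cong₂ (adj G) (sym (proj₂ (proj₂ (members-demote u σ i)))) (sym (proj₂ (proj₂ (members-demote u σ j))))))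

module _ (a b : ℕ) where

  ∑ʷ : ∀ n → (Candidate n → ℕ) → ℕ
  ∑ʷ n h = ∑ n (λ σ → weight a b σ * h σ)

  ∑ʷ-suc : ∀ n (h : Candidate (suc n) → ℕ) → ∑ʷ (suc n) h ≡
    a * ∑ʷ n (h ∘ (chosen Vec.∷_)) + (b * ∑ʷ n (h ∘ (omitted Vec.∷_)) + ∑ʷ n (h ∘ (added Vec.∷_)))
  ∑ʷ-suc n h = cong₂ _+_ (pull a _) (cong₂ _+_ (pull b _) refl)
    where
    pull : ∀ c (f : Candidate n → ℕ) → ∑ n (λ σ → weight a b σ * c * f σ) ≡ c * ∑ʷ n f
    pull c f = trans (∑-cong n λ σ → trans (cong (_* f σ) (ℕ.*-comm (weight a b σ) c)) (ℕ.*-assoc c _ (f σ))) (∑-* n c _)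

  -- Statuses of vertices other than `u` factor out of the weight. At `u`, an added vertex of weight
  -- 1 is charged for itself and for the chosen vertex of weight `a`, together `suc a`.
  demote-∑ʷ : (u : Fin n) {h h′ : Candidate n → ℕ} → (∀ σ → h σ ≤ h′ (demote u σ)) → ∑ʷ n h ≤ suc a * ∑ʷ n h′
  demote-∑ʷ {suc n} zero {h} {h′} le = begin
    ∑ʷ (suc n) h                        ≡⟨ ∑ʷ-suc n h ⟩
    a * ∑ʷ n (h ∘ (chosen Vec.∷_)) + (b * ∑ʷ n (h ∘ (omitted Vec.∷_)) + ∑ʷ n (h ∘ (added Vec.∷_)))
      ≤⟨ ℕ.+-mono-≤ (ℕ.*-monoʳ-≤ a (mono chosen added (le ∘ _)))
           (ℕ.+-mono-≤ (ℕ.*-monoʳ-≤ b (mono omitted omitted (le ∘ _))) (mono added added (le ∘ _))) ⟩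
    -- The slack consists of all terms with `γ`, as no demoted candidate has `u` chosen, and of the
    -- surplus factor `a` on the omitted part.
    a * α + (b * ω + α)                 ≤⟨ ℕ.m≤m+n _ (a * γ + a * (a * γ) + a * (b * ω)) ⟩
    a * α + (b * ω + α) + (a * γ + a * (a * γ) + a * (b * ω)) ≡⟨ rearrange a α (b * ω) γ ⟩
    suc a * (a * γ + (b * ω + α))       ≡⟨ cong (suc a *_) (∑ʷ-suc n h′) ⟨
    suc a * ∑ʷ (suc n) h′               ∎
    where
    open ℕ.≤-Reasoning
    α = ∑ʷ n (h′ ∘ (added Vec.∷_))
    ω = ∑ʷ n (h′ ∘ (omitted Vec.∷_))
    γ = ∑ʷ n (h′ ∘ (chosen Vec.∷_))
    mono : ∀ st st′ → (∀ σ → h (st Vec.∷ σ) ≤ h′ (st′ Vec.∷ σ)) → ∑ʷ n (h ∘ (st Vec.∷_)) ≤ ∑ʷ n (h′ ∘ (st′ Vec.∷_))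
    mono st st′ le = ∑-mono n λ σ → ℕ.*-monoʳ-≤ (weight a b σ) (le σ)
    rearrange : ∀ a α ω γ → a * α + (ω + α) + (a * γ + a * (a * γ) + a * ω) ≡ suc a * (a * γ + (ω + α))
    rearrange = solve-∀
  demote-∑ʷ {suc n} (suc u) {h} {h′} le = begin
    ∑ʷ (suc n) h                        ≡⟨ ∑ʷ-suc n h ⟩
    a * ∑ʷ n (h ∘ (chosen Vec.∷_)) + (b * ∑ʷ n (h ∘ (omitted Vec.∷_)) + ∑ʷ n (h ∘ (added Vec.∷_)))
      ≤⟨ ℕ.+-mono-≤ (ℕ.*-monoʳ-≤ a (demote-∑ʷ u (le ∘ _)))
           (ℕ.+-mono-≤ (ℕ.*-monoʳ-≤ b (demote-∑ʷ u (le ∘ _))) (demote-∑ʷ u (le ∘ _))) ⟩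
    a * (suc a * γ) + (b * (suc a * ω) + suc a * α) ≡⟨ rearrange a b (suc a) α ω γ ⟩
    suc a * (a * γ + (b * ω + α))       ≡⟨ cong (suc a *_) (∑ʷ-suc n h′) ⟨
    suc a * ∑ʷ (suc n) h′               ∎
    where
    open ℕ.≤-Reasoning
    α = ∑ʷ n (h′ ∘ (added Vec.∷_))
    ω = ∑ʷ n (h′ ∘ (omitted Vec.∷_))
    γ = ∑ʷ n (h′ ∘ (chosen Vec.∷_))
    rearrange : ∀ a b s α ω γ → a * (s * γ) + (b * (s * ω) + s * α) ≡ s * (a * γ + (b * ω + α))
    rearrange = solve-∀

-- Scores and the utility of the exponential mechanism

score : ℕ → Candidate n → ℕ
score κ Vec.[]              = 0
score κ (chosen  Vec.∷ σ) = score κ σ + suc κ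
score κ (omitted Vec.∷ σ) = score κ σ + κ
score κ (added   Vec.∷ σ) = score κ σ

weight-score : ∀ m κ (σ : Candidate n) → weight (2 ^ (m * suc κ)) (2 ^ (m * κ)) σ ≡ 2 ^ (m * score κ σ)
weight-score m κ Vec.[] = cong (2 ^_) (sym (ℕ.*-zeroʳ m))
weight-score m κ (chosen Vec.∷ σ) = trans (cong (_* 2 ^ (m * suc κ)) (weight-score m κ σ))
  (trans (sym (ℕ.^-distribˡ-+-* 2 (m * score κ σ) (m * suc κ))) (cong (2 ^_) (sym (ℕ.*-distribˡ-+ m (score κ σ) (suc κ)))))
weight-score m κ (omitted Vec.∷ σ) = trans (cong (_* 2 ^ (m * κ)) (weight-score m κ σ))
  (trans (sym (ℕ.^-distribˡ-+-* 2 (m * score κ σ) (m * κ))) (cong (2 ^_) (sym (ℕ.*-distribˡ-+ m (score κ σ) κ))))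
weight-score m κ (added Vec.∷ σ) = weight-score m κ σ

-- This explains the score: it is |T| - κ |S ∖ T|, shifted by κ n to remain a natural number.
score-noise : ∀ κ (σ : Candidate n) → score κ σ + κ * ∣ noise σ ∣ ≡ ∣ core σ ∣ + κ * n
score-noise κ Vec.[] = refl
score-noise {suc n} κ (chosen Vec.∷ σ) = trans (shift (score κ σ) _ κ) (trans (cong (_+ suc κ) (score-noise κ σ)) (shift′ ∣ core σ ∣ κ n))
  where
  shift : ∀ v x κ → v + suc κ + x ≡ v + x + suc κ
  shift = solve-∀
  shift′ : ∀ t κ n → t + κ * n + suc κ ≡ suc t + κ * suc n
  shift′ = solve-∀
score-noise {suc n} κ (omitted Vec.∷ σ) = trans (shift (score κ σ) _ κ) (trans (cong (_+ κ) (score-noise κ σ)) (shift′ ∣ core σ ∣ κ n))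
  where
  shift : ∀ v x κ → v + κ + x ≡ v + x + κ
  shift = solve-∀
  shift′ : ∀ t κ n → t + κ * n + κ ≡ t + κ * suc n
  shift′ = solve-∀
score-noise {suc n} κ (added Vec.∷ σ) = trans (shift (score κ σ) κ ∣ noise σ ∣) (trans (cong (_+ κ) (score-noise κ σ)) (shift′ ∣ core σ ∣ κ n))
  where
  shift : ∀ v κ x → v + κ * suc x ≡ v + κ * x + κ
  shift = solve-∀
  shift′ : ∀ t κ n → t + κ * n + κ ≡ t + κ * suc n
  shift′ = solve-∀

core≤support : (σ : Candidate n) → ∣ core σ ∣ ≤ ∣ support σ ∣
core≤support Vec.[]              = z≤n
core≤support (chosen  Vec.∷ σ) = s≤s (core≤support σ)
core≤support (omitted Vec.∷ σ) = core≤support σ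
core≤support (added   Vec.∷ σ) = ℕ.m≤n⇒m≤1+n (core≤support σ)

exactly : Subset n → Candidate n
exactly Vec.[]              = Vec.[]
exactly (inside  Vec.∷ S) = chosen Vec.∷ exactly S
exactly (outside Vec.∷ S) = omitted Vec.∷ exactly S

core-exactly : (S : Subset n) → core (exactly S) ≡ S
core-exactly Vec.[]              = refl
core-exactly (inside  Vec.∷ S) = cong (inside Vec.∷_) (core-exactly S)
core-exactly (outside Vec.∷ S) = cong (outside Vec.∷_) (core-exactly S)

noise-exactly : (S : Subset n) → ∣ noise (exactly S) ∣ ≡ 0
noise-exactly Vec.[]              = refl
noise-exactly (inside  Vec.∷ S) = noise-exactly S
noise-exactly (outside Vec.∷ S) = noise-exactly S

n≤2^n : ∀ n → n ≤ 2 ^ n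
n≤2^n zero    = z≤n
n≤2^n (suc n) = ℕ.+-mono-≤ (ℕ.m^n>0 2 n) (ℕ.≤-trans (n≤2^n n) (ℕ.m≤m+n (2 ^ n) 0))

3^n≤2^2n : ∀ n → 3 ^ n ≤ 2 ^ (2 * n)
3^n≤2^2n n = ℕ.≤-trans (ℕ.^-monoˡ-≤ n (s≤s (s≤s (s≤s z≤n)))) (ℕ.≤-reflexive (ℕ.^-*-assoc 2 2 n))

-- The exponential mechanism loses at most (2 n + 1) / m: candidates losing
-- more than 2 n / m carry less than the weight 2 ^ V of the optimum, even
-- after multiplication by their loss, because z ≤ 2 ^ z.
module _ (m κ opt : ℕ) {n : ℕ} (χ F : Candidate n → ℕ)
  (χ-F : ∀ σ → χ σ ≡ 0 ⊎ χ σ ≡ 1 × score κ σ ≤ F σ + κ * n)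
  (optimum : ∃[ σ ] χ σ ≡ 1 × opt + κ * n ≤ score κ σ) where

  private
    a = 2 ^ (m * suc κ)
    b = 2 ^ (m * κ)
    V = m * (opt + κ * n)

  loss : ∀ σ → score κ σ ≤ F σ + κ * n →
    2 ^ (2 * n) * (2 ^ (m * score κ σ) * (m * opt)) ≤
    2 ^ (2 * n) * (2 ^ (m * score κ σ) * (m * F σ + 2 * n)) + 2 ^ V
  loss σ v≤ with ℕ.≤-total (m * opt) (m * F σ + 2 * n)
  ... | inj₁ le = ℕ.≤-trans (ℕ.*-monoʳ-≤ (2 ^ (2 * n)) (ℕ.*-monoʳ-≤ (2 ^ (m * score κ σ)) le)) (ℕ.m≤m+n _ _)
  -- Here `z` is what `m` times the loss has in excess of `2 n`. The score falls short accordingly,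
  -- so that `2 ^ (2 n)` times the weight is at most `2 ^ (V - z)`.
  ... | inj₂ ge with z , eq ← ℕ.m≤n⇒∃[o]m+o≡n ge = begin
    P * (w * (m * opt))                         ≡⟨ cong (λ x → P * (w * x)) eq ⟨
    P * (w * (m * F σ + 2 * n + z))             ≡⟨ expand P w (m * F σ + 2 * n) z ⟩
    P * (w * (m * F σ + 2 * n)) + P * w * z     ≤⟨ ℕ.+-monoʳ-≤ _ (ℕ.*-monoʳ-≤ (P * w) (n≤2^n z)) ⟩
    P * (w * (m * F σ + 2 * n)) + P * w * 2 ^ z ≡⟨ cong (_+_ (P * (w * (m * F σ + 2 * n)))) (trans (cong (_* 2 ^ z) (sym (ℕ.^-distribˡ-+-* 2 (2 * n) (m * v))))
                                                                     (sym (ℕ.^-distribˡ-+-* 2 (2 * n + m * v) z))) ⟩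
    P * (w * (m * F σ + 2 * n)) + 2 ^ (2 * n + m * v + z) ≤⟨ ℕ.+-monoʳ-≤ _ (ℕ.^-monoʳ-≤ 2 exponent≤) ⟩
    P * (w * (m * F σ + 2 * n)) + 2 ^ V         ∎
    where
    open ℕ.≤-Reasoning
    P = 2 ^ (2 * n)
    v = score κ σ
    w = 2 ^ (m * v)
    expand : ∀ P w x z → P * (w * (x + z)) ≡ P * (w * x) + P * w * z
    expand = solve-∀
    rearrange : ∀ n m F k z → 2 * n + m * (F + k) + z ≡ m * F + 2 * n + z + m * k
    rearrange = solve-∀
    exponent≤ : 2 * n + m * v + z ≤ V
    exponent≤ = begin
      2 * n + m * v + z                   ≤⟨ ℕ.+-monoˡ-≤ z (ℕ.+-monoʳ-≤ (2 * n) (ℕ.*-monoʳ-≤ m v≤)) ⟩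
      2 * n + m * (F σ + κ * n) + z       ≡⟨ rearrange n m (F σ) (κ * n) z ⟩
      m * F σ + 2 * n + z + m * (κ * n)   ≡⟨ cong (_+ m * (κ * n)) eq ⟩
      m * opt + m * (κ * n)               ≡⟨ ℕ.*-distribˡ-+ m opt (κ * n) ⟨
      V                                   ∎

  utility : m * opt * ∑ʷ a b n χ ≤ m * ∑ʷ a b n (λ σ → χ σ * F σ) + suc (2 * n) * ∑ʷ a b n χ
  -- Scaling by `P = 2 ^ (2 n)` lets every candidate have an error of `2 ^ V`: there are `3 ^ n ≤ P`
  -- of them, and the optimum alone gives `2 ^ V ≤ mass`, so all errors together amount to one extra
  -- `P * mass`.
  utility = ℕ.*-cancelˡ-≤ P {{ℕ.m^n≢0 2 (2 * n)}} (begin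
    P * (m * opt * mass)                                  ≡⟨ cong (P *_) (∑-* n (m * opt) _) ⟨
    P * ∑ n (λ σ → m * opt * (w σ * χ σ))              ≡⟨ ∑-* n P _ ⟨
    ∑ n (λ σ → P * (m * opt * (w σ * χ σ)))            ≤⟨ ∑-mono n term ⟩
    ∑ n (λ σ → P * (m * (w σ * (χ σ * F σ)) + 2 * n * (w σ * χ σ)) + 2 ^ V)
      ≡⟨ ∑-+ n _ _ ⟩
    ∑ n (λ σ → P * (m * (w σ * (χ σ * F σ)) + 2 * n * (w σ * χ σ))) + ∑ n (λ _ → 2 ^ V)
      ≡⟨ cong₂ _+_ (trans (∑-* n P _) (cong (P *_) (trans (∑-+ n _ _) (cong₂ _+_ (∑-* n m _) (∑-* n (2 * n) _)))))
                   (∑-const n (2 ^ V)) ⟩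
    P * (m * value + 2 * n * mass) + 3 ^ n * 2 ^ V            ≤⟨ ℕ.+-monoʳ-≤ _ (ℕ.*-mono-≤ (3^n≤2^2n n) 2^V≤mass) ⟩
    P * (m * value + 2 * n * mass) + P * mass                    ≡⟨ collect P (m * value) (2 * n) mass ⟩
    P * (m * value + suc (2 * n) * mass)                      ∎)
    where
    open ℕ.≤-Reasoning
    P = 2 ^ (2 * n)
    w : Candidate n → ℕ
    w = weight a b
    mass = ∑ʷ a b n χ
    value = ∑ʷ a b n (λ σ → χ σ * F σ)
    collect : ∀ P value n mass → P * (value + n * mass) + P * mass ≡ P * (value + suc n * mass)
    collect = solve-∀
    swap-0 : ∀ P m o w F → P * (m * o * (w * 0)) ≡ 0
    swap-0 = solve-∀
    swap-1 : ∀ P m o w → P * (m * o * (w * 1)) ≡ P * (w * (m * o))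
    swap-1 = solve-∀
    swap-F : ∀ P m w F n → P * (w * (m * F + 2 * n)) ≡ P * (m * (w * (1 * F)) + 2 * n * (w * 1))
    swap-F = solve-∀
    term : ∀ σ → P * (m * opt * (w σ * χ σ)) ≤ P * (m * (w σ * (χ σ * F σ)) + 2 * n * (w σ * χ σ)) + 2 ^ V
    term σ with χ-F σ
    ... | inj₁ χ≡0 rewrite χ≡0 | swap-0 P m opt (w σ) (F σ) = z≤n
    ... | inj₂ (χ≡1 , v≤) rewrite χ≡1 | swap-1 P m opt (w σ) | weight-score m κ σ =
      subst (λ x → P * (2 ^ (m * score κ σ) * (m * opt)) ≤ x + 2 ^ V) (swap-F P m (2 ^ (m * score κ σ)) (F σ) n) (loss σ v≤)
    2^V≤mass : 2 ^ V ≤ mass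
    2^V≤mass = let σ , χ≡1 , V≤ = optimum in begin
      2 ^ V               ≤⟨ ℕ.^-monoʳ-≤ 2 (ℕ.*-monoʳ-≤ m V≤) ⟩
      2 ^ (m * score κ σ) ≡⟨ weight-score m κ σ ⟨
      w σ                 ≡⟨ trans (cong (w σ *_) χ≡1) (ℕ.*-identityʳ (w σ)) ⟨
      w σ * χ σ           ≤⟨ term≤∑ n (λ σ → w σ * χ σ) σ ⟩
      mass                   ∎

-- Expectations under sampling

sum-applyUpTo-+ : ∀ (f : ℕ → ℕ) m n → sum (applyUpTo f (m + n)) ≡ sum (applyUpTo f m) + sum (applyUpTo (λ i → f (m + i)) n)
sum-applyUpTo-+ f zero    n = refl
sum-applyUpTo-+ f (suc m) n = trans (cong (_+_ (f 0)) (sum-applyUpTo-+ (f ∘ suc) m n)) (sym (ℕ.+-assoc (f 0) _ _))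

sum-applyUpTo-cong : ∀ {f g : ℕ → ℕ} n → (∀ i → i < n → f i ≡ g i) → sum (applyUpTo f n) ≡ sum (applyUpTo g n)
sum-applyUpTo-cong zero    eq = refl
sum-applyUpTo-cong (suc n) eq = cong₂ _+_ (eq 0 (s≤s z≤n)) (sum-applyUpTo-cong n λ i i<n → eq (suc i) (s≤s i<n))

sum-applyUpTo-const : ∀ c n → sum (applyUpTo (λ _ → c) n) ≡ n * c
sum-applyUpTo-const c zero    = refl
sum-applyUpTo-const c (suc n) = cong (_+_ c) (sum-applyUpTo-const c n)

pick-0 : (cur : X) (L : List (ℕ × X)) → pick cur L 0 ≡ cur
pick-0 cur []            = refl
pick-0 cur ((w , x) ∷ L) = trans (cong (pick cur L) (ℕ.0∸n≡0 w)) (pick-0 cur L)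

-- An item of weight `w` at the head is the outcome of the lowest `w` counters; the higher ones
-- reach the tail diminished by `w`.
pick-sum : (F : X → ℕ) (cur : X) (L : List (ℕ × X)) →
  sum (applyUpTo (λ j → F (pick cur L (suc j))) (total L)) ≡ sum (map (λ (w , x) → w * F x) L)
pick-sum F cur []            = refl
pick-sum F cur ((w , x) ∷ L) = trans (sum-applyUpTo-+ _ w (total L)) (cong₂ _+_
  (trans (sum-applyUpTo-cong w (λ j j<w → cong F (trans (cong (pick x L) (ℕ.m≤n⇒m∸n≡0 j<w)) (pick-0 x L))))
         (sum-applyUpTo-const (F x) w))
  (trans (sum-applyUpTo-cong (total L) (λ j _ → cong (F ∘ pick x L) (trans (ℕ.+-∸-assoc 1 {w + j} {w} (ℕ.m≤m+n w j)) (cong suc (ℕ.m+n∸m≡n w j)))))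
         (pick-sum F x L)))

𝔼-uniform : ∀ m (h : ℕ → X) (f : X → ℚ) (F : X → ℕ) → (∀ x → f x ≡ fromℕ (F x)) →
  𝔼 (mapDist h (uniform m)) f ≡ + sum (applyUpTo (F ∘ h) (suc m)) ℚ./ suc m
𝔼-uniform m h f F eq = begin
  𝔼 (mapDist h (uniform m)) f                        ≡⟨ go (upTo (suc m)) ⟩
  (+ 1 ℚ./ suc m) ℚ.* fromℕ (sum (map (F ∘ h) (upTo (suc m))))
    ≡⟨ cong (λ xs → (+ 1 ℚ./ suc m) ℚ.* fromℕ (sum xs)) (List.map-applyUpTo id (F ∘ h) (suc m)) ⟩
  (+ 1 ℚ./ suc m) ℚ.* fromℕ S                        ≡⟨ ℚ.*-comm (+ 1 ℚ./ suc m) (fromℕ S) ⟩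
  fromℕ S ℚ.* (+ 1 ℚ./ suc m)                        ≡⟨ fromℕ-*-/ S 1 m ⟩
  + (S * 1) ℚ./ suc m                                ≡⟨ cong (λ s → + s ℚ./ suc m) (ℕ.*-identityʳ S) ⟩
  + S ℚ./ suc m                                      ∎
  where
  open ≡-Reasoning
  S = sum (applyUpTo (F ∘ h) (suc m))
  p = + 1 ℚ./ suc m
  go : ∀ is → 𝔼 (mapDist h (map (λ i → + 1 ℚ./ suc m , i) is)) f ≡ p ℚ.* fromℕ (sum (map (F ∘ h) is))
  go []       = sym (ℚ.*-zeroʳ p)
  go (i ∷ is) = trans (cong₂ (λ x y → p ℚ.* x ℚ.+ y) (eq (h i)) (go is))
    (trans (sym (ℚ.*-distribˡ-+ p (fromℕ (F (h i))) (fromℕ (sum (map (F ∘ h) is)))))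
           (cong (p ℚ.*_) (fromℕ-+ (F (h i)) _)))

-- Distributions read off a run

catJust : Dist (Maybe X) → Dist X
catJust []                  = []
catJust ((p , nothing) ∷ d) = catJust d
catJust ((p , just x) ∷ d)  = (p , x) ∷ catJust d

catJust-just : (d : Dist X) → catJust (mapDist just d) ≡ d
catJust-just []      = refl
catJust-just (_ ∷ d) = cong (_ ∷_) (catJust-just d)

-- Serves to define the encoder and the decoder on graphs that are not known to lie in 𝒢. Runs that
-- exceed the budget are dropped; on 𝒢 there are none.
outputs : Prog A B → ⟦ A ⟧ᵗ → ℕ → Dist ⟦ B ⟧ᵗ
outputs p x t = catJust (mapDist (Maybe.map proj₁) (⟦ p ⟧ x t))

outputs-spec : (p : Prog A B) (x : ⟦ A ⟧ᵗ) (t : ℕ) {d : Dist ⟦ B ⟧ᵗ} → p ⟨ x ⟩⇓[ t ] d → outputs p x t ≡ d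
outputs-spec p x t {d} h = trans (cong catJust h) (catJust-just d)

𝔼-mapDist : (h : X → Y) (d : Dist X) (f : Y → ℚ) → 𝔼 (mapDist h d) f ≡ 𝔼 d (f ∘ h)
𝔼-mapDist h []            f = refl
𝔼-mapDist h ((p , x) ∷ d) f = cong (p ℚ.* f (h x) ℚ.+_) (𝔼-mapDist h d f)

𝔼-return : (x : X) (f : X → ℚ) → 𝔼 (return x) f ≡ f x
𝔼-return x f = trans (ℚ.+-identityʳ _) (ℚ.*-identityˡ (f x))

bind-deterministic : {k : X → Dist Y} {h : X → Y} → (∀ x → k x ≡ return (h x)) → (d : Dist X) → (d >>= k) ≡ mapDist h d
bind-deterministic eq []            = refl
bind-deterministic {k = k} eq ((p , x) ∷ d) rewrite eq x =
  cong₂ (λ q r → (q , _) ∷ r) (ℚ.*-identityʳ p) (bind-deterministic {k = k} eq d)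

digits≤ : ∀ m → digits m ≤ suc m
digits≤ m = digits-2^ m (n≤2^n m)

total-weightedCandidates : ∀ a b (D : (S : Subset n) → Subset ∣ S ∣) →
  total (weightedCandidates a b D) ≡ ∑ʷ a b n (isEmpty ∘ D ∘ core)
total-weightedCandidates {n} a b D =
  trans (cong sum (sym (List.map-∘ (candidates n)))) (∑-candidates n _)

-- Expectations become quotients of natural sums over candidates, so privacy and utility can be
-- settled in ℕ. The denominator is written as a successor because `uniform m` has `suc m` outcomes.
𝔼-sampled : ∀ a b (D : (S : Subset n) → Subset ∣ S ∣) (f : List (⊤ ⊎ ⊤) → ℚ) (F : List (⊤ ⊎ ⊤) → ℕ) →
  (∀ x → f x ≡ fromℕ (F x)) → 1 ≤ ∑ʷ a b n (isEmpty ∘ D ∘ core) →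
  𝔼 (sampled (weightedCandidates a b D)) f ≡
  + ∑ʷ a b n (λ σ → isEmpty (D (core σ)) * F (encodeSubset (support σ))) ℚ./ suc (∑ʷ a b n (isEmpty ∘ D ∘ core) ∸ 1)
𝔼-sampled {n} a b D f F eq 1≤ = begin
  𝔼 (sampled L) f
    ≡⟨ 𝔼-uniform (total L ∸ 1) (λ j → pick [] L (j + 1)) f F eq ⟩
  + sum (applyUpTo (λ j → F (pick [] L (j + 1))) (suc (total L ∸ 1))) ℚ./ suc (total L ∸ 1)
    ≡⟨ cong₂ (λ x y → + x ℚ./ suc (y ∸ 1)) numerator total≡ ⟩
  + ∑ʷ a b n (λ σ → isEmpty (D (core σ)) * F (encodeSubset (support σ))) ℚ./ suc (∑ʷ a b n (isEmpty ∘ D ∘ core) ∸ 1) ∎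
  where
  open ≡-Reasoning
  L = weightedCandidates a b D
  total≡ = total-weightedCandidates a b D
  numerator : sum (applyUpTo (λ j → F (pick [] L (j + 1))) (suc (total L ∸ 1))) ≡
              ∑ʷ a b n (λ σ → isEmpty (D (core σ)) * F (encodeSubset (support σ)))
  numerator = begin
    sum (applyUpTo (λ j → F (pick [] L (j + 1))) (suc (total L ∸ 1)))
      ≡⟨ cong (λ t → sum (applyUpTo (λ j → F (pick [] L (j + 1))) t)) (ℕ.m+[n∸m]≡n (subst (1 ≤_) (sym total≡) 1≤)) ⟩
    sum (applyUpTo (λ j → F (pick [] L (j + 1))) (total L))
      ≡⟨ sum-applyUpTo-cong (total L) (λ j _ → cong (F ∘ pick [] L) (ℕ.+-comm j 1)) ⟩
    sum (applyUpTo (λ j → F (pick [] L (suc j))) (total L)) ≡⟨ pick-sum F [] L ⟩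
    sum (map (λ (w , x) → w * F x) L)                       ≡⟨ cong sum (List.map-∘ (candidates n)) ⟨
    sum (map (λ σ → weight a b σ * isEmpty (D (core σ)) * F (encodeSubset (support σ))) (candidates n))
      ≡⟨ ∑-candidates n _ ⟩
    ∑ n (λ σ → weight a b σ * isEmpty (D (core σ)) * F (encodeSubset (support σ)))
      ≡⟨ ∑-cong n (λ σ → ℕ.*-assoc (weight a b σ) _ _) ⟩
    ∑ʷ a b n (λ σ → isEmpty (D (core σ)) * F (encodeSubset (support σ))) ∎

-- Empty deletion sets and neighbouring graphs

isEmpty-cases : (D : Subset n) → isEmpty D ≡ 0 ⊎ isEmpty D ≡ 1
isEmpty-cases Vec.[]              = inj₂ refl
isEmpty-cases (inside  Vec.∷ D) = inj₁ refl
isEmpty-cases (outside Vec.∷ D) = isEmpty-cases D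

∣D∣≡0⇒isEmpty : (D : Subset n) → ∣ D ∣ ≡ 0 → isEmpty D ≡ 1
∣D∣≡0⇒isEmpty Vec.[]              _  = refl
∣D∣≡0⇒isEmpty (outside Vec.∷ D) eq = ∣D∣≡0⇒isEmpty D eq

isEmpty⇒∈∁ : (D : Subset n) → isEmpty D ≡ 1 → ∀ v → v Subset.∈ ∁ D
isEmpty⇒∈∁ (outside Vec.∷ D) eq zero    = Vec.here
isEmpty⇒∈∁ (outside Vec.∷ D) eq (suc v) = Vec.there (isEmpty⇒∈∁ D eq v)

-- Equal adjacency is a case of its own because a graph without vertices offers no `u`.
Similar : Graph n → Graph n → Set
Similar {n} G G′ = (∀ v w → adj G v w ≡ adj G′ v w) ⊎
  ∃ λ u → ∀ v w → v ≢ u → w ≢ u → adj G v w ≡ adj G′ v w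

similar-sym : {G G′ : Graph n} → Similar G G′ → Similar G′ G
similar-sym (inj₁ same)       = inj₁ λ v w → sym (same v w)
similar-sym (inj₂ (u , same)) = inj₂ (u , λ v w v≢u w≢u → sym (same v w v≢u w≢u))

neighbours-similar : (G G′ : Graph n) → G ∼ G′ → Similar G G′
neighbours-similar {n} G G′ le = similar (edgeDifference G G′) le differing
  where
  listed : ∀ {v w} → v Fin.< w → adj G v w ≢ adj G′ v w → (v , w) ∈ edgeDifference G G′
  listed v<w ≢ = ∈-filter⁺ _ (∈-cartesianProduct⁺ (∈-allFin _) (∈-allFin _)) (v<w , ≢)

  differing : ∀ v w → adj G v w ≡ adj G′ v w ⊎ (v , w) ∈ edgeDifference G G′ ⊎ (w , v) ∈ edgeDifference G G′
  differing v w with adj G v w Bool.≟ adj G′ v w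
  ... | yes eq = inj₁ eq
  ... | no ≢ with Fin.<-cmp v w
  ...   | tri< v<w _ _ = inj₂ (inj₁ (listed v<w ≢))
  ...   | tri≈ _ refl _ = contradiction (trans (irrefl G v) (sym (irrefl G′ v))) ≢
  ...   | tri> _ _ w<v = inj₂ (inj₂ (listed w<v λ eq → ≢ (trans (symm G v w) (trans eq (symm G′ w v)))))

  similar : ∀ es → length es ≤ 1 →
    (∀ v w → adj G v w ≡ adj G′ v w ⊎ (v , w) ∈ es ⊎ (w , v) ∈ es) → Similar G G′
  similar [] _ d = inj₁ λ v w → [ id , [ (λ ()) , (λ ()) ]′ ]′ (d v w)
  -- Either end of the only differing edge could serve.
  similar ((u , u′) ∷ []) _ d = inj₂ (u , λ v w → agree (d v w))
    where
    agree : ∀ {v w} → adj G v w ≡ adj G′ v w ⊎ (v , w) ∈ (u , u′) ∷ [] ⊎ (w , v) ∈ (u , u′) ∷ [] →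
      v ≢ u → w ≢ u → adj G v w ≡ adj G′ v w
    agree (inj₁ eq) _ _                   = eq
    agree (inj₂ (inj₁ (here refl))) v≢u _ = contradiction refl v≢u
    agree (inj₂ (inj₂ (here refl))) _ w≢u = contradiction refl w≢u
  similar (_ ∷ _ ∷ _) (s≤s ()) d

-- Rational bounds on ε, its exponential and the ratio

p≤q+r⇒p-r≤q : ∀ {p q r} → p ℚ.≤ q ℚ.+ r → p ℚ.- r ℚ.≤ q
p≤q+r⇒p-r≤q {p} {q} {r} le = subst (p ℚ.- r ℚ.≤_)
  (trans (ℚ.+-assoc q r (ℚ.- r)) (trans (cong (q ℚ.+_) (ℚ.+-inverseʳ r)) (ℚ.+-identityʳ q)))
  (ℚ.+-monoˡ-≤ (ℚ.- r) le)

-- Allows the claimed real ratio to be replaced by a rational one that is at least as large and does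
-- not depend on `i`.
ratio-bound : ∀ c (ε : ℝ) d i → 1ℚ ℚ.⊔ approx ε i ℚ.≤ fromℕ (suc d) → (1- c / ε) i ℚ.≤ 1ℚ ℚ.- + c ℚ./ suc d
ratio-bound c ε d i ε≤ = ℚ.+-monoʳ-≤ 1ℚ (ℚ.neg-antimono-≤ (begin
  + c ℚ./ suc d                                 ≡⟨ cong (λ x → + x ℚ./ suc d) (ℕ.*-identityʳ c) ⟨
  + (c * 1) ℚ./ suc d                           ≡⟨ fromℕ-*-/ c 1 d ⟨
  fromℕ c ℚ.* (+ 1 ℚ./ suc d)                   ≤⟨ ℚ.*-monoˡ-≤-nonNeg (fromℕ c) {{ℚ.nonNegative (fromℕ-nonNeg c)}} inverse≤ ⟩
  fromℕ c ℚ.* ℚ.1/ ε′                           ∎))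
  where
  open ℚ.≤-Reasoning
  ε′ = 1ℚ ℚ.⊔ approx ε i
  ε′>0 : 0ℚ ℚ.< ε′
  ε′>0 = ℚ.<-≤-trans (toWitness {a? = 0ℚ ℚ.<? 1ℚ} tt) (ℚ.p≤p⊔q 1ℚ (approx ε i))
  instance
    ε′-pos : ℚ.Positive ε′
    ε′-pos = ℚ.positive ε′>0
    ε′-nonZero : ℚ.NonZero ε′
    ε′-nonZero = ℚ.pos⇒nonZero ε′
    inverse-pos : ℚ.Positive (ℚ.1/ ε′)
    inverse-pos = ℚ.1/pos⇒pos ε′
    inverse-nonNeg : ℚ.NonNegative (ℚ.1/ ε′)
    inverse-nonNeg = ℚ.pos⇒nonNeg (ℚ.1/ ε′)
  inverse≤ : + 1 ℚ./ suc d ℚ.≤ ℚ.1/ ε′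
  inverse≤ = begin
    p                            ≡⟨ ℚ.*-identityʳ p ⟨
    p ℚ.* 1ℚ                     ≡⟨ cong (p ℚ.*_) (ℚ.*-inverseʳ ε′) ⟨
    p ℚ.* (ε′ ℚ.* ℚ.1/ ε′)       ≡⟨ ℚ.*-assoc p ε′ (ℚ.1/ ε′) ⟨
    p ℚ.* ε′ ℚ.* ℚ.1/ ε′
      ≤⟨ ℚ.*-monoʳ-≤-nonNeg (ℚ.1/ ε′) (ℚ.*-monoˡ-≤-nonNeg p {{ℚ.nonNegative (/-mono {0} {1} {0} {d} z≤n)}} ε≤) ⟩
    p ℚ.* fromℕ (suc d) ℚ.* ℚ.1/ ε′
      ≡⟨ cong (ℚ._* ℚ.1/ ε′) (trans (ℚ.*-comm p (fromℕ (suc d))) (trans (fromℕ-*-/ (suc d) 1 d)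
           (/-cong {suc d * 1} {1} {d} {0} (trans (ℕ.*-identityʳ _) (ℕ.*-comm (suc d) 1))))) ⟩
    1ℚ ℚ.* ℚ.1/ ε′               ≡⟨ ℚ.*-identityˡ (ℚ.1/ ε′) ⟩
    ℚ.1/ ε′                      ∎
    where p = + 1 ℚ./ suc d

fraction-bound : ∀ {c d k v z} → suc d * (k * suc z) ≤ suc d * v + c * (k * suc z) →
  (1ℚ ℚ.- + c ℚ./ suc d) ℚ.* fromℕ k ℚ.≤ + v ℚ./ suc z
fraction-bound {c} {d} {k} {v} {z} le = begin
  (1ℚ ℚ.- q) ℚ.* fromℕ k                  ≡⟨ ℚ.*-distribʳ-+ (fromℕ k) 1ℚ (ℚ.- q) ⟩
  1ℚ ℚ.* fromℕ k ℚ.+ (ℚ.- q) ℚ.* fromℕ k  ≡⟨ cong₂ ℚ._+_ (ℚ.*-identityˡ (fromℕ k)) (sym (ℚ.neg-distribˡ-* q (fromℕ k))) ⟩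
  fromℕ k ℚ.- q ℚ.* fromℕ k               ≤⟨ p≤q+r⇒p-r≤q k≤ ⟩
  + v ℚ./ suc z                           ∎
  where
  open ℚ.≤-Reasoning
  q = + c ℚ./ suc d
  rearrange₁ : ∀ d k z → k * (z * d) ≡ d * (k * z)
  rearrange₁ = solve-∀
  rearrange₂ : ∀ d v c k z → d * v + c * (k * z) ≡ (v * d + k * c * z) * 1
  rearrange₂ = solve-∀
  k≤ : fromℕ k ℚ.≤ + v ℚ./ suc z ℚ.+ q ℚ.* fromℕ k
  k≤ = begin
    fromℕ k
      ≤⟨ /-mono {k} {v * suc d + k * c * suc z} {0} {d + z * suc d}
           (subst₂ _≤_ (sym (rearrange₁ (suc d) k (suc z))) (rearrange₂ (suc d) v c k (suc z)) le) ⟩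
    + (v * suc d + k * c * suc z) ℚ./ (suc z * suc d)         ≡⟨ /-+ v (k * c) z d ⟨
    + v ℚ./ suc z ℚ.+ + (k * c) ℚ./ suc d                     ≡⟨ cong (+ v ℚ./ suc z ℚ.+_) (trans (ℚ.*-comm q (fromℕ k)) (fromℕ-*-/ k c d)) ⟨
    + v ℚ./ suc z ℚ.+ q ℚ.* fromℕ k                           ∎

-- Both bounds hold for every approximation of ε, which costs the additive constants.
quotient : (ε : ℝ) (s : ℕ) .{{_ : NonZero s}} → ∃ λ m →
  (m ≢ 0 → ∀ i → fromℕ (s * m) ℚ.≤ approx ε i) × (∀ i → 1ℚ ℚ.⊔ approx ε i ℚ.≤ fromℕ (suc (s * suc m + 3)))
quotient ε s = M ℕ./ s , below , above
  where
  -- All approximations lie between `q` and `q + 4`.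
  q = approx ε 0 ℚ.- fromℕ 2
  M = proj₁ (floor q)

  below : M ℕ./ s ≢ 0 → ∀ i → fromℕ (s * (M ℕ./ s)) ℚ.≤ approx ε i
  below ≢0 i = begin
    fromℕ (s * (M ℕ./ s))   ≤⟨ fromℕ-mono (ℕ.≤-trans (ℕ.≤-reflexive (ℕ.*-comm s (M ℕ./ s))) (ℕ.m/n*n≤m M s)) ⟩
    fromℕ M                 ≤⟨ [ (λ M≡0 → contradiction (trans (ℕ./-congˡ {o = s} M≡0) (ℕ.0/n≡0 s)) ≢0) , id ]′ (proj₁ (proj₂ (floor q))) ⟩
    q                       ≤⟨ p≤q+r⇒p-r≤q (approx-difference ε 0 i) ⟩
    approx ε i              ∎
    where open ℚ.≤-Reasoning

  M< : suc M ≤ s * suc (M ℕ./ s)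
  M< = begin-strict
    M                            ≡⟨ ℕ.m≡m%n+[m/n]*n M s ⟩
    M ℕ.% s + M ℕ./ s * s        <⟨ ℕ.+-monoˡ-< (M ℕ./ s * s) (ℕ.m%n<n M s) ⟩
    suc (M ℕ./ s) * s            ≡⟨ ℕ.*-comm (suc (M ℕ./ s)) s ⟩
    s * suc (M ℕ./ s)            ∎
    where open ℕ.≤-Reasoning

  above : ∀ i → 1ℚ ℚ.⊔ approx ε i ℚ.≤ fromℕ (suc (s * suc (M ℕ./ s) + 3))
  above i = ℚ.⊔-lub (fromℕ-mono {1} {suc (s * suc (M ℕ./ s) + 3)} (s≤s z≤n)) (begin
    approx ε i                                   ≤⟨ approx-difference ε i 0 ⟩
    approx ε 0 ℚ.+ fromℕ 2                       ≡⟨ cong (ℚ._+ fromℕ 2) split ⟩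
    q ℚ.+ fromℕ 2 ℚ.+ fromℕ 2                    ≤⟨ ℚ.+-monoˡ-≤ (fromℕ 2) (ℚ.+-monoˡ-≤ (fromℕ 2) (proj₂ (proj₂ (floor q)))) ⟩
    fromℕ (suc M) ℚ.+ fromℕ 2 ℚ.+ fromℕ 2        ≡⟨ trans (cong (ℚ._+ fromℕ 2) (fromℕ-+ (suc M) 2)) (fromℕ-+ (suc M + 2) 2) ⟩
    fromℕ (suc M + 2 + 2)                        ≤⟨ fromℕ-mono (ℕ.≤-trans (ℕ.+-monoˡ-≤ 2 (ℕ.+-monoˡ-≤ 2 M<)) (ℕ.≤-reflexive (rearrange _))) ⟩
    fromℕ (suc (s * suc (M ℕ./ s) + 3))          ∎)
    where
    open ℚ.≤-Reasoning
    rearrange : ∀ x → x + 2 + 2 ≡ suc (x + 3)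
    rearrange = solve-∀
    split : approx ε 0 ≡ q ℚ.+ fromℕ 2
    split = sym (trans (ℚ.+-assoc (approx ε 0) (ℚ.- fromℕ 2) (fromℕ 2))
      (trans (cong (approx ε 0 ℚ.+_) (ℚ.+-inverseˡ (fromℕ 2))) (ℚ.+-identityʳ _)))

-- With tolerance 1, `ε ≥1` says that the approximations are eventually nonnegative; the constant
-- term of the series then gives the bound.
exp-≥1 : (ε : ℝ) → ε ≥1 → ∃ λ N → ∀ i → N ≤ i → 1ℚ ℚ.≤ exp ε i
exp-≥1 ε ε≥1 with N , ε≥ ← ε≥1 1ℚ (toWitness {a? = 0ℚ ℚ.<? 1ℚ} tt) = N , λ i N≤i →
  expPartialSum-large {M = 0} (ℚ.≤-trans (ℚ.≤-reflexive (sym (ℚ.+-inverseʳ 1ℚ))) (p≤q+r⇒p-r≤q (ε≥ i N≤i))) i z≤n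

indicator : Bool → ℕ
indicator b = if b then 1 else 0

fromℕ-indicator : ∀ b → (if b then 1ℚ else 0ℚ) ≡ fromℕ (indicator b)
fromℕ-indicator true  = refl
fromℕ-indicator false = refl

q≤xq : ∀ {x q} → 1ℚ ℚ.≤ x → 0ℚ ℚ.≤ q → q ℚ.≤ x ℚ.* q
q≤xq {x} {q} 1≤x 0≤q = subst (ℚ._≤ x ℚ.* q) (ℚ.*-identityˡ q) (ℚ.*-monoʳ-≤-nonNeg q {{ℚ.nonNegative 0≤q}} 1≤x)

-- Encoders and decoders

count : Prog (list A) nat
count = pair skip (literal 0) ⨾ fold (pair snd (literal 1) ⨾ add)

countᶠ : ∀ {ℓᵢ} {I : Set ℓᵢ} {s : I → ℕ} {xs : I → List ⟦ A ⟧ᵗ} → (∀ i → length (xs i) ≤ s i) →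
  Fast s (λ _ → count) xs (length ∘ xs)
countᶠ {s = s} {xs} l =
  pairᶠ skipᶠ (literalᶠ (λ _ → 0) (poly-const 0)) ⨾ᶠ
  resultᶠ (λ i → trans (foldl-count (xs i) 0) (ℕ.+-identityʳ _))
    (foldᶠ (λ i ys c → length ys + c ≤ s i) (λ _ c _ → c + 1) (poly-mono l poly-size)
      (λ i → ℕ.≤-trans (ℕ.≤-reflexive (ℕ.+-identityʳ _)) (l i))
      (λ {i} {_} {ys} {c} → subst (_≤ s i) (sym (rearrange (length ys) c)))
      (pairᶠ sndᶠ (literalᶠ (λ _ → 1) (poly-const 1)) ⨾ᶠ
       addᶠ (poly-mono (λ (i , _ , ys , c , p) → ℕ.≤-trans (digits≤ c) (s≤s (ℕ.≤-trans (ℕ.m≤n+m c (suc (length ys))) p)))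
                       (poly-+ (poly-const 1) poly-size))
            (poly-const 1)))
  where
  rearrange : ∀ l c → l + (c + 1) ≡ suc l + c
  rearrange = solve-∀
  foldl-count : ∀ {X : Set} (xs : List X) c → foldl (λ c _ → c + 1) c xs ≡ length xs + c
  foldl-count []       c = refl
  foldl-count (_ ∷ xs) c = trans (foldl-count xs (c + 1)) (rearrange (length xs) c)

isSmall : ℕ → Prog (graph ⊗ nat) bool
isSmall θ = pair (fst ⨾ count) (pair (literal θ) snd ⨾ mult) ⨾ leq

isSmallᶠ : ∀ θ {ℓᵢ} {I : Set ℓᵢ} {s : I → ℕ} {g : I → ⟦ graph ⟧ᵗ} {k : I → ℕ} → (∀ i → length (g i) ≤ s i) → (∀ i → k i ≤ s i) →
  Fast s (λ _ → isSmall θ) (λ i → g i , k i) (λ i → bit (length (g i) ≤ᵇ θ * k i))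
isSmallᶠ θ {s = s} {k = k} l k≤ =
  pairᶠ (fstᶠ ⨾ᶠ countᶠ l) (pairᶠ (literalᶠ (λ _ → θ) (poly-const (digits θ))) sndᶠ ⨾ᶠ
                            multᶠ (poly-const (digits θ)) (poly-digits k≤)) ⨾ᶠ
  leqᶠ (poly-digits l)
    (poly-mono (λ i → ℕ.≤-trans (digits≤ (θ * k i)) (s≤s (ℕ.*-monoʳ-≤ θ (k≤ i))))
               (poly-+ (poly-const 1) (poly-* (poly-const θ) poly-size)))
  where
  poly-digits : ∀ {w} → (∀ i → w i ≤ s i) → PolyBounded s (digits ∘ w)
  poly-digits w≤ = poly-mono (λ i → ℕ.≤-trans (digits≤ _) (s≤s (w≤ i))) (poly-+ (poly-const 1) poly-size)

-- The left branch is timed only on indices that pass the test: the enumeration is affordable only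
-- there.
guardᶠ : ∀ {ℓᵢ} {I : Set ℓᵢ} {s : I → ℕ} (β : I → Bool) {p : I → Prog (𝟙 ⊗ C) D} {q : I → Prog (𝟙 ⊗ C) D}
  {z : I → ⟦ C ⟧ᵗ} {d : I → Dist ⟦ D ⟧ᵗ} {y : I → ⟦ D ⟧ᵗ} →
  FastRandom {I = ∃ λ i → T (β i)} (s ∘ proj₁) (p ∘ proj₁) (λ (i , _) → tt , z i) (d ∘ proj₁) →
  Fast s q (λ i → tt , z i) y →
  FastRandom s (λ i → case (p i) (q i)) (λ i → bit (β i) , z i) (λ i → if β i then d i else return (y i))
guardᶠ {s = s} β {p} {q} {z} {d} {y} (fastRandom r (polyBounded K e t)) (fast {T′} r′ t′) =
  fastRandom guarded (poly-+ (polyBounded K e λ i → ℕ.≤-refl) (poly-+ (poly-const 1) t′))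
  where
  guarded : ∀ i → RunsRandomly (case (p i) (q i)) (bit (β i) , z i) (if β i then d i else return (y i))
    (K * suc (s i) ^ e + (1 + T′ i))
  guarded i with β i in eq
  ... | true = withinRandomly (ℕ.≤-trans (s≤s (t _)) (ℕ.≤-trans (ℕ.≤-reflexive (ℕ.+-comm 1 _)) (ℕ.+-monoʳ-≤ _ (s≤s z≤n))))
                 (onLeftRandomly (r (i , subst T (sym eq) tt)))
  ... | false = withinRandomly (ℕ.m≤n+m _ _) (pointMass (onRight (r′ i)))

^-distribʳ-* : ∀ e x y → (x * y) ^ e ≡ x ^ e * y ^ e
^-distribʳ-* zero    x y = refl
^-distribʳ-* (suc e) x y = trans (cong (x * y *_) (^-distribʳ-* e x y)) (rearrange x y (x ^ e) (y ^ e))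
  where
  rearrange : ∀ x y p q → x * y * (p * q) ≡ x * p * (y * q)
  rearrange = solve-∀

-- `inj₁` calls for the baseline, `inj₂` publishes the support of a candidate.
Object : Ty
Object = 𝟙 ⊕ vertices

-- With m = 0 there is no privacy budget to spend.
encoderProgram : Prog graph vertices → (θ κ m : ℕ) → Prog (graph ⊗ nat) Object
encoderProgram del θ κ zero      = unit ⨾ inl
encoderProgram del θ κ m@(suc _) =
  pair (isSmall θ) fst ⨾
  case (snd ⨾ pair (enumerate (2 ^ (m * suc κ)) (2 ^ (m * κ))) skip ⨾ mapWith (weigh del) ⨾ sample ⨾ inr) (unit ⨾ inl)

decoderProgram : (base del : Prog graph vertices) → Prog (graph ⊗ Object) vertices
decoderProgram base del =
  swap ⨾ case (snd ⨾ base) (pair snd (pair fst (swap ⨾ induced ⨾ del)) ⨾ removeDeleted)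

1≤weight : ∀ m κ (σ : Candidate n) → 1 ≤ weight (2 ^ (m * suc κ)) (2 ^ (m * κ)) σ
1≤weight m κ σ = subst (1 ≤_) (sym (weight-score m κ σ)) (ℕ.m^n>0 2 (m * score κ σ))

-- The scheme for fixed Γ and 𝒢

module Scheme {ℓ₁ ℓ₂} (Γ : GraphPredicate ℓ₁) (𝒢 : GraphPredicate ℓ₂) (Γ-her : Hereditary Γ) (𝒢-her : Hereditary 𝒢)
  (baseline : LargeBaseline Γ 𝒢) (approximation : DeletionApproximation Γ 𝒢) where

  private
    module Base = LargeBaseline baseline
    module Del  = DeletionApproximation approximation

  θ κ : ℕ
  θ = proj₁ (upper Base.constant)
  κ = proj₁ (upper Del.ρ)

  baseSet : (G : Graph n) → 𝒢 G → Subset n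
  baseSet G g = proj₁ (Base.correct G g)

  baseSet-Γ : (G : Graph n) (g : 𝒢 G) → Γ (G [ baseSet G g ])
  baseSet-Γ G g = proj₂ (proj₂ (proj₂ (Base.correct G g)))

  baseSet-large : (G : Graph n) (g : 𝒢 G) → n ≤ θ * ∣ baseSet G g ∣
  baseSet-large G g = natural-bound Base.constant θ _ ∣ baseSet G g ∣ (proj₂ (upper Base.constant)) (proj₁ (proj₂ (proj₂ (Base.correct G g))))

  deletionSet : (G : Graph n) → 𝒢 G → Subset n
  deletionSet G g = proj₁ (Del.correct G g)

  deletionSet-Γ : (G : Graph n) (g : 𝒢 G) → Γ (G [ ∁ (deletionSet G g) ])
  deletionSet-Γ G g = proj₁ (proj₂ (proj₂ (Del.correct G g)))

  -- The minimality demanded by IsDist is supplied by the induction hypothesis.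
  deletionSet-small : (G : Graph n) (g : 𝒢 G) (S : Subset n) → Γ (G [ ∁ S ]) → ∣ deletionSet G g ∣ ≤ κ * ∣ S ∣
  deletionSet-small {n} G g S γ = ℕ.<-rec (λ d → ∀ S → ∣ S ∣ ≡ d → Γ (G [ ∁ S ]) → ∣ deletionSet G g ∣ ≤ κ * d) step ∣ S ∣ S refl γ
    where
    step : ∀ d → (∀ {d′} → d′ < d → ∀ S → ∣ S ∣ ≡ d′ → Γ (G [ ∁ S ]) → ∣ deletionSet G g ∣ ≤ κ * d′) →
      ∀ S → ∣ S ∣ ≡ d → Γ (G [ ∁ S ]) → ∣ deletionSet G g ∣ ≤ κ * d
    step d rec S eq γ = decidable-stable (_ ℕ.≤? _) λ ≰ → ≰
      (natural-bound Del.ρ κ ∣ deletionSet G g ∣ d (proj₂ (upper Del.ρ)) (proj₂ (proj₂ (proj₂ (Del.correct G g))) d ((S , eq , γ) , λ S′ γ′ →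
        ℕ.≮⇒≥ λ S′<d → ≰ (ℕ.≤-trans (rec S′<d S′ refl γ′) (ℕ.*-monoʳ-≤ κ (ℕ.<⇒≤ S′<d))))))

  deleted : (G : Graph n) → 𝒢 G → (S : Subset n) → Subset ∣ S ∣
  deleted G g S = deletionSet (G [ S ]) (induced-her 𝒢-her G S g)

  deleted-runs : (G : Graph n) (g : 𝒢 G) (S : Subset n) →
    Runs Del.algorithm (encodeGraph (G [ S ])) (encodeSubset (deleted G g S)) (Del.factor * suc ∣ S ∣ ^ Del.degree)
  deleted-runs G g S = fromSpec (proj₁ (proj₂ (Del.correct (G [ S ]) (induced-her 𝒢-her G S g))))

  feasible : (G : Graph n) → 𝒢 G → Candidate n → ℕ
  feasible G g σ = isEmpty (deleted G g (core σ))

  -- A purely multiplicative guarantee is exact where the empty set is a solution: at most `κ * 0`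
  -- vertices are deleted.
  Γ⇒isEmpty : (G : Graph n) (g : 𝒢 G) → Γ G → isEmpty (deletionSet G g) ≡ 1
  Γ⇒isEmpty {n} G g γ = ∣D∣≡0⇒isEmpty (deletionSet G g) (ℕ.n≤0⇒n≡0 (begin
    ∣ deletionSet G g ∣       ≤⟨ deletionSet-small G g Subset.⊥ (induced-her Γ-her G (∁ Subset.⊥) γ) ⟩
    κ * ∣ Subset.⊥ {n} ∣      ≡⟨ cong (κ *_) (Subset.∣⊥∣≡0 n) ⟩
    κ * 0                     ≡⟨ ℕ.*-zeroʳ κ ⟩
    0                         ∎))
    where open ℕ.≤-Reasoning

  isEmpty⇒Γ : (G : Graph n) (g : 𝒢 G) → isEmpty (deletionSet G g) ≡ 1 → Γ G
  isEmpty⇒Γ G g eq = embedded Γ-her (G [ ∁ S ]) G (proj₁ ∘ all)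
    (λ {u} {v} e → trans (sym (proj₂ (all u))) (trans (cong (members (∁ S)) e) (proj₂ (all v))))
    (λ u v → cong₂ (adj G) (sym (proj₂ (all u))) (sym (proj₂ (all v))))
    (deletionSet-Γ G g)
    where
    S = deletionSet G g
    all = λ v → index {S = ∁ S} (isEmpty⇒∈∁ S eq v)

  decodeSet : (G : Graph n) → 𝒢 G → ⟦ Object ⟧ᵗ → Subset n
  decodeSet {n} G g (inj₁ _) = baseSet G g
  decodeSet {n} G g (inj₂ c) = without (toSubset n c) (deleted G g (toSubset n c))

  decodeSet-Γ : (G : Graph n) (g : 𝒢 G) (c : ⟦ Object ⟧ᵗ) → Γ (G [ decodeSet G g c ])
  decodeSet-Γ     G g (inj₁ _) = baseSet-Γ G g
  decodeSet-Γ {n} G g (inj₂ c) = without-her Γ-her G (toSubset n c) _ (deletionSet-Γ (G [ toSubset n c ]) _)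

  decoder : Prog (graph ⊗ Object) vertices
  decoder = decoderProgram Base.algorithm Del.algorithm

  Instance : Set ℓ₂
  Instance = ∃ λ n → ∃ λ (G : Graph n) → 𝒢 G

  removalᶠ : Fast {I = Instance × List (⊤ ⊎ ⊤)} (proj₁ ∘ proj₁)
    (λ _ → pair snd (pair fst (swap ⨾ induced ⨾ Del.algorithm)) ⨾ removeDeleted)
    (λ ((n , G , g) , c) → c , encodeGraph G) (λ ((n , G , g) , c) → encodeSubset (decodeSet G g (inj₂ c)))
  removalᶠ =
    pairᶠ sndᶠ (pairᶠ fstᶠ (swapᶠ ⨾ᶠ
      inducedDeletionᶠ {s = proj₁} {n = proj₁} (λ _ → ℕ.≤-refl) (λ (n , G , g) → G) (λ (n , G , g) → deleted G g)
        {K = Del.factor} {Del.degree} (λ (n , G , g) → deleted-runs G g) proj₁ proj₂)) ⨾ᶠ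
    resultᶠ (λ ((n , G , g) , c) → survivors-encode _ c (deleted G g (toSubset n c)))
      (removeDeletedᶠ (length-encodeGraph (λ _ → ℕ.≤-refl) (λ ((n , G , g) , c) → G)))

  -- One polynomial for both kinds of object: the bounds of the branches are added, and 20 pays for
  -- the dispatch.
  decoderBound : PolyBounded id (λ n → (Base.factor * suc n ^ Base.degree) + removalᶠ .timePoly .scale * suc n ^ removalᶠ .timePoly .exponent + 20)
  decoderBound = poly-+ (poly-+ (polyBounded Base.factor Base.degree λ _ → ℕ.≤-refl)
    (polyBounded (removalᶠ .timePoly .scale) (removalᶠ .timePoly .exponent) λ _ → ℕ.≤-refl)) (poly-const 20)

  decodeTime : ℕ → ℕ
  decodeTime n = decoderBound .scale * suc n ^ decoderBound .exponent

  decoder-correct : (G : Graph n) (g : 𝒢 G) (c : ⟦ Object ⟧ᵗ) →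
    Runs decoder (encodeGraph G , c) (encodeSubset (decodeSet G g c)) (decodeTime n)
  decoder-correct {n} G g (inj₁ _) =
    within (ℕ.≤-trans (time≤ _ _) (decoderBound .bound n))
      (seq (straight swap refl) (onLeft (seq (straight snd refl) (fromSpec (proj₁ (proj₂ (Base.correct G g)))))))
    where
    rearrange : ∀ x y → 7 + x + y ≡ x + y + 7
    rearrange = solve-∀
    time≤ : ∀ x y → 7 + x ≤ x + y + 20
    time≤ x y = ℕ.≤-trans (ℕ.≤-trans (ℕ.m≤m+n (7 + x) y) (ℕ.≤-reflexive (rearrange x y))) (ℕ.+-monoʳ-≤ (x + y) (ℕ.m≤m+n 7 13))
  decoder-correct {n} G g (inj₂ c) =
    within (ℕ.≤-trans (time≤ (Base.factor * suc n ^ Base.degree) _ _ (removalᶠ .timePoly .bound ((n , G , g) , c))) (decoderBound .bound n))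
      (seq (straight swap refl) (onRight (removalᶠ .run ((n , G , g) , c))))
    where
    rearrange : ∀ x y → x + (5 + y) ≡ x + y + 5
    rearrange = solve-∀
    time≤ : ∀ x y t → t ≤ y → 5 + t ≤ x + y + 20
    time≤ x y t t≤y = ℕ.≤-trans (ℕ.≤-trans (ℕ.+-monoʳ-≤ 5 t≤y) (ℕ.m≤n+m (5 + y) x))
      (ℕ.≤-trans (ℕ.≤-reflexive (rearrange x y)) (ℕ.+-monoʳ-≤ (x + y) (ℕ.m≤m+n 5 15)))

  decode : Graph n → ⟦ Object ⟧ᵗ → Dist (Subset n)
  decode {n} G c =
    mapDist (toSubset n) (outputs decoder (encodeGraph G , c) (decodeTime n))

  decode-return : (G : Graph n) (g : 𝒢 G) (c : ⟦ Object ⟧ᵗ) → decode G c ≡ return (decodeSet G g c)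
  decode-return G g c = trans (cong (mapDist (toSubset _)) (outputs-spec decoder (encodeGraph G , c) (decodeTime _) (toSpec (decoder-correct G g c))))
    (cong return (toSubset-encode (decodeSet G g c)))

  feasible-exactly : (G : Graph n) (g : 𝒢 G) (S : Subset n) → Γ (G [ S ]) → feasible G g (exactly S) ≡ 1
  feasible-exactly G g S γ =
    subst (λ S → isEmpty (deleted G g S) ≡ 1) (sym (core-exactly S)) (Γ⇒isEmpty (G [ S ]) _ γ)

  feasible-mono : {G G′ : Graph n} (g : 𝒢 G) (g′ : 𝒢 G′) (σ τ : Candidate n) →
    (Γ (G [ core σ ]) → Γ (G′ [ core τ ])) → feasible G g σ ≤ feasible G′ g′ τ
  feasible-mono {G = G} {G′} g g′ σ τ imp with isEmpty-cases (deleted G g (core σ))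
  ... | inj₁ eq = subst (_≤ _) (sym eq) z≤n
  ... | inj₂ eq = ℕ.≤-reflexive (trans eq (sym (Γ⇒isEmpty (G′ [ core τ ]) _ (imp (isEmpty⇒Γ (G [ core σ ]) _ eq)))))

  -- The total weight of the feasible candidates

  chosenWeight omittedWeight : ℕ → ℕ
  chosenWeight  m = 2 ^ (m * suc κ)
  omittedWeight m = 2 ^ (m * κ)

  weighedSum : ℕ → (Candidate n → ℕ) → ℕ
  weighedSum {n} m = ∑ʷ (chosenWeight m) (omittedWeight m) n

  mass : ℕ → (G : Graph n) → 𝒢 G → ℕ
  mass m G g = weighedSum m (feasible G g)

  mass-large : ∀ m (G : Graph n) (g : 𝒢 G) (S : Subset n) → Γ (G [ S ]) → 1 ≤ mass m G g
  mass-large {n} m G g S γ = begin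
    1                                       ≤⟨ 1≤weight m κ (exactly S) ⟩
    w                                       ≡⟨ ℕ.*-identityʳ w ⟨
    w * 1                                   ≡⟨ cong (w *_) (feasible-exactly G g S γ) ⟨
    w * feasible G g (exactly S)            ≤⟨ term≤∑ n _ (exactly S) ⟩
    mass m G g                              ∎
    where
    open ℕ.≤-Reasoning
    w = weight (chosenWeight m) (omittedWeight m) (exactly S)

  1≤mass : ∀ m (G : Graph n) (g : 𝒢 G) → 1 ≤ mass m G g
  1≤mass m G g = mass-large m G g (baseSet G g) (baseSet-Γ G g)

  omitted≤ : ∀ m → omittedWeight m ≤ 2 ^ (m * suc κ)
  omitted≤ m = ℕ.^-monoʳ-≤ 2 (ℕ.*-monoʳ-≤ m (ℕ.n≤1+n κ))

  -- Bounds the digits of the total weight, and with them the cost of sampling.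
  mass-small : ∀ m (G : Graph n) (g : 𝒢 G) → mass m G g ≤ 2 ^ (2 * n + m * suc κ * n)
  mass-small {n} m G g = begin
    mass m G g                               ≤⟨ ∑-mono n bounded ⟩
    ∑ n (λ _ → 2 ^ (m * suc κ * n))          ≡⟨ ∑-const n _ ⟩
    3 ^ n * 2 ^ (m * suc κ * n)              ≤⟨ ℕ.*-monoˡ-≤ _ (3^n≤2^2n n) ⟩
    2 ^ (2 * n) * 2 ^ (m * suc κ * n)        ≡⟨ ℕ.^-distribˡ-+-* 2 (2 * n) (m * suc κ * n) ⟨
    2 ^ (2 * n + m * suc κ * n)              ∎
    where
    open ℕ.≤-Reasoning
    feasible≤1 : ∀ σ → feasible G g σ ≤ 1
    feasible≤1 σ with isEmpty-cases (deleted G g (core σ))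
    ... | inj₁ eq = subst (_≤ 1) (sym eq) z≤n
    ... | inj₂ eq = ℕ.≤-reflexive eq
    bounded : ∀ σ → weight (chosenWeight m) (omittedWeight m) σ * feasible G g σ ≤ 2 ^ (m * suc κ * n)
    bounded σ = ℕ.≤-trans (ℕ.*-mono-≤ (weight-≤ (m * suc κ) ℕ.≤-refl (omitted≤ m) σ) (feasible≤1 σ))
                          (ℕ.≤-reflexive (ℕ.*-identityʳ _))

  sampledSupport : ℕ → (G : Graph n) → 𝒢 G → Dist (List (⊤ ⊎ ⊤))
  sampledSupport m G g = sampled (weightedCandidates (chosenWeight m) (omittedWeight m) (deleted G g))

  -- The test involves only `n` and `k`, on which neighbours agree, so branching on it costs no
  -- privacy.
  object : ℕ → (G : Graph n) → 𝒢 G → ℕ → Dist ⟦ Object ⟧ᵗ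
  object     zero      G g k = return (inj₁ tt)
  object {n} m@(suc _) G g k = if n ≤ᵇ θ * k then mapDist inj₂ (sampledSupport m G g) else return (inj₁ tt)

  encoder : ℕ → Prog (graph ⊗ nat) Object
  encoder = encoderProgram Del.algorithm θ κ

  -- For `n ≤ θ * k`, the part `2 * θ` pays for the `3 ^ n ≤ 2 ^ (2 * n)` candidates. The summand 1
  -- makes `2 ^ (rate * k)` at least `k` and, for positive `k`, absorbs the 1 in the utility loss
  -- `2 * n + 1`.
  rate : ℕ
  rate = 2 * θ + 1

  -- The three factors separate in every power: the one in `m` becomes a constant depending on ε,
  -- the others become `2 ^ O(k)` and a power of `suc n`, with exponents independent of ε.
  size : (m n k : ℕ) → ℕ
  size m n k = suc (m * suc κ) * (2 ^ (rate * k) * suc n)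

  n≤size : ∀ m n k → suc (m * suc κ) * suc n ≤ size m n k
  n≤size m n k = ℕ.*-monoʳ-≤ (suc (m * suc κ)) (ℕ.m≤n*m (suc n) (2 ^ (rate * k)) {{ℕ.m^n≢0 2 (rate * k)}})

  2^≤size : ∀ m n k → 2 ^ (rate * k) ≤ size m n k
  2^≤size m n k = ℕ.≤-trans (ℕ.m≤m*n _ (suc n)) (ℕ.m≤n*m _ (suc (m * suc κ)))

  k≤size : ∀ m n k → k ≤ size m n k
  k≤size m n k = begin
    k               ≤⟨ n≤2^n k ⟩
    2 ^ k           ≤⟨ ℕ.^-monoʳ-≤ 2 (ℕ.≤-trans (ℕ.≤-reflexive (sym (ℕ.*-identityˡ k))) (ℕ.*-monoˡ-≤ k (ℕ.m≤n+m 1 (2 * θ)))) ⟩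
    2 ^ (rate * k)  ≤⟨ 2^≤size m n k ⟩
    size m n k      ∎
    where open ℕ.≤-Reasoning

  3^n≤size : ∀ m n k → n ≤ θ * k → 3 ^ n ≤ size m n k
  3^n≤size m n k n≤ = begin
    3 ^ n             ≤⟨ 3^n≤2^2n n ⟩
    2 ^ (2 * n)       ≤⟨ ℕ.^-monoʳ-≤ 2 (ℕ.*-monoʳ-≤ 2 n≤) ⟩
    2 ^ (2 * (θ * k)) ≤⟨ ℕ.^-monoʳ-≤ 2 (ℕ.≤-trans (ℕ.m≤m+n _ k) (ℕ.≤-reflexive (rearrange θ k))) ⟩
    2 ^ (rate * k)    ≤⟨ 2^≤size m n k ⟩
    size m n k        ∎
    where
    open ℕ.≤-Reasoning
    rearrange : ∀ θ k → 2 * (θ * k) + k ≡ (2 * θ + 1) * k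
    rearrange = solve-∀

  -- The leading component is one less than the budget, as budget 0 has a program of its own.
  EncoderInstance : Set ℓ₂
  EncoderInstance = ℕ × Instance × ℕ

  encoderSize : EncoderInstance → ℕ
  encoderSize (m , (n , _) , k) = size (suc m) n k

  samplerᶠ : FastRandom {I = ∃ λ ((_ , (n , _) , k) : EncoderInstance) → T (n ≤ᵇ θ * k)} (encoderSize ∘ proj₁)
    (λ ((m , _) , _) → snd {𝟙} ⨾ pair (enumerate (chosenWeight (suc m)) (omittedWeight (suc m))) skip ⨾
                         mapWith (weigh Del.algorithm) ⨾ sample ⨾ inr {A = 𝟙})
    (λ ((_ , (_ , G , _) , _) , _) → tt , encodeGraph G)
    (λ ((m , (_ , G , g) , _) , _) → mapDist inj₂ (sampledSupport (suc m) G g))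
  samplerᶠ =
    seqRandomlyᶠ sndᶠ (seqRandomlyᶠ
      (pairᶠ (enumerateᶠ {d = λ ((m , _) , _) → suc m * suc κ} few
                (λ ((m , (n , _) , k) , _) → ℕ.≤-trans (ℕ.*-monoˡ-≤ (suc n) (ℕ.n≤1+n (suc m * suc κ))) (n≤size (suc m) n k))
                (λ _ → ℕ.≤-refl) (λ ((m , _) , _) → omitted≤ (suc m))
                (λ ((_ , (_ , G , _) , _) , _) → List.length-tabulate _))
             skipᶠ)
      (seqRandomlyᶠ
        (weighᶠ n≤ (λ ((_ , (_ , G , _) , _) , _) → G) (λ ((_ , (_ , G , g) , _) , _) → deleted G g)
          {K = Del.factor} {Del.degree} (λ ((_ , (_ , G , g) , _) , _) → deleted-runs G g) few)
        (randomly-seqᶠ (λ _ _ → ⊤) (λ _ → inj₂) (λ _ → All.universal (λ _ → tt) _)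
          (sampleᶠ L
            (poly-mono (λ i@((_ , (n , _) , _) , _) → ℕ.≤-trans
              (ℕ.≤-reflexive (trans (List.length-map _ (candidates n)) (length-candidates n))) (few i)) poly-size)
            (poly-mono bits≤ (poly-+ (poly-const 1) (poly-+ (poly-* (poly-const 2) poly-size) poly-size)))
            (λ i@((m , (_ , G , g) , _) , _) → subst (1 ≤_) (sym (total≡ i)) (1≤mass (suc m) G g)))
          (straightᶠ (λ _ → inr) (λ _ → refl)))))
    where
    SmallInstance : Set ℓ₂
    SmallInstance = ∃ λ ((_ , (n , _) , k) : EncoderInstance) → T (n ≤ᵇ θ * k)

    L : SmallInstance → List (ℕ × List (⊤ ⊎ ⊤))
    L ((m , (_ , G , g) , _) , _) = weightedCandidates (chosenWeight (suc m)) (omittedWeight (suc m)) (deleted G g)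

    few : ∀ (((m , (n , _) , k) , _) : SmallInstance) → 3 ^ n ≤ size (suc m) n k
    few ((m , (n , _) , k) , small) = 3^n≤size (suc m) n k (ℕ.≤ᵇ⇒≤ n (θ * k) small)

    n≤ : ∀ (((m , (n , _) , k) , _) : SmallInstance) → n ≤ size (suc m) n k
    n≤ ((m , (n , _) , k) , _) = ℕ.≤-trans (ℕ.n≤1+n n) (ℕ.≤-trans (ℕ.m≤n*m (suc n) (suc (suc m * suc κ))) (n≤size (suc m) n k))

    total≡ : ∀ (i@((m , (_ , G , g) , _) , _) : SmallInstance) → total (L i) ≡ mass (suc m) G g
    total≡ ((m , (_ , G , g) , _) , _) = total-weightedCandidates _ _ (deleted G g)

    bits≤ : ∀ i → digits (total (L i)) ≤ 1 + (2 * encoderSize (proj₁ i) + encoderSize (proj₁ i))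
    bits≤ i@((m , (n , G , g) , k) , _) = begin
      digits (total (L i))                ≡⟨ cong digits (total≡ i) ⟩
      digits (mass (suc m) G g)           ≤⟨ digits-2^ (2 * n + suc m * suc κ * n) (mass-small (suc m) G g) ⟩
      1 + (2 * n + suc m * suc κ * n)     ≤⟨ s≤s (ℕ.+-mono-≤ (ℕ.*-monoʳ-≤ 2 (n≤ i))
                                              (ℕ.≤-trans (ℕ.*-mono-≤ (ℕ.n≤1+n (suc m * suc κ)) (ℕ.n≤1+n n)) (n≤size (suc m) n k))) ⟩
      1 + (2 * encoderSize (proj₁ i) + encoderSize (proj₁ i)) ∎
      where open ℕ.≤-Reasoning

  isSmall-encoderᶠ : Fast encoderSize (λ _ → isSmall θ) (λ (_ , (_ , G , _) , k) → encodeGraph G , k)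
    (λ (_ , (n , _) , k) → bit (n ≤ᵇ θ * k))
  isSmall-encoderᶠ = resultᶠ (λ (_ , (_ , G , _) , k) → cong (λ l → bit (l ≤ᵇ θ * k)) (length-graph G))
    (isSmallᶠ θ (λ (m , (n , G , _) , k) → ℕ.≤-trans (ℕ.≤-reflexive (length-graph G))
                  (ℕ.≤-trans (ℕ.n≤1+n n) (ℕ.≤-trans (ℕ.m≤n*m (suc n) (suc (suc m * suc κ))) (n≤size (suc m) n k))))
                (λ (m , (n , _) , k) → k≤size (suc m) n k))
    where
    length-graph : (G : Graph n) → length (encodeGraph G) ≡ n
    length-graph G = List.length-tabulate (λ u → List.tabulate (λ v → bit (adj G u v)))

  -- The running time of the encoder

  abstract
    -- Abstract, so that its scale and exponent, whose values do not matter, are never unfolded.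
    encoderᶠ : FastRandom encoderSize (λ (m , _) → encoder (suc m)) (λ (_ , (_ , G , _) , k) → encodeGraph G , k)
      (λ (m , (_ , G , g) , k) → object (suc m) G g k)
    encoderᶠ = seqRandomlyᶠ (pairᶠ isSmall-encoderᶠ fstᶠ)
      (guardᶠ (λ (_ , (n , _) , k) → n ≤ᵇ θ * k)
        {d = λ (m , (_ , G , g) , k) → mapDist inj₂ (sampledSupport (suc m) G g)} {y = λ _ → inj₁ tt}
        samplerᶠ (straightᶠ (λ _ → unit ⨾ inl) (λ _ → refl)))

  timeScale timeExponent timeRate : ℕ
  timeScale    = encoderᶠ .randomTimePoly .scale
  timeExponent = encoderᶠ .randomTimePoly .exponent
  timeRate     = rate * timeExponent

  -- The summand 3 is the cost of the program for budget 0.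
  timeFactor : ℕ → ℕ
  timeFactor m = 3 + timeScale * (2 * suc (m * suc κ)) ^ timeExponent

  encodeTime : (m n k : ℕ) → ℕ
  encodeTime m n k = timeFactor m * 2 ^ (timeRate * k) * suc n ^ timeExponent

  encodeTime-scale : ∀ n k x → x * (2 ^ (timeRate * k) * suc n ^ timeExponent) + 3 ≤
    (3 + x) * 2 ^ (timeRate * k) * suc n ^ timeExponent
  encodeTime-scale n k x = begin
    x * y + 3           ≤⟨ ℕ.+-monoʳ-≤ (x * y) (ℕ.*-monoʳ-≤ 3 {1} {y} (ℕ.*-mono-≤ (ℕ.m^n>0 2 (timeRate * k)) (ℕ.m^n>0 (suc n) timeExponent))) ⟩
    x * y + 3 * y       ≡⟨ rearrange x (2 ^ (timeRate * k)) (suc n ^ timeExponent) ⟩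
    (3 + x) * 2 ^ (timeRate * k) * suc n ^ timeExponent ∎
    where
    open ℕ.≤-Reasoning
    y = 2 ^ (timeRate * k) * suc n ^ timeExponent
    rearrange : ∀ x p q → x * (p * q) + 3 * (p * q) ≡ (3 + x) * p * q
    rearrange = solve-∀

  encoderTime≤ : ∀ (i@(m , (n , _) , k) : EncoderInstance) → encoderᶠ .randomTime i ≤ encodeTime (suc m) n k
  encoderTime≤ i@(m , (n , _) , k) = begin
    encoderᶠ .randomTime i                       ≤⟨ encoderᶠ .randomTimePoly .bound i ⟩
    timeScale * suc (size (suc m) n k) ^ e       ≤⟨ ℕ.*-monoʳ-≤ timeScale (ℕ.^-monoˡ-≤ e double) ⟩
    timeScale * (2 * suc δ * (p * suc n)) ^ e    ≡⟨ cong (timeScale *_) powers ⟩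
    timeScale * ((2 * suc δ) ^ e * (2 ^ (timeRate * k) * suc n ^ e)) ≡⟨ ℕ.*-assoc timeScale _ _ ⟨
    timeScale * (2 * suc δ) ^ e * (2 ^ (timeRate * k) * suc n ^ e)   ≤⟨ ℕ.m≤m+n _ 3 ⟩
    timeScale * (2 * suc δ) ^ e * (2 ^ (timeRate * k) * suc n ^ e) + 3
      ≤⟨ encodeTime-scale n k (timeScale * (2 * suc δ) ^ e) ⟩
    encodeTime (suc m) n k                       ∎
    where
    open ℕ.≤-Reasoning
    e = timeExponent
    δ = suc m * suc κ
    p = 2 ^ (rate * k)
    double : suc (size (suc m) n k) ≤ 2 * suc δ * (p * suc n)
    double = begin
      suc (size (suc m) n k)                     ≤⟨ ℕ.+-monoˡ-≤ (size (suc m) n k) (ℕ.*-mono-≤ {1} {suc δ} (s≤s z≤n) (ℕ.*-mono-≤ (ℕ.m^n>0 2 (rate * k)) (s≤s (z≤n {n})))) ⟩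
      size (suc m) n k + size (suc m) n k        ≡⟨ rearrange (suc δ) (p * suc n) ⟩
      2 * suc δ * (p * suc n)                    ∎
      where
      rearrange : ∀ x y → x * y + x * y ≡ 2 * x * y
      rearrange = solve-∀
    powers : (2 * suc δ * (p * suc n)) ^ e ≡ (2 * suc δ) ^ e * (2 ^ (timeRate * k) * suc n ^ e)
    powers = trans (^-distribʳ-* e (2 * suc δ) (p * suc n)) (cong ((2 * suc δ) ^ e *_)
      (trans (^-distribʳ-* e p (suc n)) (cong (_* suc n ^ e)
        (trans (ℕ.^-*-assoc 2 (rate * k) e) (cong (2 ^_) (exponents rate k e))))))
      where
      exponents : ∀ r k e → r * k * e ≡ r * e * k
      exponents = solve-∀

  encoder-correct : ∀ m (G : Graph n) (g : 𝒢 G) k →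
    RunsRandomly (encoder m) (encodeGraph G , k) (object m G g k) (encodeTime m n k)
  encoder-correct {n} zero G g k = withinRandomly (ℕ.≤-trans (ℕ.m≤n+m 3 _) (encodeTime-scale n k (timeScale * (2 * 1) ^ timeExponent))) (pointMass (straight (unit ⨾ inl) refl))
  encoder-correct {n} (suc m) G g k =
    withinRandomly (encoderTime≤ (m , (n , G , g) , k)) (encoderᶠ .randomRun (m , (n , G , g) , k))

  encode : ℕ → Graph n → ℕ → Dist ⟦ Object ⟧ᵗ
  encode {n} m G k = outputs (encoder m) (encodeGraph G , k) (encodeTime m n k)

  encode-object : ∀ m (G : Graph n) (g : 𝒢 G) k → encode m G k ≡ object m G g k
  encode-object m G g k =
    outputs-spec (encoder m) (encodeGraph G , k) (encodeTime m _ k) (toSpecRandomly (encoder-correct m G g k))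

  -- Privacy

  similar-weighedSum : ∀ m {G G′ : Graph n} (g : 𝒢 G) (g′ : 𝒢 G′) → Similar G G′ → (F : Subset n → ℕ) →
    weighedSum m (λ σ → feasible G g σ * F (support σ)) ≤
    suc (chosenWeight m) * weighedSum m (λ σ → feasible G′ g′ σ * F (support σ))
  similar-weighedSum {n} m {G} {G′} g g′ (inj₁ same) F = ℕ.≤-trans
    (∑-mono n λ σ → ℕ.*-monoʳ-≤ (weight (chosenWeight m) (omittedWeight m) σ)
      (ℕ.*-monoˡ-≤ (F (support σ)) (feasible-mono g g′ σ σ
        (embedded Γ-her _ _ id id λ i j → sym (same (members (core σ) i) (members (core σ) j))))))
    (ℕ.m≤n*m _ (suc (chosenWeight m)))
  similar-weighedSum m {G} {G′} g g′ (inj₂ (u , same)) F =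
    demote-∑ʷ (chosenWeight m) (omittedWeight m) u λ σ →
      subst (λ S → _ ≤ feasible G′ g′ (demote u σ) * F S) (sym (support-demote u σ))
        (ℕ.*-monoˡ-≤ (F (support σ)) (feasible-mono g g′ σ (demote u σ) (demote-her Γ-her G G′ u same σ)))

  -- The constant function of the support yields the normaliser, just as an indicator yields the
  -- weight of an event.
  similar-mass : ∀ m {G G′ : Graph n} (g : 𝒢 G) (g′ : 𝒢 G′) → Similar G G′ → mass m G g ≤ suc (chosenWeight m) * mass m G′ g′
  similar-mass {n} m {G} {G′} g g′ sim =
    subst₂ (λ x y → x ≤ suc (chosenWeight m) * y) (ones G g) (ones G′ g′) (similar-weighedSum m g g′ sim (λ _ → 1))
    where
    ones : ∀ G g → weighedSum m (λ σ → feasible G g σ * 1) ≡ mass m G g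
    ones G g = ∑-cong n λ σ → cong (weight (chosenWeight m) (omittedWeight m) σ *_) (ℕ.*-identityʳ (feasible G g σ))

  unsampled-private : ∀ {x} → 1ℚ ℚ.≤ x → (S : ⟦ Object ⟧ᵗ → Bool) → Pr (return (inj₁ tt)) S ℚ.≤ x ℚ.* Pr (return (inj₁ tt)) S
  unsampled-private {x} 1≤x S = q≤xq 1≤x (subst (0ℚ ℚ.≤_)
    (sym (trans (𝔼-return (inj₁ tt) (λ c → if S c then 1ℚ else 0ℚ)) (fromℕ-indicator (S (inj₁ tt))))) (fromℕ-nonNeg (indicator (S (inj₁ tt)))))

  sampledValue : ℕ → (G : Graph n) → 𝒢 G → (List (⊤ ⊎ ⊤) → ℕ) → ℚ
  sampledValue m G g F =
    + weighedSum m (λ σ → feasible G g σ * F (encodeSubset (support σ))) ℚ./ suc (mass m G g ∸ 1)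

  𝔼-sampledSupport : ∀ m (G : Graph n) (g : 𝒢 G) (f : ⟦ Object ⟧ᵗ → ℚ) (F : List (⊤ ⊎ ⊤) → ℕ) →
    (∀ x → f (inj₂ x) ≡ fromℕ (F x)) → 𝔼 (mapDist inj₂ (sampledSupport m G g)) f ≡ sampledValue m G g F
  𝔼-sampledSupport m G g f F eq = trans (𝔼-mapDist inj₂ (sampledSupport m G g) f)
    (𝔼-sampled (chosenWeight m) (omittedWeight m) (deleted G g) (f ∘ inj₂) F eq (1≤mass m G g))

  -- The factor is paid once in the numerator and once, with the graphs exchanged, in the
  -- normaliser; hence the square.
  sampled-private : ∀ m {G G′ : Graph n} (g : 𝒢 G) (g′ : 𝒢 G′) → Similar G G′ → ∀ {x} →
    fromℕ (suc (chosenWeight m) * suc (chosenWeight m)) ℚ.≤ x → (F : List (⊤ ⊎ ⊤) → ℕ) →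
    sampledValue m G g F ℚ.≤ x ℚ.* sampledValue m G′ g′ F
  sampled-private m {G} {G′} g g′ sim {x} β²≤x F = begin
    + v ℚ./ suc z                                ≤⟨ /-mono {v} {β * β * v′} {z} {z′} ratio ⟩
    + (β * β * v′) ℚ./ suc z′                    ≡⟨ fromℕ-*-/ (β * β) v′ z′ ⟨
    fromℕ (β * β) ℚ.* (+ v′ ℚ./ suc z′)
      ≤⟨ ℚ.*-monoʳ-≤-nonNeg (+ v′ ℚ./ suc z′) {{ℚ.nonNegative (/-mono {0} {v′} {0} {z′} z≤n)}} β²≤x ⟩
    x ℚ.* (+ v′ ℚ./ suc z′)                      ∎
    where
    open ℚ.≤-Reasoning
    β = suc (chosenWeight m)
    z = mass m G g ∸ 1
    z′ = mass m G′ g′ ∸ 1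
    v = weighedSum m (λ σ → feasible G g σ * F (encodeSubset (support σ)))
    v′ = weighedSum m (λ σ → feasible G′ g′ σ * F (encodeSubset (support σ)))
    suc-z : ∀ G g → suc (mass m G g ∸ 1) ≡ mass m G g
    suc-z G g = ℕ.m+[n∸m]≡n (1≤mass m G g)
    rearrange : ∀ β v z → β * v * (β * z) ≡ β * β * v * z
    rearrange = solve-∀
    ratio : v * suc z′ ≤ β * β * v′ * suc z
    ratio = subst₂ (λ a b → v * a ≤ β * β * v′ * b) (sym (suc-z G′ g′)) (sym (suc-z G g))
      (ℕ.≤-trans (ℕ.*-mono-≤ (similar-weighedSum m g g′ sim (F ∘ encodeSubset)) (similar-mass m g′ g (similar-sym {G = G} {G′} sim)))
                 (ℕ.≤-reflexive (rearrange β v′ (mass m G g))))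

  object-private : ∀ m {G G′ : Graph n} (g : 𝒢 G) (g′ : 𝒢 G′) → Similar G G′ → ∀ {x} →
    1ℚ ℚ.≤ x → (m ≢ 0 → fromℕ (suc (chosenWeight m) * suc (chosenWeight m)) ℚ.≤ x) →
    ∀ k S → Pr (object m G g k) S ℚ.≤ x ℚ.* Pr (object m G′ g′ k) S
  object-private     zero          g g′ sim 1≤x _    k S = unsampled-private 1≤x S
  object-private {n} m@(suc _) {G} {G′} g g′ sim {x} 1≤x β²≤x k S = compare (n ≤ᵇ θ * k)
    where
    F : List (⊤ ⊎ ⊤) → ℕ
    F c = indicator (S (inj₂ c))
    value : ∀ G g → Pr (mapDist inj₂ (sampledSupport m G g)) S ≡ sampledValue m G g F
    value G g = 𝔼-sampledSupport m G g _ F (λ c → fromℕ-indicator (S (inj₂ c)))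
    compare : ∀ b → Pr (if b then mapDist inj₂ (sampledSupport m G g) else return (inj₁ tt)) S ℚ.≤
                    x ℚ.* Pr (if b then mapDist inj₂ (sampledSupport m G′ g′) else return (inj₁ tt)) S
    compare false = unsampled-private 1≤x S
    compare true  = subst₂ (λ p q → p ℚ.≤ x ℚ.* q) (sym (value G g)) (sym (value G′ g′)) (sampled-private m g g′ sim (β²≤x λ ()) F)

  -- Utility

  decodedSize : (G : Graph n) → 𝒢 G → List (⊤ ⊎ ⊤) → ℕ
  decodedSize G g c = ∣ decodeSet G g (inj₂ c) ∣

  -- The noise is one solution of the deletion problem on the graph induced by the support, so the
  -- algorithm deletes at most `κ` times as many vertices, although the decoder never learns which
  -- vertices are noise.
  score≤decodedSize : (G : Graph n) (g : 𝒢 G) (σ : Candidate n) → feasible G g σ ≡ 1 →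
    score κ σ ≤ decodedSize G g (encodeSubset (support σ)) + κ * n
  score≤decodedSize {n} G g σ feas = ℕ.+-cancelʳ-≤ (κ * ∣ noise σ ∣) _ _ (begin
    score κ σ + κ * ∣ noise σ ∣                ≡⟨ score-noise κ σ ⟩
    ∣ core σ ∣ + κ * n                         ≤⟨ ℕ.+-monoˡ-≤ (κ * n) (core≤support σ) ⟩
    ∣ S ∣ + κ * n                              ≡⟨ cong (_+ κ * n) (∣without∣ S (deleted G g S)) ⟨
    ∣ without S (deleted G g S) ∣ + ∣ deleted G g S ∣ + κ * n
      ≤⟨ ℕ.+-monoˡ-≤ (κ * n) (ℕ.+-monoʳ-≤ ∣ without S (deleted G g S) ∣ few-deleted) ⟩
    ∣ without S (deleted G g S) ∣ + κ * ∣ noise σ ∣ + κ * n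
      ≡⟨ rearrange ∣ without S (deleted G g S) ∣ (κ * ∣ noise σ ∣) (κ * n) ⟩
    ∣ without S (deleted G g S) ∣ + κ * n + κ * ∣ noise σ ∣
      ≡⟨ cong (λ S → ∣ without S (deleted G g S) ∣ + κ * n + κ * ∣ noise σ ∣) (toSubset-encode S) ⟨
    decodedSize G g (encodeSubset S) + κ * n + κ * ∣ noise σ ∣ ∎)
    where
    open ℕ.≤-Reasoning
    S = support σ
    few-deleted : ∣ deleted G g S ∣ ≤ κ * ∣ noise σ ∣
    few-deleted = deletionSet-small (G [ S ]) _ (noise σ) (noise-her Γ-her G σ (isEmpty⇒Γ (G [ core σ ]) _ feas))
    rearrange : ∀ x y z → x + y + z ≡ x + z + y
    rearrange = solve-∀

  sampled-utility : ∀ m (G : Graph n) (g : 𝒢 G) {opt} → IsOpt Γ G opt →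
    m * opt * mass m G g ≤
    m * weighedSum m (λ σ → feasible G g σ * decodedSize G g (encodeSubset (support σ))) + suc (2 * n) * mass m G g
  sampled-utility {n} m G g {opt} ((S , ∣S∣≡opt , γ) , _) =
    utility m κ opt (feasible G g) (decodedSize G g ∘ encodeSubset ∘ support)
      (λ σ → [ inj₁ , (λ feas → inj₂ (feas , score≤decodedSize G g σ feas)) ]′ (isEmpty-cases (deleted G g (core σ))))
      (exactly S , feasible-exactly G g S γ , ℕ.≤-reflexive score-exactly)
    where
    open ≡-Reasoning
    score-exactly : opt + κ * n ≡ score κ (exactly S)
    score-exactly = begin
      opt + κ * n                                       ≡⟨ cong (_+ κ * n) (trans (cong ∣_∣ (core-exactly S)) ∣S∣≡opt) ⟨
      ∣ core (exactly S) ∣ + κ * n                      ≡⟨ score-noise κ (exactly S) ⟨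
      score κ (exactly S) + κ * ∣ noise (exactly S) ∣   ≡⟨ cong (λ x → score κ (exactly S) + κ * x) (noise-exactly S) ⟩
      score κ (exactly S) + κ * 0                       ≡⟨ cong (_+_ (score κ (exactly S))) (ℕ.*-zeroʳ κ) ⟩
      score κ (exactly S) + 0                           ≡⟨ ℕ.+-identityʳ _ ⟩
      score κ (exactly S)                               ∎

  -- For positive `m` the bound on ε is at most `20 * suc κ * m`, and the loss is at most
  -- `(2 * n + 1) / m`, hence at most `rate * k / m`. In the product of the two bounds `m` cancels.
  lossFactor : ℕ
  lossFactor = 20 * suc κ * rate

  -- Its successor bounds ε when m is about ε / (8 (1 + κ)).
  denominator : ℕ → ℕ
  denominator m = 8 * suc κ * suc m + 3

  sampled-bound : ∀ m (G : Graph n) (g : 𝒢 G) {opt} → IsOpt Γ G opt → ∀ k → k ≤ opt → n ≤ θ * k →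
    suc (denominator (suc m)) * (k * mass (suc m) G g) ≤
    suc (denominator (suc m)) *
      weighedSum (suc m) (λ σ → feasible G g σ * decodedSize G g (encodeSubset (support σ))) + lossFactor * (k * mass (suc m) G g)
  -- For `k = 0` the bound `2 * n + 1 ≤ rate * k` fails.
  sampled-bound m G g isOpt zero _ _ = ℕ.≤-trans (ℕ.≤-reflexive (ℕ.*-zeroʳ (suc (denominator (suc m))))) z≤n
  sampled-bound {n} m₋₁ G g {opt} isOpt k@(suc _) k≤opt n≤ = [ enough , (λ le → short (ℕ.m≤n⇒∃[o]m+o≡n le)) ]′ (ℕ.≤-total (k * mass m⁺ G g) value)
    where
    open ℕ.≤-Reasoning
    m⁺ = suc m₋₁
    d = suc (denominator m⁺)
    value = weighedSum m⁺ (λ σ → feasible G g σ * decodedSize G g (encodeSubset (support σ)))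
    d≤ : d ≤ 20 * suc κ * m⁺
    d≤ = ℕ.≤-trans (ℕ.m≤m+n d (12 * (suc κ * m₋₁) + 4 * κ)) (ℕ.≤-reflexive (rearrange κ m₋₁))
      where
      rearrange : ∀ κ m → suc (8 * suc κ * suc (suc m) + 3) + (12 * (suc κ * m) + 4 * κ) ≡ 20 * suc κ * suc m
      rearrange = solve-∀
    2n+1≤ : suc (2 * n) ≤ rate * k
    2n+1≤ = begin
      suc (2 * n)             ≤⟨ ℕ.+-mono-≤ {1} {k} (s≤s z≤n) (ℕ.*-monoʳ-≤ 2 n≤) ⟩
      k + 2 * (θ * k)         ≡⟨ collect θ k ⟩
      rate * k                ∎
      where
      collect : ∀ θ k → k + 2 * (θ * k) ≡ (2 * θ + 1) * k
      collect = solve-∀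
    enough : k * mass m⁺ G g ≤ value → d * (k * mass m⁺ G g) ≤ d * value + lossFactor * (k * mass m⁺ G g)
    enough le = ℕ.≤-trans (ℕ.*-monoʳ-≤ d le) (ℕ.m≤m+n _ _)
    -- `r` is the mass times the shortfall of the expected size below `k`; naming it replaces a
    -- subtraction.
    short : (∃ λ r → value + r ≡ k * mass m⁺ G g) → d * (k * mass m⁺ G g) ≤ d * value + lossFactor * (k * mass m⁺ G g)
    short (r , eq) = begin
      d * (k * mass m⁺ G g)                ≡⟨ cong (d *_) eq ⟨
      d * (value + r)                      ≡⟨ ℕ.*-distribˡ-+ d value r ⟩
      d * value + d * r                    ≤⟨ ℕ.+-monoʳ-≤ (d * value) (begin
        d * r                                ≤⟨ ℕ.*-monoˡ-≤ r d≤ ⟩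
        20 * suc κ * m⁺ * r                  ≡⟨ ℕ.*-assoc (20 * suc κ) m⁺ r ⟩
        20 * suc κ * (m⁺ * r)                ≤⟨ ℕ.*-monoʳ-≤ (20 * suc κ) mr≤ ⟩
        20 * suc κ * (rate * (k * mass m⁺ G g)) ≡⟨ ℕ.*-assoc (20 * suc κ) rate _ ⟨
        lossFactor * (k * mass m⁺ G g)       ∎) ⟩
      d * value + lossFactor * (k * mass m⁺ G g) ∎
      where
      mr≤ : m⁺ * r ≤ rate * (k * mass m⁺ G g)
      mr≤ = ℕ.+-cancelˡ-≤ (m⁺ * value) _ _ (begin
        m⁺ * value + m⁺ * r                              ≡⟨ ℕ.*-distribˡ-+ m⁺ value r ⟨
        m⁺ * (value + r)                                 ≡⟨ cong (m⁺ *_) eq ⟩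
        m⁺ * (k * mass m⁺ G g)                           ≤⟨ ℕ.*-monoʳ-≤ m⁺ (ℕ.*-monoˡ-≤ (mass m⁺ G g) k≤opt) ⟩
        m⁺ * (opt * mass m⁺ G g)                         ≡⟨ ℕ.*-assoc m⁺ opt _ ⟨
        m⁺ * opt * mass m⁺ G g                           ≤⟨ sampled-utility m⁺ G g isOpt ⟩
        m⁺ * value + suc (2 * n) * mass m⁺ G g           ≤⟨ ℕ.+-monoʳ-≤ (m⁺ * value) (ℕ.*-monoˡ-≤ (mass m⁺ G g) 2n+1≤) ⟩
        m⁺ * value + rate * k * mass m⁺ G g              ≡⟨ cong (_+_ (m⁺ * value)) (ℕ.*-assoc rate k _) ⟩
        m⁺ * value + rate * (k * mass m⁺ G g)            ∎)

  expectedSize : ℕ → (G : Graph n) → 𝒢 G → ℕ → ℚ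
  expectedSize m G g k = 𝔼 (object m G g k) (λ c → fromℕ ∣ decodeSet G g c ∣)

  decode-expectation : ∀ m (G : Graph n) (g : 𝒢 G) k →
    𝔼 (encode m G k >>= decode G) (λ S → fromℕ ∣ S ∣) ≡ expectedSize m G g k
  decode-expectation m G g k = begin
    𝔼 (encode m G k >>= decode G) (λ S → fromℕ ∣ S ∣)
      ≡⟨ cong (λ d → 𝔼 d (λ S → fromℕ ∣ S ∣))
           (trans (bind-cong (encode-object m G g k)) (bind-deterministic (decode-return G g) (object m G g k))) ⟩
    𝔼 (mapDist (decodeSet G g) (object m G g k)) (λ S → fromℕ ∣ S ∣)
      ≡⟨ 𝔼-mapDist (decodeSet G g) (object m G g k) _ ⟩
    expectedSize m G g k ∎
    where open ≡-Reasoning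

  unsampled-size : (G : Graph n) (g : 𝒢 G) → 𝔼 (return (inj₁ tt)) (λ c → fromℕ ∣ decodeSet G g c ∣) ≡ fromℕ ∣ baseSet G g ∣
  unsampled-size G g = 𝔼-return (inj₁ tt) (λ c → fromℕ ∣ decodeSet G g c ∣)

  expectedSize-large : ∀ m (G : Graph n) (g : 𝒢 G) {opt} → IsOpt Γ G opt → ∀ k → k ≤ opt →
    (1ℚ ℚ.- + lossFactor ℚ./ suc (denominator m)) ℚ.* fromℕ k ℚ.≤ expectedSize m G g k
  -- At budget 0 the constant exceeds the bound on ε, so the ratio is not positive and any solution
  -- will do.
  expectedSize-large zero G g isOpt k k≤opt = subst (_ ℚ.≤_) (sym (unsampled-size G g))
    (fraction-bound {lossFactor} {denominator 0} {k} {∣ baseSet G g ∣} {0}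
      (ℕ.≤-trans (ℕ.*-monoˡ-≤ (k * 1) d≤) (ℕ.m≤n+m _ _)))
    where
    rearrange : ∀ κ → suc (8 * suc κ * 1 + 3) + (8 + 12 * κ) ≡ 20 * suc κ
    rearrange = solve-∀
    d≤ : suc (denominator 0) ≤ lossFactor
    d≤ = ℕ.≤-trans (ℕ.m≤m+n _ (8 + 12 * κ)) (ℕ.≤-trans (ℕ.≤-reflexive (rearrange κ))
      (ℕ.m≤m*n (20 * suc κ) rate {{>-nonZero (ℕ.m≤n+m 1 (2 * θ))}}))
  expectedSize-large {n} m@(suc m₋₁) G g {opt} isOpt k k≤opt = compare (n ≤ᵇ θ * k) refl
    where
    value : ℕ
    value = weighedSum m (λ σ → feasible G g σ * decodedSize G g (encodeSubset (support σ)))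

    sampled≥ : n ≤ θ * k →
      (1ℚ ℚ.- + lossFactor ℚ./ suc (denominator m)) ℚ.* fromℕ k ℚ.≤ sampledValue m G g (decodedSize G g)
    sampled≥ n≤ = fraction-bound {lossFactor} {denominator m} {k} {value} {mass m G g ∸ 1}
      (subst (λ z → suc (denominator m) * (k * z) ≤ suc (denominator m) * value + lossFactor * (k * z))
        (sym (ℕ.m+[n∸m]≡n (1≤mass m G g))) (sampled-bound m₋₁ G g isOpt k k≤opt n≤))

    k≤base : θ * k < n → k ≤ ∣ baseSet G g ∣
    k≤base θk<n = ℕ.<⇒≤ (ℕ.*-cancelˡ-< θ k _ (ℕ.<-≤-trans θk<n (baseSet-large G g)))

    unsampled≥ : θ * k < n →
      (1ℚ ℚ.- + lossFactor ℚ./ suc (denominator m)) ℚ.* fromℕ k ℚ.≤ fromℕ ∣ baseSet G g ∣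
    unsampled≥ θk<n = fraction-bound {lossFactor} {denominator m} {k} {∣ baseSet G g ∣} {0}
      (ℕ.≤-trans (ℕ.*-monoʳ-≤ (suc (denominator m)) (ℕ.≤-trans (ℕ.≤-reflexive (ℕ.*-identityʳ k)) (k≤base θk<n))) (ℕ.m≤m+n _ _))

    compare : ∀ b → (n ≤ᵇ θ * k) ≡ b → (1ℚ ℚ.- + lossFactor ℚ./ suc (denominator m)) ℚ.* fromℕ k ℚ.≤
      𝔼 (if b then mapDist inj₂ (sampledSupport m G g) else return (inj₁ tt)) (λ c → fromℕ ∣ decodeSet G g c ∣)
    compare true  eq = subst (_ ℚ.≤_) (sym (𝔼-sampledSupport m G g _ (decodedSize G g) (λ _ → refl)))
      (sampled≥ (ℕ.≤ᵇ⇒≤ n (θ * k) (subst T (sym eq) tt)))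
    compare false eq = subst (_ ℚ.≤_) (sym (unsampled-size G g))
      (unsampled≥ (ℕ.≰⇒> λ n≤ → contradiction (trans (sym (≤ᵇ-true n≤)) eq) λ ()))

  -- The choice of the budget

  module _ (ε : ℝ) (ε≥1 : ε ≥1) where

    -- With `d = m (1 + κ)`, privacy needs `(1 + 2 ^ d) ^ 2` below the exponential of ε. The square
    -- is at most `2 ^ (4 d)` for positive `d`, and the series reaches `2 ^ M` when ε is at least
    -- `2 M`; so `8 d ≤ ε` suffices, which is the origin of the divisor `8 * suc κ`.
    budget : ℕ
    budget = proj₁ (quotient ε (8 * suc κ))

    private
      power : ℕ
      power = 4 * (budget * suc κ)

      exp-large : budget ≢ 0 → ∀ i → power ≤ i → fromℕ (2 ^ power) ℚ.≤ exp ε i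
      exp-large budget≢0 i = expPartialSum-large {M = power} (ℚ.≤-trans
        (ℚ.≤-reflexive (cong fromℕ (rearrange budget κ))) (proj₁ (proj₂ (quotient ε (8 * suc κ))) budget≢0 i)) i
        where
        rearrange : ∀ b κ → 2 * (4 * (b * suc κ)) ≡ 8 * suc κ * b
        rearrange = solve-∀

      ratio≤ : budget ≢ 0 → suc (chosenWeight budget) * suc (chosenWeight budget) ≤ 2 ^ power
      ratio≤ budget≢0 = begin
        suc (2 ^ d) * suc (2 ^ d)       ≤⟨ ℕ.*-mono-≤ suc≤ suc≤ ⟩
        2 ^ (d + d) * 2 ^ (d + d)       ≡⟨ ℕ.^-distribˡ-+-* 2 (d + d) (d + d) ⟨
        2 ^ (d + d + (d + d))           ≡⟨ cong (2 ^_) (rearrange d) ⟩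
        2 ^ power                    ∎
        where
        open ℕ.≤-Reasoning
        d = budget * suc κ
        rearrange : ∀ d → d + d + (d + d) ≡ 4 * d
        rearrange = solve-∀
        -- For `d = 0` the estimate `1 + 2 ^ d ≤ 2 ^ (d + d)` would read `2 ≤ 1`, so a positive
        -- budget is essential.
        1≤d : 1 ≤ d
        1≤d = ℕ.*-mono-≤ (ℕ.n≢0⇒n>0 budget≢0) (s≤s (z≤n {κ}))
        suc≤ : suc (2 ^ d) ≤ 2 ^ (d + d)
        suc≤ = begin
          suc (2 ^ d)          ≤⟨ ℕ.+-monoˡ-≤ (2 ^ d) (ℕ.m^n>0 2 d) ⟩
          2 ^ d + 2 ^ d        ≡⟨ cong (_+_ (2 ^ d)) (ℕ.+-identityʳ (2 ^ d)) ⟨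
          2 ^ suc d            ≤⟨ ℕ.^-monoʳ-≤ 2 (ℕ.+-monoˡ-≤ d 1≤d) ⟩
          2 ^ (d + d)          ∎

      large-budget : ∀ i → power ≤ i → budget ≢ 0 → fromℕ (suc (chosenWeight budget) * suc (chosenWeight budget)) ℚ.≤ exp ε i
      large-budget i i≥ budget≢0 = ℚ.≤-trans
        (fromℕ-mono {suc (chosenWeight budget) * suc (chosenWeight budget)} {2 ^ power} (ratio≤ budget≢0)) (exp-large budget≢0 i i≥)

    encode-differentially-private : ∀ k → DifferentiallyPrivate 𝒢 ε (λ G → encode budget G k)
    encode-differentially-private k G G′ g g′ G∼G′ S = eventually (N + power) λ i i≥ →
      subst₂ (λ d d′ → Pr d S ℚ.≤ exp ε i ℚ.* Pr d′ S)
        (sym (encode-object budget G g k)) (sym (encode-object budget G′ g′ k))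
        (object-private budget g g′ (neighbours-similar G G′ G∼G′)
          (proj₂ (exp-≥1 ε ε≥1) i (ℕ.≤-trans (ℕ.m≤m+n N power) i≥))
          (large-budget i (ℕ.≤-trans (ℕ.m≤n+m power N) i≥)) k S)
      where N = proj₁ (exp-≥1 ε ε≥1)

    scheme : ImplicitRepresentationScheme Γ 𝒢 ε
    scheme = record
      { Object         = Object
      ; Space          = λ _ → ⊤
      ; encode         = encode budget
      ; encoder        = encoder budget
      ; encodeTime     = encodeTime budget
      ; encoder-runs   = λ G g k → subst (λ d → encoder budget ⟨ encodeGraph G , k ⟩⇓[ encodeTime budget _ k ] d)
                           (sym (encode-object budget G g k)) (toSpecRandomly (encoder-correct budget G g k))
      ; encode-space   = λ G g k → All.universal (λ _ → tt) _
      ; encode-private = encode-differentially-private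
      ; decode         = decode
      ; decoder        = decoder
      ; factor         = decoderBound .scale
      ; degree         = decoderBound .exponent
      ; decoder-runs   = λ G g c _ → subst (λ d → decoder ⟨ encodeGraph G , c ⟩⇓[ decodeTime _ ] mapDist encodeSubset d)
                           (sym (decode-return G g c)) (toSpec (decoder-correct G g c))
      ; decode-valid   = λ G g c _ → subst (Always (λ S → Γ (G [ S ]))) (sym (decode-return G g c)) (decodeSet-Γ G g c ∷ [])
      }

    scheme-approximation : IsApproximation Γ 𝒢 scheme (1- lossFactor / ε)
    scheme-approximation G g opt isOpt k k≤opt = eventually 0 λ i _ →
      subst ((1- lossFactor / ε) i ℚ.* fromℕ k ℚ.≤_) (sym (decode-expectation budget G g k))
        (ℚ.≤-trans (ℚ.*-monoʳ-≤-nonNeg (fromℕ k) {{ℚ.nonNegative (fromℕ-nonNeg k)}}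
                      (ratio-bound lossFactor ε (denominator budget) i (proj₂ (proj₂ (quotient ε (8 * suc κ))) i)))
                   (expectedSize-large budget G g isOpt k k≤opt))

-- The order of the quantifiers expresses the uniformity of the asymptotic bounds: `c`, `b` and `e`
-- are fixed before ε, and only the factor `a` may grow with ε, as the digits of the weights do.
theorem19 : ∀ {ℓ₁ ℓ₂} (Γ : GraphPredicate ℓ₁) (𝒢 : GraphPredicate ℓ₂) →
    Hereditary Γ → Hereditary 𝒢 →
    LargeBaseline Γ 𝒢 → DeletionApproximation Γ 𝒢 →
    ∃[ c ] ∃[ b ] ∃[ e ] ∀ (ε : ℝ) → ε ≥1 →
    ∃ λ (Π : ImplicitRepresentationScheme Γ 𝒢 ε) →
    IsFPTApproximation Γ 𝒢 Π (1- c / ε) ×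
    (∃[ a ] ∀ n k →
    ImplicitRepresentationScheme.encodeTime Π n k ≤ a * 2 ^ (b * k) * suc n ^ e)
theorem19 Γ 𝒢 Γ-her 𝒢-her baseline approximation =
  lossFactor , timeRate , timeExponent , λ ε ε≥1 →
    scheme ε ε≥1 ,
    (scheme-approximation ε ε≥1 ,
     (λ k → timeFactor (budget ε ε≥1) * 2 ^ (timeRate * k)) , timeExponent , λ n k → ℕ.≤-refl) ,
    timeFactor (budget ε ε≥1) , λ n k → ℕ.≤-refl
  where open Scheme Γ 𝒢 Γ-her 𝒢-her baseline approximation
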